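{- Let $\Phi=(G,\varphi)$ be a complex unit gain graph of order $n$ with $r(\Phi)=r(G)+2\theta(G)$. Then (i) the cycles (if any) of $G$ are pairwise vertex-disjoint; (ii) each cycle $C_p^{\varphi}$ of $\Phi$ is of Type B with order $p\equiv 0\pmod 4$; (iii) $r(G)=r(T_G)+\sum_{O\in\mathcal{C}(G)}(|V(O)|-2)$ and $r(T_G)=r(\Gamma_G)$.
   Context: A complex unit gain graph $\Phi=(G,\varphi)$ consists of a finite simple graph $G$ with vertex set $\{v_1,\dots,v_n\}$ and a gain function $\varphi$ assigning to each oriented edge $e_{ij}$ ($v_iv_j\in E(G)$) a complex number of modulus $1$ with $\varphi(e_{ji})=\overline{\varphi(e_{ij})}$. $A(\Phi)$ is the Hermitian matrix with $(i,j)$ entry $\varphi(e_{ij})$ if $v_iv_j\in E(G)$ and $0$ otherwise; $r(\Phi)$ is its rank; $r(\cdot)$ of a simple graph is the rank of its $0$-$1$ adjacency matrix. $\theta(G)=|E(G)|-|V(G)|+\omega(G)$, $\omega(G)$ the number of components. For a gain cycle with vertices $v_1,\dots,v_p$ in cyclic order, $\varphi(C_p)=\varphi(e_{12})\cdots\varphi(e_{p1})$; for $p$ even it is of Type B if $\varphi(C_p)\neq(-1)^{p/2}$. For a graph $G$ whose cycles are pairwise vertex-disjoint, $\mathcal{C}(G)$ is its set of cycles, and $T_G$ is the acyclic graph obtained by contracting each cycle $O$ to a vertex $t_O$: its vertex set is $U\cup C_G$, where $U$ is the set of vertices of $G$ on no cycle and $C_G=\{t_O:O\in\mathcal{C}(G)\}$;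 $u_1,u_2\in U$ are adjacent iff $u_1u_2\in E(G)$; $u\in U$ is adjacent to $t_O$ iff $u$ is adjacent in $G$ to some vertex of $O$; $t_{O_1},t_{O_2}$ are adjacent iff some edge of $G$ joins a vertex of $O_1$ to a vertex of $O_2$. $\Gamma_G$ is obtained from $T_G$ by deleting the vertices of $C_G$ and their incident edges. -}

module Defs where

open import Algebra.Bundles using (RawRing)
import Algebra.Definitions.RawMonoid as RawMonoidDefs
import Algebra.Definitions.RawSemiring as RawSemiringDefs
open import Algebra.Structures using (IsCommutativeRing)
open import Data.Bool.Base using (if_then_else_)
open import Data.Fin.Base using (Fin)
import Data.Fin.Properties as Fin
open import Data.Integer.Base as ℤ using (ℤ; +_)
open import Data.List.Base using (List; []; _∷_; [_]; _++_; _∷ʳ_; length; map; foldr;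
  zip; filter; allFin; upTo; cartesianProduct; cartesianProductWith; concatMap; deduplicate; lookup)
open import Data.List.Membership.Propositional using (_∈_; _∉_)
open import Data.List.Membership.Propositional.Properties using (∈-allFin)
open import Data.List.Relation.Binary.Subset.Propositional using (_⊆_)
import Data.List.Relation.Binary.Subset.DecPropositional as DecSubset
open import Data.List.Relation.Unary.All using (All; all?)
open import Data.List.Relation.Unary.Any using (Any; any?; here; there)
import Data.List.Relation.Unary.Any as Any
open import Data.List.Relation.Unary.Unique.Propositional using (Unique)
import Data.List.Relation.Unary.Unique.DecPropositional as DecUnique
open import Data.Nat.Base as ℕ using (ℕ; zero; suc; _∸_; _/_)
import Data.Nat.Properties as ℕ
open import Data.Nat.Divisibility using (_∣_)
open import Data.Product.Base using (Σ-syntax; ∃-syntax; _×_; _,_; proj₁; proj₂; swap)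
open import Data.Product.Properties using (≡-dec)
open import Data.Refinement.Base using (Refinement-syntax; value)
open import Data.Sum.Base using (_⊎_; inj₁; inj₂)
open import Level using (0ℓ)
open import Relation.Binary.Construct.Closure.ReflexiveTransitive using (Star; ε; _◅_; _◅◅_)
open import Relation.Binary.Core using (Rel)
open import Relation.Binary.Definitions using (Decidable; Symmetric; Irreflexive)
open import Relation.Binary.PropositionalEquality using (_≡_; _≢_; refl; sym)
open import Relation.Binary.Structures using (IsDecTotalOrder)
open import Relation.Nullary using (¬_; Dec; yes; no; does)
open import Relation.Nullary.Decidable using (¬?; _×-dec_; _⊎-dec_; map′)
open import Relation.Unary using (Pred)

------------------------------------------------------------------------
-- Real and complex numbers

-- The real numbers, given by their categorical axiomatisation as an
-- ordered field with the least upper bound property.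

record CompleteOrderedField : Set₁ where
  infix  4 _≈_ _≤_
  infixl 6 _+_
  infixl 7 _*_
  infix  8 -_
  field
    Carrier : Set
    _≈_ _≤_ : Rel Carrier 0ℓ
    _+_ _*_ : Carrier → Carrier → Carrier
    -_      : Carrier → Carrier
    0# 1#   : Carrier
    isCommutativeRing : IsCommutativeRing _≈_ _+_ _*_ -_ 0# 1#
    isDecTotalOrder   : IsDecTotalOrder _≈_ _≤_
    0≉1     : ¬ (0# ≈ 1#)
    inverse : ∀ x → ¬ (x ≈ 0#) → ∃[ y ] x * y ≈ 1#
    +-monoˡ-≤ : ∀ z {x y} → x ≤ y → x + z ≤ y + z
    *-nonNeg  : ∀ {x y} → 0# ≤ x → 0# ≤ y → 0# ≤ x * y

  IsUpperBound : Pred Carrier 0ℓ → Pred Carrier 0ℓ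
  IsUpperBound P b = ∀ x → P x → x ≤ b

  field
    supremum : (P : Pred Carrier 0ℓ) → (∃[ x ] P x) → (∃[ b ] IsUpperBound P b) →
               ∃[ s ] (IsUpperBound P s × (∀ b → IsUpperBound P b → s ≤ b))

module Complex (ℝ : CompleteOrderedField) where
  private module ℝ = CompleteOrderedField ℝ

  infix 5 _+i_
  record ℂ : Set where
    constructor _+i_
    field
      re im : ℝ.Carrier
  open ℂ public

  infix  4 _≈_
  infixl 6 _+_
  infixl 7 _*_
  infix  8 -_

  _≈_ : Rel ℂ 0ℓ
  z ≈ w = (re z ℝ.≈ re w) × (im z ℝ.≈ im w)

  _+_ _*_ : ℂ → ℂ → ℂ
  (a +i b) + (c +i d) = (a ℝ.+ c) +i (b ℝ.+ d)
  (a +i b) * (c +i d) = (a ℝ.* c ℝ.+ ℝ.- (b ℝ.* d)) +i (a ℝ.* d ℝ.+ b ℝ.* c)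

  -_ conj : ℂ → ℂ
  - (a +i b)    = (ℝ.- a) +i (ℝ.- b)
  conj (a +i b) = a +i (ℝ.- b)

  0# 1# : ℂ
  0# = ℝ.0# +i ℝ.0#
  1# = ℝ.1# +i ℝ.0#

  -- m = |z|, i.e. m is the nonnegative square root of re(z)² + im(z)².
  IsModulus : ℂ → ℝ.Carrier → Set
  IsModulus z m = (ℝ.0# ℝ.≤ m) × (m ℝ.* m ℝ.≈ re z ℝ.* re z ℝ.+ im z ℝ.* im z)

  rawRing : RawRing 0ℓ 0ℓ
  rawRing = record
    { Carrier = ℂ ; _≈_ = _≈_ ; _+_ = _+_ ; _*_ = _*_ ; -_ = -_ ; 0# = 0# ; 1# = 1# }

  open RawRing rawRing using (+-rawMonoid; rawSemiring)
  open RawMonoidDefs +-rawMonoid public using () renaming (sum to ∑)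
  open RawSemiringDefs rawSemiring public using (_^_)

  LinearlyIndependent : {I : Set} {k : ℕ} → (Fin k → I → ℂ) → Set
  LinearlyIndependent {I} {k} v =
    (a : Fin k → ℂ) → (∀ i → ∑ (λ l → a l * v l i) ≈ 0#) → ∀ l → a l ≈ 0#

  InSpan : {I : Set} {k : ℕ} → (I → ℂ) → (Fin k → I → ℂ) → Set
  InSpan {I} {k} w v =
    Σ[ a ∈ (Fin k → ℂ) ] (∀ i → w i ≈ ∑ (λ l → a l * v l i))

  -- M has rank r: some r columns of M form a basis of its column space.
  HasRank : {I J : Set} → (I → J → ℂ) → ℕ → Set
  HasRank {I} {J} M r =
    Σ[ c ∈ (Fin r → J) ]
      (LinearlyIndependent (λ l i → M i (c l)) ×
       (∀ j → InSpan (λ i → M i j) (λ l i → M i (c l))))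

------------------------------------------------------------------------
-- Simple graphs

record Graph (V : Set) : Set₁ where
  infix 4 _~_ _~?_
  field
    _~_    : Rel V 0ℓ
    _~?_   : Decidable _~_
    sym-~  : Symmetric _~_
    irrefl : Irreflexive _≡_ _~_

induced : {V W : Set} → Graph V → (W → V) → Graph W
induced G f = record
  { _~_    = λ x y → f x ~ f y
  ; _~?_   = λ x y → f x ~? f y
  ; sym-~  = sym-~
  ; irrefl = λ { refl → irrefl refl }
  } where open Graph G

-- Decidability of connectedness: Reach ws x y says that some walk from
-- x to y has all its interior vertices in ws.

module _ {V : Set} (G : Graph V) (_≟_ : Decidable (_≡_ {A = V})) where
  open Graph G

  private
    Reach : List V → V → V → Set
    Reach []       x y = (x ≡ y) ⊎ (x ~ y)
    Reach (w ∷ ws) x y = Reach ws x y ⊎ (Reach ws x w × Reach ws w y)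

    reach? : ∀ ws → Decidable (Reach ws)
    reach? []       x y = (x ≟ y) ⊎-dec (x ~? y)
    reach? (w ∷ ws) x y = reach? ws x y ⊎-dec (reach? ws x w ×-dec reach? ws w y)

    sound : ∀ ws {x y} → Reach ws x y → Star _~_ x y
    sound []       (inj₁ refl)    = ε
    sound []       (inj₂ e)       = e ◅ ε
    sound (w ∷ ws) (inj₁ p)       = sound ws p
    sound (w ∷ ws) (inj₂ (p , q)) = sound ws p ◅◅ sound ws q

    base : ∀ ws {x y} → (x ≡ y) ⊎ (x ~ y) → Reach ws x y
    base []       p = p
    base (w ∷ ws) p = inj₁ (base ws p)

    trans-via : ∀ {ws w x y} → w ∈ ws → Reach ws x w → Reach ws w y → Reach ws x y
    trans-via {h ∷ ws} (here refl) p q = inj₂ (toHead p , fromHead q)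
      where
      toHead : ∀ {x} → Reach (h ∷ ws) x h → Reach ws x h
      toHead (inj₁ p)       = p
      toHead (inj₂ (p , _)) = p
      fromHead : ∀ {y} → Reach (h ∷ ws) h y → Reach ws h y
      fromHead (inj₁ q)       = q
      fromHead (inj₂ (_ , q)) = q
    trans-via (there m) (inj₁ p)        (inj₁ q)        = inj₁ (trans-via m p q)
    trans-via (there m) (inj₁ p)        (inj₂ (q , q′)) = inj₂ (trans-via m p q , q′)
    trans-via (there m) (inj₂ (p , p′)) (inj₁ q)        = inj₂ (p , trans-via m p′ q)
    trans-via (there m) (inj₂ (p , _))  (inj₂ (_ , q′)) = inj₂ (p , q′)

    complete : ∀ {ws} → (∀ x → x ∈ ws) → ∀ {x y} → Star _~_ x y → Reach ws x y
    complete {ws} all∈ ε        = base ws (inj₁ refl)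
    complete {ws} all∈ (_◅_ {j = z} e p) =
      trans-via (all∈ z) (base ws (inj₂ e)) (complete all∈ p)

  connected? : (vs : List V) → (∀ x → x ∈ vs) → Decidable (Star _~_)
  connected? vs all∈ x y = map′ (sound vs) (complete all∈) (reach? vs x y)

-- The vertices are 0, …, n-1.

module FiniteGraph {n : ℕ} (G : Graph (Fin n)) where
  open Graph G

  ∣E∣ : ℕ
  ∣E∣ = length (filter (λ (u , v) → (u Fin.<? v) ×-dec (u ~? v))
                       (cartesianProduct (allFin n) (allFin n)))

  components : List (Fin n)
  components = deduplicate (connected? G Fin._≟_ (allFin n) ∈-allFin) (allFin n)

  ω : ℕ
  ω = length components

  θ : ℤ
  θ = + ∣E∣ ℤ.- + n ℤ.+ + ω

  -- A cycle is traversed by the list v₁ , … , vₚ of its vertices in cyclic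
  -- order; its steps are (v₁ , v₂) , … , (vₚ , v₁).

  steps : List (Fin n) → List (Fin n × Fin n)
  steps []       = []
  steps (v ∷ vs) = zip (v ∷ vs) (vs ∷ʳ v)

  IsCycle : List (Fin n) → Set
  IsCycle c = (3 ℕ.≤ length c) × Unique c × All (λ (u , v) → u ~ v) (steps c)

  isCycle? : ∀ c → Dec (IsCycle c)
  isCycle? c = (3 ℕ.≤? length c) ×-dec
               (DecUnique.unique? Fin._≟_ c ×-dec all? (λ (u , v) → u ~? v) (steps c))

  -- Two lists describe the same cycle of G (they may differ in starting
  -- point and direction) when they traverse the same set of edges.

  orientedEdges : List (Fin n) → List (Fin n × Fin n)
  orientedEdges c = steps c ++ map swap (steps c)

  SameCycle : Rel (List (Fin n)) 0ℓ
  SameCycle c d = (orientedEdges c ⊆ orientedEdges d) × (orientedEdges d ⊆ orientedEdges c)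

  sameCycle? : Decidable SameCycle
  sameCycle? c d = (orientedEdges c ⊆? orientedEdges d) ×-dec (orientedEdges d ⊆? orientedEdges c)
    where open DecSubset (≡-dec Fin._≟_ Fin._≟_) using (_⊆?_)

  PairwiseDisjointCycles : Set
  PairwiseDisjointCycles =
    ∀ c d → IsCycle c → IsCycle d → ¬ SameCycle c d → ∀ v → v ∈ c → v ∉ d

  sequences : ℕ → List (List (Fin n))
  sequences zero    = [ [] ]
  sequences (suc k) = cartesianProductWith _∷_ (allFin n) (sequences k)

  -- One list for every cycle of G; a cycle has at most n vertices.

  𝒞 : List (List (Fin n))
  𝒞 = deduplicate sameCycle? (filter isCycle? (concatMap sequences (upTo (suc n))))

  U : Set
  U = [ v ∈ Fin n ∣ ¬ (∃[ c ] (IsCycle c × v ∈ c)) ]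

  -- The index k stands for the contracted cycle O k.

  C : Set
  C = Fin (length 𝒞)

  O : C → List (Fin n)
  O = lookup 𝒞

  -- Adjacency in T. Distinctness of the two cycles is required, since the
  -- edges of a cycle itself would otherwise produce loops.

  Adj : Rel (U ⊎ C) 0ℓ
  Adj (inj₁ u) (inj₁ v) = value u ~ value v
  Adj (inj₁ u) (inj₂ k) = Any (value u ~_) (O k)
  Adj (inj₂ k) (inj₁ u) = Any (value u ~_) (O k)
  Adj (inj₂ k) (inj₂ l) = k ≢ l × Any (λ x → Any (x ~_) (O l)) (O k)

  adj? : Decidable Adj
  adj? (inj₁ u) (inj₁ v) = value u ~? value v
  adj? (inj₁ u) (inj₂ k) = any? (value u ~?_) (O k)
  adj? (inj₂ k) (inj₁ u) = any? (value u ~?_) (O k)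
  adj? (inj₂ k) (inj₂ l) = ¬? (k Fin.≟ l) ×-dec any? (λ x → any? (x ~?_) (O l)) (O k)

  private
    flip-any : ∀ {xs ys} → Any (λ x → Any (x ~_) ys) xs → Any (λ y → Any (y ~_) xs) ys
    flip-any {x ∷ xs} (here p)  = Any.map (λ e → here (sym-~ e)) p
    flip-any {x ∷ xs} (there p) = Any.map there (flip-any p)

  adj-sym : Symmetric Adj
  adj-sym {inj₁ u} {inj₁ v} e       = sym-~ e
  adj-sym {inj₁ u} {inj₂ k} e       = e
  adj-sym {inj₂ k} {inj₁ u} e       = e
  adj-sym {inj₂ k} {inj₂ l} (d , e) = (λ eq → d (sym eq)) , flip-any e

  adj-irrefl : Irreflexive _≡_ Adj
  adj-irrefl {inj₁ u} refl e       = irrefl refl e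
  adj-irrefl {inj₂ k} refl (d , _) = d refl

  T : Graph (U ⊎ C)
  T = record { _~_ = Adj ; _~?_ = adj? ; sym-~ = λ {x} {y} → adj-sym {x} {y}
             ; irrefl = adj-irrefl }

  Γ : Graph U
  Γ = induced T inj₁

------------------------------------------------------------------------
-- Complex unit gain graphs

module Gain (ℝ : CompleteOrderedField) where
  open Complex ℝ

  adjacencyMatrix : {V : Set} → Graph V → V → V → ℂ
  adjacencyMatrix G u v = if does (Graph._~?_ G u v) then 1# else 0#

  -- r(G) is r.
  GraphRank : {V : Set} → Graph V → ℕ → Set
  GraphRank G = HasRank (adjacencyMatrix G)

  -- Values of φ off the oriented edges of the graph carry no meaning and
  -- are never used.

  record GainGraph (n : ℕ) : Set₁ where
    field
      graph : Graph (Fin n)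
    open Graph graph public
    field
      φ      : Fin n → Fin n → ℂ
      φ-unit : ∀ {u v} → u ~ v → IsModulus (φ u v) (CompleteOrderedField.1# ℝ)
      φ-conj : ∀ {u v} → u ~ v → φ v u ≈ conj (φ u v)

    A : Fin n → Fin n → ℂ
    A u v = if does (u ~? v) then φ u v else 0#

    open FiniteGraph graph public

    gain : List (Fin n) → ℂ
    gain c = foldr _*_ 1# (map (λ (u , v) → φ u v) (steps c))

    TypeB : List (Fin n) → Set
    TypeB c = (2 ∣ length c) × ¬ (gain c ≈ (- 1#) ^ (length c / 2))

module Submission where

-- For every vertex cover Z of G one has r(Φ) ≤ 2|Z|, and repeated removal of a
-- leaf together with its neighbour gives any acyclic induced subgraph a vertex
-- cover K and a triangular system of 2|K| independent columns.  Hence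
-- r(Φ) ≤ r(G) + 2|X| for every set X meeting all cycles, so that extremality
-- makes θ(G) the least size of such a set.  Of two distinct cycles with a common
-- vertex two non-tree edges meet, and θ(G) - 1 vertices would suffice: this is (i).
--
-- Now let X be a transversal of the disjoint cycles, Q the set of vertices on
-- cycles and μ the size of the cover of Γ.  As r(G) is the rank of G − X, column
-- relations give kernel vectors of G which force every neighbour of Q in Γ into
-- some cover of Γ of size μ; hence r(Φ) ≤ 2μ + |Q|.  Since X together with the
-- cover of G − X is a cover of size r(Φ)/2, it is tight: it takes one end of each
-- matched edge of Γ and alternates along the cycles, which are therefore even.
-- Choosing X next to the attachments of a component of Γ and gluing over the
-- components yields a cover K of Γ of size μ containing all neighbours of Q.  It
-- covers T, so r(T) = r(Γ) = 2μ.  Kernel vectors of G vanish on K and therefore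
-- satisfy z(v₋) + z(v₊) = 0 along each cycle, whence 4 divides its length; the
-- same argument with Φ z = e_v for v in Q excludes the gain (-1)^(p/2).

open import Defs
open import Data.Bool.Base using (if_then_else_)
open import Data.Empty using (⊥)
open import Data.Fin.Base as Fin using (zero; suc; Fin)
import Data.Fin.Properties as Fin
open import Data.List.Base using (List; []; _∷_; _++_; length; map; lookup; tabulate; _∷ʳ_; filter; concatMap; allFin; concat)
import Data.List.Membership.DecPropositional as DecMembership
open import Data.List.Membership.Propositional using (_∈_; _∉_; find; lose)
open import Data.List.Membership.Propositional.Properties using (∈-map⁺; ∈-map⁻; ∈-++⁺ˡ; ∈-++⁺ʳ; ∈-++⁻; ∈-allFin; ∈-filter⁺; ∈-filter⁻; ∈-lookup)
open import Data.List.Properties using (length-map; length-tabulate; length-++)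
open import Data.List.Relation.Binary.Permutation.Propositional using (_↭_; ↭-refl; ↭-trans)
import Data.List.Relation.Binary.Permutation.Propositional.Properties as Perm
open import Data.List.Relation.Binary.Subset.Propositional using (_⊆_)
open import Data.List.Relation.Unary.All as All using (All; []; _∷_)
import Data.List.Relation.Unary.All.Properties as All
open import Data.List.Relation.Unary.AllPairs as AllPairs using (AllPairs; []; _∷_)
open import Data.List.Relation.Unary.Any as Any using (here; there; Any; any?)
import Data.List.Relation.Unary.Any.Properties as Any
open import Data.List.Relation.Unary.Unique.Propositional using (Unique)
import Data.List.Relation.Unary.Unique.Propositional.Properties as Unique
open import Data.Nat.Base as ℕ using (ℕ; zero; suc; s≤s; z≤n)
import Data.Nat.Properties as ℕ
open import Data.Product.Base using (∃-syntax; _×_; _,_; proj₁; proj₂)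
open import Data.Product.Properties using (≡-dec)
open import Data.Sum.Base as Sum using (_⊎_; inj₁; inj₂; [_,_]′)
open import Function.Base using (_∘_; id)
open import Level using (0ℓ)
open import Relation.Binary.Construct.Closure.ReflexiveTransitive as Star using (Star; ε; _◅_; _◅◅_)
open import Relation.Binary.PropositionalEquality as ≡ using (_≡_; _≢_; cong; subst)
open import Relation.Nullary using (¬_; yes; no; contradiction; does; Dec)
open import Relation.Nullary.Decidable using (¬?; _×-dec_)

-- Both rank estimates use only the zero pattern of a matrix and the invertibility of its edge
-- entries, so they hold alike for G and for Φ; the rigidity comes from comparing them.
--
-- The delicate step is forcing a neighbour u of a cycle into a cover of Γ of size μ. If Γ without u
-- still had μ matched pairs, Γ would have a kernel vector κ with κ u = 1. Cut down to the component
-- of u, its image under the adjacency matrix of G lives only where this component touches the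
-- cycles, at most once on each. Pairing that image with a kernel vector of G which is 1 at one such
-- vertex and 0 at the others leaves a single nonzero entry, although by symmetry the pairing is 0.
--
-- Tightness of covers is a count. With each matched edge of Γ taken twice and each cycle edge once,
-- every vertex concerned has degree two, so a cover Z satisfies 2μ + |Q| ≤ 2|Z|, and equality
-- leaves no edge with both ends in Z. A cover is most useful where it avoids an attachment, since
-- it then contains all neighbours of that vertex; hence the transversals one step behind the
-- attachments.

module SpanTheory where

  open import Algebra.Bundles using (CommutativeRing)
  import Algebra.Properties.Semiring.Sum as SemiringSum
  import Algebra.Solver.Ring.NaturalCoefficients.Default as SemiringSolver
  open import Relation.Binary.Definitions using (Decidable)
  import Relation.Binary.Reasoning.Setoid as SetoidReasoning

  record Field : Set₁ where
    field
      commutativeRing : CommutativeRing 0ℓ 0ℓ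
    open CommutativeRing commutativeRing public hiding (zero)
    field
      _≈?_    : Decidable _≈_
      inverse : ∀ x → ¬ (x ≈ 0#) → ∃[ y ] x * y ≈ 1#
      1≉0     : ¬ (1# ≈ 0#)
      2≉0     : ¬ (1# + 1# ≈ 0#)

  -- Spans, dependence and exchange over a field.

  module LinearAlgebra (F : Field) where
    open Field F public
    open SemiringSum semiring public
    open SemiringSolver commutativeSemiring public using (solve; _:+_; _:*_; _:=_; con)
    open SetoidReasoning setoid public

    *-cancelˡ-0 : ∀ {x y} → ¬ (x ≈ 0#) → x * y ≈ 0# → y ≈ 0#
    *-cancelˡ-0 {x} {y} x≉0 xy≈0 with inverse x x≉0
    ... | b , xb≈1 = begin
      y            ≈⟨ *-identityˡ y ⟨
      1# * y       ≈⟨ *-congʳ xb≈1 ⟨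
      x * b * y    ≈⟨ solve 3 (λ x b y → x :* b :* y := b :* (x :* y)) refl x b y ⟩
      b * (x * y)  ≈⟨ *-congˡ xy≈0 ⟩
      b * 0#       ≈⟨ zeroʳ b ⟩
      0#           ∎

    0*+ : ∀ x w → w ≈ 0# * x + w
    0*+ x w = solve 2 (λ x w → w := con 0 :* x :+ w) refl x w

    infixr 5 _∷⟨_,_⟩

    -- Combinations are built along the list, one coefficient per vector, so that elimination is
    -- structural recursion. The row index `I` is arbitrary because the vertices of `T` and `Γ` are
    -- not of the form `Fin n`.
    data Span {I : Set} : List (I → Carrier) → (I → Carrier) → Set where
      [_] : ∀ {w} → (∀ i → w i ≈ 0#) → Span [] w
      _∷⟨_,_⟩ : ∀ {v vs w w′} → Span vs w′ → (a : Carrier) →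
                 (∀ i → w i ≈ a * v i + w′ i) → Span (v ∷ vs) w

    -- Dependence in positive form, some vector lying in the span of its successors; this is what
    -- elimination can produce.
    Dep : {I : Set} → List (I → Carrier) → Set
    Dep []       = ⊥
    Dep (v ∷ vs) = Span vs v ⊎ Dep vs

    module _ {I : Set} where
      private variable
        u v w w′ : I → Carrier
        us vs ws : List (I → Carrier)

      span-cong : (∀ i → w i ≈ w′ i) → Span vs w → Span vs w′
      span-cong eq [ p ]          = [ (λ i → trans (sym (eq i)) (p i)) ]
      span-cong eq (s ∷⟨ a , p ⟩) = s ∷⟨ a , (λ i → trans (sym (eq i)) (p i)) ⟩

      span-weaken : Span vs w → Span (v ∷ vs) w
      span-weaken {w = w} {v = v} s = s ∷⟨ 0# , (λ i → 0*+ (v i) (w i)) ⟩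

      span-0 : ∀ {vs} → (∀ i → w i ≈ 0#) → Span vs w
      span-0 {vs = []}     p = [ p ]
      span-0 {vs = _ ∷ vs} p = span-weaken (span-0 p)

      span-lin : ∀ c → Span vs w → Span vs w′ → Span vs (λ i → c * w i + w′ i)
      span-lin c [ p ] [ q ] = [ (λ i → trans (+-cong (*-congˡ (p i)) (q i))
                                   (trans (+-identityʳ _) (zeroʳ c))) ]
      span-lin c (_∷⟨_,_⟩ {v = v} {w′ = x} s a p) (_∷⟨_,_⟩ {w′ = y} t b q) =
        span-lin c s t ∷⟨ c * a + b , (λ i → trans (+-cong (*-congˡ (p i)) (q i))
          (solve 6 (λ c a b v x y → c :* (a :* v :+ x) :+ (b :* v :+ y)
                                  := (c :* a :+ b) :* v :+ (c :* x :+ y))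
             refl c a b (v i) (x i) (y i))) ⟩

      span-∈ : v ∈ vs → Span vs v
      span-∈ {v} (here ≡.refl) = span-0 (λ i → refl) ∷⟨ 1# , (λ i →
        solve 1 (λ v → v := con 1 :* v :+ con 0) refl (v i)) ⟩
      span-∈ (there m) = span-weaken (span-∈ m)

      span-trans : All (Span us) vs → Span vs w → Span us w
      span-trans []       [ p ]          = span-0 p
      span-trans (s ∷ ss) (t ∷⟨ a , p ⟩) =
        span-cong (λ i → sym (p i)) (span-lin a s (span-trans ss t))

      span-++ʳ : ∀ us → Span vs w → Span (us ++ vs) w
      span-++ʳ []       s = s
      span-++ʳ (u ∷ us) s = span-weaken (span-++ʳ us s)

      span-++ˡ : Span us w → Span (us ++ vs) w
      span-++ˡ [ p ]          = span-0 p
      span-++ˡ (s ∷⟨ a , p ⟩) = span-++ˡ s ∷⟨ a , p ⟩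

      private
        Pivot : (I → Carrier) → List (I → Carrier) → List (I → Carrier) → Set
        Pivot u us vs = ∃[ p ] ∃[ p′ ] ∃[ a ]
          Span vs p × Span us p′ × ¬ (a ≈ 0#) × (∀ i → p i ≈ a * u i + p′ i)

        Reduced : List (I → Carrier) → List (I → Carrier) → Set
        Reduced us vs = ∃[ vs′ ] length vs ≡ suc (length vs′) × All (Span us) vs′
          × (Dep vs′ → Dep vs) × (∀ w → Span vs′ w → Span vs w)

        -- One step of Gaussian elimination. The pivot is the last vector whose coefficient at `u`
        -- is nonzero; clearing `u` from the earlier vectors subtracts only vectors spanned by later
        -- ones, so dependences and spans carry back to `vs`.
        eliminate : All (Span (u ∷ us)) vs →
          All (Span us) vs ⊎ (Pivot u us vs × Reduced us vs)
        eliminate [] = inj₁ []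
        eliminate {u = u} {vs = v ∷ vs} ((_∷⟨_,_⟩ {w′ = v′} s a e) ∷ ss) with eliminate ss
        ... | inj₁ ts with a ≈? 0#
        ...   | yes a≈0 = inj₁ (span-cong (λ i → sym (trans (e i)
                  (trans (+-congʳ (*-congʳ a≈0)) (sym (0*+ (u i) (v′ i)))))) s ∷ ts)
        ...   | no a≉0 = inj₂
                  ( (v , v′ , a , span-∈ (here ≡.refl) , s , a≉0 , e)
                  , (vs , ≡.refl , ts , inj₂ , λ w → span-weaken))
        eliminate {u = u} {vs = v ∷ vs} ((_∷⟨_,_⟩ {w′ = v′} s a e) ∷ ss)
          | inj₂ ((p , p′ , c , sp , sp′ , c≉0 , e′) , (vs′ , len , ts , dep , sub)) with inverse c c≉0
        ... | b , cb≈1 = inj₂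
              ( (p , p′ , c , span-weaken sp , sp′ , c≉0 , e′)
              , ((λ i → - (a * b) * p′ i + v′ i) ∷ vs′ , ≡.cong suc len
                , span-lin _ sp′ s ∷ ts
                , (λ { (inj₁ t) → inj₁ (back (sub _ t)) ; (inj₂ d) → inj₂ (dep d) })
                , λ { w (t ∷⟨ d , q ⟩) → span-cong (λ i → sym (q i))
                       (span-lin d (forth sp) (span-weaken (sub _ t))) }))
          where
          key : ∀ i → v i ≈ a * b * p i + (- (a * b) * p′ i + v′ i)
          key i = begin
            v i ≈⟨ e i ⟩
            a * u i + v′ i
              ≈⟨ solve 4 (λ a u v z → a :* u :+ v := con 1 :* a :* u :+ con 0 :* z :+ v)
                   refl a (u i) (v′ i) (p′ i) ⟩
            1# * a * u i + 0# * p′ i + v′ i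
              ≈⟨ +-congʳ (+-cong (*-congʳ (*-congʳ (sym cb≈1)))
                                 (*-congʳ (sym (-‿inverseʳ (a * b))))) ⟩
            c * b * a * u i + (a * b + - (a * b)) * p′ i + v′ i
              ≈⟨ solve 7 (λ a b n c u p v →
                     c :* b :* a :* u :+ (a :* b :+ n) :* p :+ v
                  := a :* b :* (c :* u :+ p) :+ (n :* p :+ v))
                   refl a b (- (a * b)) c (u i) (p′ i) (v′ i) ⟩
            a * b * (c * u i + p′ i) + (- (a * b) * p′ i + v′ i)
              ≈⟨ +-congʳ (*-congˡ (e′ i)) ⟨
            a * b * p i + (- (a * b) * p′ i + v′ i) ∎
          back : Span vs (λ i → - (a * b) * p′ i + v′ i) → Span vs v
          back t = span-cong (λ i → sym (key i)) (span-lin (a * b) sp t)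
          forth : Span vs p → Span (v ∷ vs) (λ i → - (a * b) * p′ i + v′ i)
          forth t = span-cong (λ i → begin
            - (a * b) * p i + v i
              ≈⟨ +-congˡ (key i) ⟩
            - (a * b) * p i + (a * b * p i + (- (a * b) * p′ i + v′ i))
              ≈⟨ solve 4 (λ n c p x → n :* p :+ (c :* p :+ x) := (n :+ c) :* p :+ x)
                   refl (- (a * b)) (a * b) (p i) (- (a * b) * p′ i + v′ i) ⟩
            (- (a * b) + a * b) * p i + (- (a * b) * p′ i + v′ i)
              ≈⟨ +-congʳ (trans (*-congʳ (-‿inverseˡ (a * b))) (zeroˡ _)) ⟩
            0# + (- (a * b) * p′ i + v′ i)
              ≈⟨ +-identityˡ _ ⟩
            - (a * b) * p′ i + v′ i ∎)
            (span-lin (- (a * b)) (span-weaken t) (span-∈ (here ≡.refl)))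

      -- Steinitz exchange: the spanning vectors are eliminated one at a time, each at the cost of
      -- at most one vector of `vs`.
      exchange : ∀ us vs → All (Span us) vs → length us ℕ.< length vs → Dep vs
      exchange []       (v ∷ vs) ([ p ] ∷ _) _  = inj₁ (span-0 p)
      exchange (u ∷ us) (v ∷ vs) (s ∷ ss) (s≤s lt) with eliminate (s ∷ ss)
      ... | inj₁ ts = exchange us (v ∷ vs) ts (ℕ.m≤n⇒m≤1+n lt)
      ... | inj₂ (_ , (vs′ , len , ts , dep , _)) =
        dep (exchange us vs′ ts (≡.subst (suc (length us) ℕ.≤_) (ℕ.suc-injective len) lt))

      -- The list `w ∷ vs` is longer than the spanning list, hence dependent, and since `vs` is not,
      -- the dependence must express `w`.
      maximal-indep-spans : ∀ us → All (Span us) vs → ¬ Dep vs →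
        length us ℕ.≤ length vs → Span us w → Span vs w
      maximal-indep-spans us ss indep le s with exchange us _ (s ∷ ss) (s≤s le)
      ... | inj₁ t = t
      ... | inj₂ d = contradiction d indep

-- Rank bounds, triangular systems and kernel vectors.

module RankTheory where

  open SpanTheory
  open import Data.List.Properties using (map-tabulate)
  open import Data.Product.Base using (Σ-syntax)
  open import Data.Unit.Base using (⊤; tt)
  open import Relation.Binary.Definitions using (DecidableEquality)

  module MatrixRank (F : Field) where
    open LinearAlgebra F public

    -- This and the next two definitions repeat those of the statement over an abstract field. At
    -- the complex field they agree definitionally, so that rank hypotheses pass through unchanged.
    LinearlyIndependent : {I : Set} {k : ℕ} → (Fin k → I → Carrier) → Set
    LinearlyIndependent {I} {k} v =
      (a : Fin k → Carrier) → (∀ i → sum (λ l → a l * v l i) ≈ 0#) → ∀ l → a l ≈ 0#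

    InSpan : {I : Set} {k : ℕ} → (I → Carrier) → (Fin k → I → Carrier) → Set
    InSpan {I} {k} w v =
      Σ[ a ∈ (Fin k → Carrier) ] (∀ i → w i ≈ sum (λ l → a l * v l i))

    HasRank : {I J : Set} → (I → J → Carrier) → ℕ → Set
    HasRank {I} {J} M r =
      Σ[ c ∈ (Fin r → J) ]
        (LinearlyIndependent (λ l i → M i (c l)) ×
         (∀ j → InSpan (λ i → M i j) (λ l i → M i (c l))))

    col : {I J : Set} → (I → J → Carrier) → J → I → Carrier
    col M j i = M i j

    sum-zero : ∀ {k} (f : Fin k → Carrier) → (∀ l → f l ≈ 0#) → sum f ≈ 0#
    sum-zero {zero}  f p = refl
    sum-zero {suc k} f p = trans (+-cong (p zero) (sum-zero (f ∘ suc) (p ∘ suc))) (+-identityʳ 0#)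

    module _ {I : Set} where

      inSpan⇒span : ∀ {k} (v : Fin k → I → Carrier) {w} → InSpan w v → Span (tabulate v) w
      inSpan⇒span {zero}  v (a , p) = [ p ]
      inSpan⇒span {suc k} v (a , p) =
        inSpan⇒span (v ∘ suc) (a ∘ suc , λ i → refl) ∷⟨ a zero , p ⟩

      span⇒inSpan : ∀ {k} (v : Fin k → I → Carrier) {w} → Span (tabulate v) w → InSpan w v
      span⇒inSpan {zero}  v [ p ] = (λ ()) , p
      span⇒inSpan {suc k} v (s ∷⟨ a , p ⟩) with span⇒inSpan (v ∘ suc) s
      ... | b , q = (λ { zero → a ; (suc l) → b l }) , λ i → trans (p i) (+-congˡ (q i))

      -- The final `0#` is there to match the shape of a linear combination formed by `span-lin`.
      solve-head : ∀ {a b x y} → a * b ≈ 1# → a * x + y ≈ 0# → x ≈ - b * y + 0#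
      solve-head {a} {b} {x} {y} ab≈1 p = begin
        x                         ≈⟨ solve 2 (λ x y → x := con 1 :* x :+ con 0 :* y) refl x y ⟩
        1# * x + 0# * y           ≈⟨ +-cong (*-congʳ (sym ab≈1)) (*-congʳ (sym (-‿inverseʳ b))) ⟩
        a * b * x + (b + - b) * y ≈⟨ solve 5 (λ a b n x y → a :* b :* x :+ (b :+ n) :* y
                                         := b :* (a :* x :+ y) :+ n :* y) refl a b (- b) x y ⟩
        b * (a * x + y) + - b * y ≈⟨ +-congʳ (trans (*-congˡ p) (zeroʳ b)) ⟩
        0# + - b * y              ≈⟨ +-comm _ _ ⟩
        - b * y + 0#              ∎

      indep⇒¬dep : ∀ {k} (v : Fin k → I → Carrier) → LinearlyIndependent v → ¬ Dep (tabulate v)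
      indep⇒¬dep {suc k} v indep (inj₁ s) with span⇒inSpan (v ∘ suc) s
      ... | b , q = 1≉0 (indep (λ { zero → 1# ; (suc l) → - (b l) }) eq zero)
          where
          eq : ∀ i → 1# * v zero i + sum (λ l → - (b l) * v (suc l) i) ≈ 0#
          eq i = begin
            1# * v zero i + sum (λ l → - (b l) * v (suc l) i)
              ≈⟨ +-congʳ (trans (*-identityˡ _) (q i)) ⟩
            sum (λ l → b l * v (suc l) i) + sum (λ l → - (b l) * v (suc l) i)
              ≈⟨ ∑-distrib-+ (λ l → b l * v (suc l) i) (λ l → - (b l) * v (suc l) i) ⟨
            sum (λ l → b l * v (suc l) i + - (b l) * v (suc l) i)
              ≈⟨ sum-zero _ (λ l → trans (sym (distribʳ _ _ _))
                   (trans (*-congʳ (-‿inverseʳ (b l))) (zeroˡ _))) ⟩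
            0# ∎
      indep⇒¬dep {suc k} v indep (inj₂ d) = indep⇒¬dep (v ∘ suc)
        (λ a p l → indep (λ { zero → 0# ; (suc l) → a l })
          (λ i → trans (+-cong (zeroˡ _) (p i)) (+-identityʳ 0#)) (suc l)) d

      ¬dep⇒indep : ∀ {k} (v : Fin k → I → Carrier) → ¬ Dep (tabulate v) → LinearlyIndependent v
      ¬dep⇒indep {suc k} v ¬dep a p = λ { zero → a₀≈0 ; (suc l) → tail≈0 l }
        where
        a₀≈0 : a zero ≈ 0#
        a₀≈0 with a zero ≈? 0#
        ... | yes q = q
        ... | no a₀≉0 with inverse (a zero) a₀≉0
        ...   | b , ab≈1 = contradiction (inj₁ (span-cong (λ i → sym (solve-head ab≈1 (p i)))
                  (span-lin (- b) (inSpan⇒span (v ∘ suc) (a ∘ suc , λ i → refl))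
                    (span-0 (λ i → refl))))) ¬dep
        tail≈0 : ∀ l → a (suc l) ≈ 0#
        tail≈0 = ¬dep⇒indep (v ∘ suc) (¬dep ∘ inj₂) (a ∘ suc) (λ i →
          trans (sym (trans (+-congʳ (trans (*-congʳ a₀≈0) (zeroˡ _))) (+-identityˡ _))) (p i))

      span-vanish : ∀ {vs w} (i : I) → All (λ v → v i ≈ 0#) vs → Span vs w → w i ≈ 0#
      span-vanish i []       [ p ]          = p i
      span-vanish i (q ∷ qs) (s ∷⟨ a , p ⟩) = trans (p i) (trans
        (+-cong (trans (*-congˡ q) (zeroʳ a)) (span-vanish i qs s)) (+-identityʳ 0#))

    tabulate-lookup-map : ∀ {A B : Set} (f : A → B) xs → tabulate (f ∘ lookup xs) ≡ map f xs
    tabulate-lookup-map f []       = ≡.refl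
    tabulate-lookup-map f (x ∷ xs) = ≡.cong (f x ∷_) (tabulate-lookup-map f xs)

    module _ {I J : Set} {M : I → J → Carrier} where

      mkHasRank : ∀ S → ¬ Dep (map (col M) S) → (∀ j → Span (map (col M) S) (col M j)) →
        HasRank M (length S)
      mkHasRank S ¬dep spans = lookup S
        , ¬dep⇒indep _ (≡.subst (¬_ ∘ Dep) eq ¬dep)
        , λ j → span⇒inSpan _ (≡.subst (λ vs → Span vs (col M j)) eq (spans j))
        where eq = ≡.sym (tabulate-lookup-map (col M) S)

      module _ {r} (R : HasRank M r) where
        private
          basis : List (I → Carrier)
          basis = tabulate (λ l → col M (proj₁ R l))
          len : length basis ≡ r
          len = length-tabulate (λ l → col M (proj₁ R l))
          basis-spans : ∀ j → Span basis (col M j)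
          basis-spans j = inSpan⇒span _ (proj₂ (proj₂ R) j)
          basis-indep : ¬ Dep basis
          basis-indep = indep⇒¬dep _ (proj₁ (proj₂ R))

        rank-≤ : ∀ us → (∀ j → Span us (col M j)) → r ℕ.≤ length us
        rank-≤ us spans = ℕ.≮⇒≥ λ lt → basis-indep
          (exchange us basis (All.tabulate⁺ (λ l → spans (proj₁ R l)))
            (≡.subst (length us ℕ.<_) (≡.sym len) lt))

        rank-≥ : ∀ S → ¬ Dep (map (col M) S) → length S ℕ.≤ r
        rank-≥ S ¬dep = ℕ.≮⇒≥ λ lt → ¬dep
          (exchange basis _ (All.map⁺ (All.universal basis-spans S))
            (≡.subst₂ ℕ._<_ (≡.sym len) (≡.sym (length-map (col M) S)) lt))

        large-indep-spans : ∀ S → ¬ Dep (map (col M) S) → r ℕ.≤ length S →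
          ∀ j → Span (map (col M) S) (col M j)
        large-indep-spans S ¬dep le j =
          maximal-indep-spans basis (All.map⁺ (All.universal basis-spans S)) ¬dep
            (≡.subst₂ ℕ._≤_ (≡.sym len) (≡.sym (length-map (col M) S)) le) (basis-spans j)

        -- A list of at most `r` vectors that spans all columns spans nothing beyond the column
        -- space. This is how unit vectors are later found in the image of Φ.
        large-rank-spans : ∀ us → (∀ j → Span us (col M j)) → length us ℕ.≤ r →
          ∀ {w} → Span us w → ∃[ S ] Span (map (col M) S) w
        large-rank-spans us spans le {w} s = tabulate (proj₁ R)
          , ≡.subst (λ vs → Span vs w) (≡.sym (map-tabulate (proj₁ R) (col M)))
              (maximal-indep-spans us (All.tabulate⁺ (λ l → spans (proj₁ R l))) basis-indep
                (≡.subst (length us ℕ.≤_) (≡.sym len) le) s)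

      data Triangular : List (I × J) → Set where
        []  : Triangular []
        _∷_ : ∀ {e es} → (¬ (M (proj₁ e) (proj₂ e) ≈ 0#)) ×
              All (λ e′ → M (proj₁ e) (proj₂ e′) ≈ 0#) es →
              Triangular es → Triangular (e ∷ es)

      -- In the row of the first pivot all later columns are zero and the pivot column is not.
      triangular⇒¬dep : ∀ {es} → Triangular es → ¬ Dep (map (col M) (map proj₂ es))
      triangular⇒¬dep {e ∷ es} ((p , q) ∷ t) (inj₁ s) =
        p (span-vanish (proj₁ e) (All.map⁺ (All.map⁺ q)) s)
      triangular⇒¬dep (_ ∷ t) (inj₂ d) = triangular⇒¬dep t d

    module _ {I : Set} (_≟_ : DecidableEquality I) where

      δ : I → I → Carrier
      δ k i = if does (i ≟ k) then 1# else 0#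

      without : I → (I → Carrier) → I → Carrier
      without k f i = if does (i ≟ k) then 0# else f i

      split-off : ∀ k f i → f i ≈ f k * δ k i + without k f i
      split-off k f i with i ≟ k
      ... | yes ≡.refl = solve 1 (λ x → x := x :* con 1 :+ con 0) refl (f i)
      ... | no _       = solve 2 (λ x y → x := y :* con 0 :+ x) refl (f i) (f k)

      open DecMembership _≟_ using (_∈?_)

      without-support : ∀ {k K f} → (∀ i → i ∉ k ∷ K → f i ≈ 0#) →
        ∀ i → i ∉ K → without k f i ≈ 0#
      without-support {k} p i i∉K with i ≟ k
      ... | yes _  = refl
      ... | no i≢k = p i λ { (here eq) → i≢k eq ; (there m) → i∉K m }

      supported⇒span : ∀ K f → (∀ i → i ∉ K → f i ≈ 0#) → Span (map δ K) f
      supported⇒span []      f p = [ (λ i → p i λ ()) ]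
      supported⇒span (k ∷ K) f p =
        supported⇒span K (without k f) (without-support p) ∷⟨ f k , split-off k f ⟩

      -- A column outside `K` is supported on the rows in `K`. With 2|K| generators this bounds the
      -- rank by twice the size of a vertex cover.
      cover-spans : ∀ (M : I → I → Carrier) K → (∀ i j → i ∉ K → j ∉ K → M i j ≈ 0#) →
        ∀ j → Span (map δ K ++ map (col M) K) (col M j)
      cover-spans M K p j with j ∈? K
      ... | yes j∈K = span-++ʳ (map δ K) (span-∈ (∈-map⁺ (col M) j∈K))
      ... | no j∉K  = span-++ˡ (supported⇒span K (col M j) (λ i i∉K → p i j i∉K j∉K))

    private variable n : ℕ

    sum-single : ∀ (f : Fin n → Carrier) s → (∀ j → j ≢ s → f j ≈ 0#) → sum f ≈ f s
    sum-single f zero    p = trans (+-congˡ (sum-zero _ (λ j → p (suc j) λ ()))) (+-identityʳ _)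
    sum-single f (suc s) p = trans (+-cong (p zero λ ())
      (sum-single (f ∘ suc) s (λ j j≢s → p (suc j) (j≢s ∘ Fin.suc-injective)))) (+-identityˡ _)

    _∙_ : ∀ {I : Set} → (I → Fin n → Carrier) → (Fin n → Carrier) → I → Carrier
    (M ∙ z) i = sum (λ j → M i j * z j)

    module _ {I : Set} (M : I → Fin n → Carrier) where

      ∙-δ : ∀ s i → (M ∙ δ Fin._≟_ s) i ≈ M i s
      ∙-δ s i = trans (sum-single _ s off) on
        where
        off : ∀ j → j ≢ s → M i j * δ Fin._≟_ s j ≈ 0#
        off j j≢s with j Fin.≟ s
        ... | yes eq = contradiction eq j≢s
        ... | no _   = zeroʳ _
        on : M i s * δ Fin._≟_ s s ≈ M i s
        on with s Fin.≟ s
        ... | yes _  = *-identityʳ _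
        ... | no s≢s = contradiction ≡.refl s≢s

      ∙-lin : ∀ a z z′ i → (M ∙ (λ j → a * z j + z′ j)) i ≈ a * (M ∙ z) i + (M ∙ z′) i
      ∙-lin a z z′ i = begin
        (M ∙ (λ j → a * z j + z′ j)) i
          ≈⟨ sum-cong-≋ (λ j → solve 4 (λ m a z w → m :* (a :* z :+ w) := a :* (m :* z) :+ m :* w)
               refl (M i j) a (z j) (z′ j)) ⟩
        sum (λ j → a * (M i j * z j) + M i j * z′ j)
          ≈⟨ ∑-distrib-+ (λ j → a * (M i j * z j)) (λ j → M i j * z′ j) ⟩
        sum (λ j → a * (M i j * z j)) + (M ∙ z′) i
          ≈⟨ +-congʳ (*-distribˡ-sum a (λ j → M i j * z j)) ⟨
        a * (M ∙ z) i + (M ∙ z′) i ∎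

      span⇒combination : ∀ S {w} → Span (map (col M) S) w →
        ∃[ z ] (∀ i → w i ≈ (M ∙ z) i) × (∀ j → j ∉ S → z j ≈ 0#)
      span⇒combination [] [ p ] = (λ _ → 0#)
        , (λ i → trans (p i) (sym (sum-zero _ (λ j → zeroʳ (M i j))))) , λ _ _ → refl
      span⇒combination (s ∷ S) (t ∷⟨ a , p ⟩) with span⇒combination S t
      ... | z , q , supp = (λ j → a * δ Fin._≟_ s j + z j)
        , (λ i → trans (p i) (trans (+-cong (*-congˡ (sym (∙-δ s i))) (q i))
            (sym (∙-lin a (δ Fin._≟_ s) z i))))
        , off
        where
        off : ∀ j → j ∉ s ∷ S → a * δ Fin._≟_ s j + z j ≈ 0#
        off j j∉ with j Fin.≟ s
        ... | yes eq = contradiction (here eq) j∉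
        ... | no _   = trans (+-cong (zeroʳ a) (supp j (j∉ ∘ there))) (+-identityʳ 0#)

      combination⇒span : ∀ S z → (∀ j → j ∉ S → z j ≈ 0#) → Span (map (col M) S) (M ∙ z)
      combination⇒span [] z supp =
        [ (λ i → sum-zero _ (λ j → trans (*-congˡ (supp j λ ())) (zeroʳ _))) ]
      combination⇒span (s ∷ S) z supp =
        combination⇒span S (without Fin._≟_ s z) (without-support Fin._≟_ supp)
          ∷⟨ z s , (λ i → begin
        (M ∙ z) i
          ≈⟨ sum-cong-≋ (λ j → *-congˡ (split-off Fin._≟_ s z j)) ⟩
        (M ∙ (λ j → z s * δ Fin._≟_ s j + without Fin._≟_ s z j)) i
          ≈⟨ ∙-lin (z s) _ _ i ⟩
        z s * (M ∙ δ Fin._≟_ s) i + (M ∙ without Fin._≟_ s z) i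
          ≈⟨ +-congʳ (*-congˡ (∙-δ s i)) ⟩
        z s * M i s + (M ∙ without Fin._≟_ s z) i ∎) ⟩

      -- Forward substitution: in the first row the later columns of the system have zero entries
      -- and all other columns contribute nothing, so its own term vanishes; from then on that
      -- column contributes nothing to the remaining rows.
      triangular-kernel : ∀ {es} → Triangular {M = M} es → ∀ z →
        All (λ e → (M ∙ z) (proj₁ e) ≈ 0#) es →
        (∀ e j → e ∈ es → j ∉ map proj₂ es → M (proj₁ e) j * z j ≈ 0#) →
        All (λ e → z (proj₂ e) ≈ 0#) es
      triangular-kernel [] z _ _ = []
      triangular-kernel {(ρ , s) ∷ es} ((p , q) ∷ t) z (r ∷ rs) off = zs≈0 ∷
        triangular-kernel t z rs off′
        where
        zs≈0 : z s ≈ 0#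
        zs≈0 = *-cancelˡ-0 p (trans (sym (sum-single _ s others)) r)
          where
          others : ∀ j → j ≢ s → M ρ j * z j ≈ 0#
          others j j≢s with DecMembership._∈?_ Fin._≟_ j (map proj₂ es)
          ... | yes j∈ = trans (*-congʳ (All.lookup (All.map⁺ {f = proj₂} q) j∈)) (zeroˡ _)
          ... | no j∉  = off _ j (here ≡.refl) λ { (here eq) → j≢s eq ; (there m) → j∉ m }
        off′ : ∀ e j → e ∈ es → j ∉ map proj₂ es → M (proj₁ e) j * z j ≈ 0#
        off′ e j e∈ j∉ with j Fin.≟ s
        ... | yes ≡.refl = trans (*-congˡ zs≈0) (zeroʳ _)
        ... | no j≢s     = off e j (there e∈) λ { (here eq) → j≢s eq ; (there m) → j∉ m }

      -1*x+x≈0 : ∀ x → - 1# * x + x ≈ 0#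
      -1*x+x≈0 x = trans (+-congˡ (sym (*-identityˡ x))) (trans (sym (distribʳ x (- 1#) 1#))
        (trans (*-congʳ (-‿inverseˡ 1#)) (zeroˡ x)))

      span⇒kernel : ∀ {S j} → Span (map (col M) S) (col M j) → j ∉ S →
        ∃[ z ] (∀ i → (M ∙ z) i ≈ 0#) × z j ≈ 1# × (∀ l → l ∉ S → l ≢ j → z l ≈ 0#)
      span⇒kernel {S} {j} s j∉S = extend (span⇒combination S s)
        where
        δⱼ : Fin n → Carrier
        δⱼ = δ Fin._≟_ j
        at-j : δⱼ j ≈ 1#
        at-j with j Fin.≟ j
        ... | yes _ = refl
        ... | no ¬p = contradiction ≡.refl ¬p
        off-j : ∀ l → l ≢ j → δⱼ l ≈ 0#
        off-j l l≢j with l Fin.≟ j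
        ... | yes eq = contradiction eq l≢j
        ... | no _   = refl
        extend : (∃[ z ] (∀ i → M i j ≈ (M ∙ z) i) × (∀ j → j ∉ S → z j ≈ 0#)) →
          ∃[ z ] (∀ i → (M ∙ z) i ≈ 0#) × z j ≈ 1# × (∀ l → l ∉ S → l ≢ j → z l ≈ 0#)
        extend (z , eq , supp) = (λ l → - 1# * z l + δⱼ l)
          , (λ i → trans (∙-lin (- 1#) z δⱼ i) (trans (+-cong (*-congˡ (sym (eq i))) (∙-δ j i)) (-1*x+x≈0 _)))
          , trans (+-cong (trans (*-congˡ (supp j j∉S)) (zeroʳ _)) at-j) (+-identityˡ 1#)
          , λ l l∉S l≢j → trans (+-cong (trans (*-congˡ (supp l l∉S)) (zeroʳ _)) (off-j l l≢j)) (+-identityˡ 0#)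

      kernel⇒span : ∀ {S j} z → (∀ i → (M ∙ z) i ≈ 0#) → z j ≈ 1# → (∀ l → l ∉ S → l ≢ j → z l ≈ 0#) →
        Span (map (col M) S) (col M j)
      kernel⇒span {S} {j} z ker zj≈1 supp = span-cong solve-col
        (span-lin (- 1#) (combination⇒span S z′ supp′) (span-0 {w = λ _ → 0#} (λ _ → refl)))
        where
        z′ : Fin n → Carrier
        z′ = without Fin._≟_ j z
        supp′ : ∀ l → l ∉ S → z′ l ≈ 0#
        supp′ l l∉S with l Fin.≟ j
        ... | yes _  = refl
        ... | no l≢j = supp l l∉S l≢j
        split : ∀ i → M i j + (M ∙ z′) i ≈ 0#
        split i = begin
          M i j + (M ∙ z′) i ≈⟨ +-congʳ (trans (*-congʳ zj≈1) (*-identityˡ _)) ⟨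
          z j * M i j + (M ∙ z′) i ≈⟨ +-congʳ (*-congˡ (∙-δ j i)) ⟨
          z j * (M ∙ δ Fin._≟_ j) i + (M ∙ z′) i ≈⟨ ∙-lin (z j) _ z′ i ⟨
          (M ∙ (λ l → z j * δ Fin._≟_ j l + z′ l)) i ≈⟨ sum-cong-≋ (λ l → *-congˡ (split-off Fin._≟_ j z l)) ⟨
          (M ∙ z) i ≈⟨ ker i ⟩
          0# ∎
        solve-col : ∀ i → - 1# * (M ∙ z′) i + 0# ≈ M i j
        solve-col i = begin
          - 1# * (M ∙ z′) i + 0#                        ≈⟨ +-congˡ (split i) ⟨
          - 1# * (M ∙ z′) i + (M i j + (M ∙ z′) i)     ≈⟨ solve 3 (λ n x m → n :* x :+ (m :+ x) := m :+ (n :* x :+ x)) refl (- 1#) ((M ∙ z′) i) (M i j) ⟩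
          M i j + (- 1# * (M ∙ z′) i + (M ∙ z′) i)     ≈⟨ +-congˡ (-1*x+x≈0 _) ⟩
          M i j + 0#                                    ≈⟨ +-identityʳ _ ⟩
          M i j ∎

    -- The pairing carries no conjugation: it is meant for the symmetric matrix of G, not for the
    -- Hermitian matrix of Φ.
    ∙-adjoint : ∀ (M : Fin n → Fin n → Carrier) → (∀ i j → M i j ≈ M j i) → ∀ y z →
      sum (λ i → y i * (M ∙ z) i) ≈ sum (λ j → z j * (M ∙ y) j)
    ∙-adjoint M M-sym y z = begin
      sum (λ i → y i * (M ∙ z) i)               ≈⟨ sum-cong-≋ (λ i → *-distribˡ-sum (y i) (λ j → M i j * z j)) ⟩
      sum (λ i → sum (λ j → y i * (M i j * z j))) ≈⟨ ∑-comm (λ i j → y i * (M i j * z j)) ⟩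
      sum (λ j → sum (λ i → y i * (M i j * z j))) ≈⟨ sum-cong-≋ (λ j → sum-cong-≋ (λ i →
        trans (solve 3 (λ y m z → y :* (m :* z) := z :* (m :* y)) refl (y i) (M i j) (z j)) (*-congˡ (*-congʳ (M-sym i j))))) ⟩
      sum (λ j → sum (λ i → z j * (M j i * y i))) ≈⟨ sum-cong-≋ (λ j → *-distribˡ-sum (z j) (λ i → M j i * y i)) ⟨
      sum (λ j → z j * (M ∙ y) j) ∎

    sum-pair : ∀ (f : Fin n → Carrier) s t → s ≢ t → (∀ j → j ≢ s → j ≢ t → f j ≈ 0#) → sum f ≈ f s + f t
    sum-pair f s t s≢t p = begin
      sum f ≈⟨ sum-cong-≋ (λ j → split-off Fin._≟_ s f j) ⟩
      sum (λ j → f s * δ Fin._≟_ s j + without Fin._≟_ s f j) ≈⟨ ∑-distrib-+ (λ j → f s * δ Fin._≟_ s j) (without Fin._≟_ s f) ⟩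
      -- The first sum is the product of a one-row matrix, constantly `f s`, with a unit vector.
      sum (λ j → f s * δ Fin._≟_ s j) + sum (without Fin._≟_ s f) ≈⟨ +-cong (∙-δ {I = ⊤} (λ _ _ → f s) s tt) (sum-single _ t others) ⟩
      f s + without Fin._≟_ s f t ≈⟨ +-congˡ at-t ⟩
      f s + f t ∎
      where
      others : ∀ j → j ≢ t → without Fin._≟_ s f j ≈ 0#
      others j j≢t with j Fin.≟ s
      ... | yes _  = refl
      ... | no j≢s = p j j≢s j≢t
      at-t : without Fin._≟_ s f t ≈ f t
      at-t with t Fin.≟ s
      ... | yes eq = contradiction (≡.sym eq) s≢t
      ... | no _   = refl

-- Cycles, arcs and simple paths.

module CycleTheory where

  open import Data.List.Base using ([_]; zip)
  open import Data.List.Membership.Propositional.Properties using (∈-∃++)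
  open import Data.List.Properties using (++-assoc; ++-identityʳ)
  open import Data.List.Relation.Binary.Permutation.Propositional using (↭⇒↭ₛ; ↭-sym)
  import Data.List.Relation.Binary.Permutation.Setoid.Properties as PermSetoid
  open import Data.Product.Base using (swap)
  open import Relation.Binary.PropositionalEquality using (refl; sym; setoid)

  module _ {A : Set} where

    Unique-resp-↭ : ∀ {xs ys : List A} → xs ↭ ys → Unique xs → Unique ys
    Unique-resp-↭ p = PermSetoid.Unique-resp-↭ (setoid A) (↭⇒↭ₛ p)

    Unique-++⁻ˡ : ∀ xs {ys : List A} → Unique (xs ++ ys) → Unique xs
    Unique-++⁻ˡ []       _        = []
    Unique-++⁻ˡ (x ∷ xs) (p ∷ ps) = All.++⁻ˡ xs p ∷ Unique-++⁻ˡ xs ps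

    Unique-∷ : ∀ {x : A} {xs} → x ∉ xs → Unique xs → Unique (x ∷ xs)
    Unique-∷ x∉ u = All.tabulate (λ { m refl → x∉ m }) ∷ u

    Unique⇒∉ : ∀ {x : A} {xs} → Unique (x ∷ xs) → x ∉ xs
    Unique⇒∉ (p ∷ _) m = All.lookup p m refl

  -- The partner of the first element can be removed from `ys`, since no later element relates to
  -- it. A relation replaces a function because partners are found by search: equal elements in one
  -- use, component representatives in another.
  pigeonhole : ∀ {A B : Set} (R : A → B → Set) xs ys →
    AllPairs (λ x x′ → ∀ y → R x y → ¬ R x′ y) xs → All (λ x → Any (R x) ys) xs →
    length xs ℕ.≤ length ys
  pigeonhole R []       ys _        _        = z≤n
  pigeonhole R (x ∷ xs) ys (d ∷ ds) (a ∷ as) with find a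
  ... | y , y∈ys , r with ∈-∃++ y∈ys
  ...   | ys₁ , ys₂ , refl =
    subst (suc (length xs) ℕ.≤_)
      (≡.trans (cong suc (length-++ ys₁)) (≡.trans (sym (ℕ.+-suc _ _)) (sym (length-++ ys₁))))
      (s≤s (subst (length xs ℕ.≤_) refl (pigeonhole R xs (ys₁ ++ ys₂) ds (All.zipWith drop-y (d , as)))))
    where
    drop-y : ∀ {x′} → ((∀ y → R x y → ¬ R x′ y) × Any (R x′) (ys₁ ++ y ∷ ys₂)) → Any (R x′) (ys₁ ++ ys₂)
    drop-y (d , a) with Any.++⁻ ys₁ a
    ... | inj₁ p         = Any.++⁺ˡ p
    ... | inj₂ (here r′) = contradiction r′ (d y r)
    ... | inj₂ (there p) = Any.++⁺ʳ ys₁ p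

  Unique-⊆-length : ∀ {A : Set} {xs ys : List A} → Unique xs → xs ⊆ ys → length xs ℕ.≤ length ys
  Unique-⊆-length {xs = xs} {ys} u s = pigeonhole _≡_ xs ys (distinct u) (All.tabulate s)
    where
    distinct : ∀ {xs} → Unique xs → AllPairs (λ x x′ → ∀ y → x ≡ y → ¬ x′ ≡ y) xs
    distinct []       = []
    distinct (p ∷ ps) = All.map (λ { x≢x′ y refl refl → x≢x′ refl }) p ∷ distinct ps

  -- steps′ v vs e lists the steps of the walk v , vs , e.
  steps′ : ∀ {A : Set} → A → List A → A → List (A × A)
  steps′ v vs e = zip (v ∷ vs) (vs ∷ʳ e)

  module _ {A : Set} where

    steps′-++ : ∀ v vs w ws (e : A) → steps′ v (vs ++ w ∷ ws) e ≡ steps′ v vs w ++ steps′ w ws e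
    steps′-++ v []       w ws e = refl
    steps′-++ v (x ∷ vs) w ws e = cong ((v , x) ∷_) (steps′-++ x vs w ws e)

    steps′-source : ∀ v vs {e x y : A} → (x , y) ∈ steps′ v vs e → x ∈ v ∷ vs
    steps′-source v []       (here refl) = here refl
    steps′-source v (w ∷ vs) (here refl) = here refl
    steps′-source v (w ∷ vs) (there m)   = there (steps′-source w vs m)

    steps′-target : ∀ v vs {e x y : A} → (x , y) ∈ steps′ v vs e → y ∈ vs ∷ʳ e
    steps′-target v []       (here refl) = here refl
    steps′-target v (w ∷ vs) (here refl) = here refl
    steps′-target v (w ∷ vs) (there m)   = there (steps′-target w vs m)

    steps′-from : ∀ v vs (e : A) {x} → x ∈ v ∷ vs → ∃[ y ] (x , y) ∈ steps′ v vs e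
    steps′-from v []       e (here refl) = e , here refl
    steps′-from v (w ∷ vs) e (here refl) = w , here refl
    steps′-from v (w ∷ vs) e (there m) with steps′-from w vs e m
    ... | y , p = y , there p

    steps′-into : ∀ v vs (e : A) {y} → y ∈ vs ∷ʳ e → ∃[ x ] (x , y) ∈ steps′ v vs e
    steps′-into v []       e (here refl) = v , here refl
    steps′-into v (w ∷ vs) e (here refl) = v , here refl
    steps′-into v (w ∷ vs) e (there m) with steps′-into w vs e m
    ... | y , p = y , there p

    steps′-star : ∀ v vs {e : A} {R : A → A → Set} → All (λ (x , y) → R x y) (steps′ v vs e) → Star R v e
    steps′-star v []       (r ∷ _)  = r ◅ ε
    steps′-star v (w ∷ vs) (r ∷ rs) = r ◅ steps′-star w vs rs

    steps′-split : ∀ v vs {e a b : A} → (a , b) ∈ steps′ v vs e →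
      (b ≡ e × ∃[ ps ] v ∷ vs ≡ ps ∷ʳ a) ⊎ (∃[ ps ] ∃[ qs ] v ∷ vs ≡ (ps ∷ʳ a) ++ b ∷ qs)
    steps′-split v []       (here refl) = inj₁ (refl , [] , refl)
    steps′-split v (w ∷ vs) (here refl) = inj₂ ([] , vs , refl)
    steps′-split v (w ∷ vs) (there m) with steps′-split w vs m
    ... | inj₁ (refl , ps , eq) = inj₁ (refl , v ∷ ps , cong (v ∷_) eq)
    ... | inj₂ (ps , qs , eq)   = inj₂ (v ∷ ps , qs , cong (v ∷_) eq)

  module GraphCycles {n : ℕ} (G : Graph (Fin n)) where
    open Graph G public
    open FiniteGraph G public
    open DecMembership (Fin._≟_ {n}) using (_∈?_)

    step-from : ∀ c {x} → x ∈ c → ∃[ y ] (x , y) ∈ steps c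
    step-from (v ∷ vs) = steps′-from v vs v

    step-into : ∀ c {y} → y ∈ c → ∃[ x ] (x , y) ∈ steps c
    step-into (v ∷ vs) m = steps′-into v vs v (Perm.∈-resp-↭ (Perm.∷↭∷ʳ v vs) m)

    step-source : ∀ c {x y} → (x , y) ∈ steps c → x ∈ c
    step-source (v ∷ vs) = steps′-source v vs

    step-target : ∀ c {x y} → (x , y) ∈ steps c → y ∈ c
    step-target (v ∷ vs) m = Perm.∈-resp-↭ (↭-sym (Perm.∷↭∷ʳ v vs)) (steps′-target v vs m)

    orientedEdges-steps : ∀ c {x y} → (x , y) ∈ orientedEdges c → (x , y) ∈ steps c ⊎ (y , x) ∈ steps c
    orientedEdges-steps c m with ∈-++⁻ (steps c) m
    ... | inj₁ p = inj₁ p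
    ... | inj₂ p with ∈-map⁻ swap p
    ...   | _ , q , refl = inj₂ q

    orientedEdges-swap : ∀ c {x y} → (x , y) ∈ orientedEdges c → (y , x) ∈ orientedEdges c
    orientedEdges-swap c m with ∈-++⁻ (steps c) m
    ... | inj₁ p = ∈-++⁺ʳ (steps c) (∈-map⁺ swap p)
    ... | inj₂ p with ∈-map⁻ swap p
    ...   | _ , q , refl = ∈-++⁺ˡ q

    orientedEdges-source : ∀ c {x y} → (x , y) ∈ orientedEdges c → x ∈ c
    orientedEdges-source c m with ∈-++⁻ (steps c) m
    ... | inj₁ p = step-source c p
    ... | inj₂ p with ∈-map⁻ swap p
    ...   | _ , q , refl = step-target c q

    orientedEdges-target : ∀ c {x y} → (x , y) ∈ orientedEdges c → y ∈ c
    orientedEdges-target c = orientedEdges-source c ∘ orientedEdges-swap c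

    orientedEdges-adj : ∀ {c} → IsCycle c → ∀ {x y} → (x , y) ∈ orientedEdges c → x ~ y
    orientedEdges-adj {c} (_ , _ , adj) m with ∈-++⁻ (steps c) m
    ... | inj₁ p = All.lookup adj p
    ... | inj₂ p with ∈-map⁻ swap p
    ...   | _ , q , refl = sym-~ (All.lookup adj q)

    steps-rotate : ∀ ps qs → steps (ps ++ qs) ↭ steps (qs ++ ps)
    steps-rotate []       qs       = subst (λ l → steps qs ↭ steps l) (sym (++-identityʳ qs)) ↭-refl
    steps-rotate (v ∷ vs) []       = subst (λ l → steps l ↭ steps (v ∷ vs)) (sym (++-identityʳ (v ∷ vs))) ↭-refl
    steps-rotate (v ∷ vs) (w ∷ ws) = ≡.subst₂ _↭_
      (sym (steps′-++ v vs w ws v)) (sym (steps′-++ w ws v vs w))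
      (Perm.++-comm (steps′ v vs w) (steps′ w ws v))

    isCycle-rotate : ∀ ps qs → IsCycle (ps ++ qs) → IsCycle (qs ++ ps)
    isCycle-rotate ps qs (len , uniq , adj) =
        subst (3 ℕ.≤_) (Perm.↭-length (Perm.++-comm ps qs)) len
      , Unique-resp-↭ (Perm.++-comm ps qs) uniq
      , Perm.All-resp-↭ (steps-rotate ps qs) adj

    -- Rotation makes the chosen step the closing one, so that the other steps form a walk from `b`
    -- to `a`.
    steps-open : ∀ {c a b} → IsCycle c → (a , b) ∈ steps c →
      ∃[ ws ] IsCycle (b ∷ ws ∷ʳ a) × steps (b ∷ ws ∷ʳ a) ↭ steps c
    steps-open {v ∷ vs} {a} {b} cyc m with steps′-split v vs m
    ... | inj₁ (refl , [] , refl)     = contradiction (proj₁ cyc) λ { (s≤s ()) }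
    ... | inj₁ (refl , p ∷ ps , refl) = ps , cyc , ↭-refl
    ... | inj₂ (ps , qs , eq) = qs ++ ps
      , subst IsCycle assoc (isCycle-rotate (ps ∷ʳ a) (b ∷ qs) (subst IsCycle eq cyc))
      , ≡.subst₂ (λ l l′ → steps l ↭ steps l′) assoc (sym eq) (steps-rotate (b ∷ qs) (ps ∷ʳ a))
      where
      assoc : (b ∷ qs) ++ (ps ∷ʳ a) ≡ b ∷ (qs ++ ps) ∷ʳ a
      assoc = cong (b ∷_) (sym (++-assoc qs ps [ a ]))

    steps-∷ʳ : ∀ b ws a → steps (b ∷ ws ∷ʳ a) ≡ steps′ b ws a ++ [ (a , b) ]
    steps-∷ʳ b ws a = steps′-++ b ws a [] b

    -- Both orientations are excluded, which deletes the undirected edge.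
    Avoiding : Fin n → Fin n → (Fin n → Fin n → Set) → Fin n → Fin n → Set
    Avoiding a b R x y = R x y × (x , y) ≢ (a , b) × (y , x) ≢ (a , b)

    avoiding-sym : ∀ {a b R} → (∀ {x y} → R x y → R y x) → ∀ {x y} → Avoiding a b R x y → Avoiding a b R y x
    avoiding-sym s (r , p , q) = s r , q , p

    avoiding-flip : ∀ {a b R x y} → Avoiding a b R x y → Avoiding b a R x y
    avoiding-flip (r , p , q) = r , (λ { refl → q refl }) , (λ { refl → p refl })

    step-arc : ∀ {c a b} → IsCycle c → (a , b) ∈ steps c →
      Star (Avoiding a b (λ x y → (x , y) ∈ orientedEdges c)) b a
    step-arc {c} {a} {b} cyc p with steps-open cyc p
    ... | ws , (len , uniq , adj) , perm = steps′-star b ws (All.tabulate edge)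
      where
      a∉ : a ∉ b ∷ ws
      a∉ = Unique⇒∉ (Unique-resp-↭ (↭-sym (Perm.∷↭∷ʳ a (b ∷ ws))) uniq)
      -- Length at least three matters here: on two vertices the way back would be the deleted edge
      -- itself.
      not-back : ∀ ws → 3 ℕ.≤ length (b ∷ ws ∷ʳ a) → Unique (b ∷ ws ∷ʳ a) → (b , a) ∉ steps′ b ws a
      not-back [] (s≤s (s≤s ())) _ _
      not-back (w ∷ ws) _ (_ ∷ w∉ ∷ _) (here refl) = All.lookup w∉ (∈-++⁺ʳ ws (here refl)) refl
      not-back (w ∷ ws) _ (b∉ ∷ _) (there m) = All.lookup b∉ (∈-++⁺ˡ (steps′-source w ws m)) refl
      edge : ∀ {e} → e ∈ steps′ b ws a → Avoiding a b (λ x y → (x , y) ∈ orientedEdges c) (proj₁ e) (proj₂ e)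
      edge m = ∈-++⁺ˡ (Perm.∈-resp-↭ perm (subst (_ ∈_) (sym (steps-∷ʳ b ws a)) (∈-++⁺ˡ m)))
        , (λ { refl → a∉ (steps′-source b ws m) })
        , (λ { refl → not-back ws len uniq m })

    cycle-arc : ∀ {c a b} → IsCycle c → (a , b) ∈ orientedEdges c →
      Star (Avoiding a b (λ x y → (x , y) ∈ orientedEdges c)) b a
    cycle-arc {c} cyc m with ∈-++⁻ (steps c) m
    ... | inj₁ p = step-arc cyc p
    ... | inj₂ p with ∈-map⁻ swap p
    ...   | _ , q , refl = Star.reverse
      (λ {x} {y} → avoiding-sym {R = λ x y → (x , y) ∈ orientedEdges c} (orientedEdges-swap c) {x} {y})
      (Star.map (λ {x} {y} → avoiding-flip {R = λ x y → (x , y) ∈ orientedEdges c} {x} {y}) (step-arc cyc q))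

    SimplePath : (Fin n → Fin n → Set) → Fin n → Fin n → List (Fin n) → Set
    SimplePath R x y ws = Unique (x ∷ ws ∷ʳ y) × All (λ (u , v) → R u v) (steps′ x ws y)

    simplePath-suffix : ∀ {R z y x} ws → SimplePath R z y ws → x ∈ z ∷ ws → ∃[ ws′ ] SimplePath R x y ws′
    simplePath-suffix ws       p (here refl) = ws , p
    simplePath-suffix (w ∷ ws) (_ ∷ u , _ ∷ r) (there m) = simplePath-suffix ws (u , r) m

    -- If the new starting vertex already lies on the path found so far, the path is cut there
    -- instead of being extended.
    loop-erase : ∀ {R x y} → Star R x y → x ≡ y ⊎ ∃[ ws ] SimplePath R x y ws
    loop-erase ε = inj₁ refl
    loop-erase {x = x} {y} (_◅_ {j = z} r p) with x Fin.≟ y | loop-erase p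
    ... | yes x≡y | _ = inj₁ x≡y
    ... | no x≢y | inj₁ refl = inj₂ ([] , Unique-∷ (λ { (here eq) → x≢y eq }) ([] ∷ []) , r ∷ [])
    ... | no x≢y | inj₂ (ws , q@(u , rs)) with x ∈? z ∷ ws
    ...   | yes x∈ = inj₂ (simplePath-suffix ws q x∈)
    ...   | no x∉  = inj₂ (z ∷ ws , Unique-∷ ([ x∉ , (λ { (here eq) → x≢y eq }) ]′ ∘ ∈-++⁻ (z ∷ ws)) u , r ∷ rs)

    -- The second route, made simple, closes up with the edge; it has an interior vertex because the
    -- edge itself is forbidden on it.
    cycle-through : ∀ {a b} → a ~ b → Star (Avoiding a b _~_) b a →
      ∃[ c ] IsCycle c × (a , b) ∈ steps c
    cycle-through {a} {b} a~b p with loop-erase p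
    ... | inj₁ refl = contradiction a~b (irrefl refl)
    ... | inj₂ ([] , _ , (_ , _ , b≢) ∷ []) = contradiction refl b≢
    ... | inj₂ (ws@(_ ∷ ws′) , u , rs) = b ∷ ws ∷ʳ a
      , (s≤s (s≤s (subst (1 ℕ.≤_) (Perm.↭-length (Perm.∷↭∷ʳ a ws′)) (s≤s z≤n)))
        , u , subst (All _) (sym (steps-∷ʳ b ws a)) (All.++⁺ (All.map proj₁ rs) (a~b ∷ [])))
      , subst ((a , b) ∈_) (sym (steps-∷ʳ b ws a)) (∈-++⁺ʳ (steps′ b ws a) (here refl))

    Acyclic : List (Fin n) → Set
    Acyclic W = ∀ c → IsCycle c → ¬ All (_∈ W) c

    Leaf : List (Fin n) → Set
    Leaf W = ∃[ y ] ∃[ x ] (y ∈ W × x ∈ W × x ~ y × ∀ z → z ∈ W → z ~ y → z ≡ x)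

    data Path : Fin n → List (Fin n) → Set where
      [] : ∀ {x} → Path x []
      _∷_ : ∀ {x y ys} → x ~ y → Path y ys → Path x (y ∷ ys)

    path-prefix : ∀ {x ys z} → Path x ys → z ∈ ys →
      ∃[ ws ] ∃[ vs ] x ∷ ys ≡ (x ∷ ws ∷ʳ z) ++ vs × All (λ (u , v) → u ~ v) (steps′ x ws z)
    path-prefix (_∷_ {ys = ys} e p) (here refl) = [] , ys , refl , e ∷ []
    path-prefix {x} (e ∷ p) (there m) with path-prefix p m
    ... | ws , vs , eq , es = _ ∷ ws , vs , cong (x ∷_) eq , e ∷ es

    -- Extend a simple path inside W at its front until its first vertex is a leaf.
    find-leaf : ∀ {W} → Acyclic W → ∀ {x y} → x ∈ W → y ∈ W → x ~ y → Leaf W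
    find-leaf {W} acyclic x∈ y∈ x~y = grow n (x~y ∷ [])
      (Unique-∷ (λ { (here eq) → irrefl eq x~y }) ([] ∷ [])) (x∈ ∷ y∈ ∷ []) (ℕ.≤-reflexive (ℕ.+-comm 1 n))
      where
      grow : ∀ k {x y ys} → Path x (y ∷ ys) → Unique (x ∷ y ∷ ys) → All (_∈ W) (x ∷ y ∷ ys) →
        suc n ℕ.≤ k ℕ.+ length (y ∷ ys) → Leaf W
      grow zero {x} {y} {ys} _ u _ le = contradiction
        (ℕ.≤-trans (Unique-⊆-length u (λ _ → ∈-allFin _)) (ℕ.≤-reflexive (length-tabulate id)))
        (ℕ.<⇒≱ (ℕ.m≤n⇒m≤1+n le))
      grow (suc k) {x} {y} {ys} (e ∷ p) u (x∈ ∷ y∈ ∷ ys∈) le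
        with any? (λ z → (z ~? x) ×-dec ¬? (z Fin.≟ y)) W
      ... | no none = x , y , x∈ , y∈ , sym-~ e , only
        where
        only : ∀ z → z ∈ W → z ~ x → z ≡ y
        only z z∈ z~x with z Fin.≟ y
        ... | yes eq = eq
        ... | no z≢y = contradiction (lose z∈ (z~x , z≢y)) none
      ... | yes some with find some
      ...   | z , z∈ , z~x , z≢y with z ∈? x ∷ y ∷ ys
      ...     | no z∉ = grow k (z~x ∷ e ∷ p) (Unique-∷ z∉ u) (z∈ ∷ x∈ ∷ y∈ ∷ ys∈)
                  (subst (suc n ℕ.≤_) (sym (ℕ.+-suc k _)) le)
      ...     | yes (here eq)          = contradiction z~x (irrefl eq)
      ...     | yes (there (here eq))  = contradiction eq z≢y
      ...     | yes (there (there m)) with path-prefix (e ∷ p) (there m)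
      ...       | [] , vs , refl , _ = contradiction refl z≢y
      ...       | w ∷ ws , vs , eq , es = contradiction
        (All.++⁻ˡ (x ∷ (w ∷ ws) ∷ʳ z) (subst (All (_∈ W)) eq (x∈ ∷ y∈ ∷ ys∈)))
        (acyclic (x ∷ (w ∷ ws) ∷ʳ z)
          ( s≤s (s≤s (subst (1 ℕ.≤_) (Perm.↭-length (Perm.∷↭∷ʳ z ws)) (s≤s z≤n)))
          , Unique-++⁻ˡ _ (subst Unique eq u)
          , subst (All _) (sym (steps-∷ʳ x (w ∷ ws) z)) (All.++⁺ es (z~x ∷ []))))

    steps′-reach : ∀ v vs {e z : Fin n} → z ∈ v ∷ vs → Star (λ x y → (x , y) ∈ steps′ v vs e) v z
    steps′-reach v vs       (here refl) = ε
    steps′-reach v (w ∷ vs) (there m)   = here refl ◅ Star.map there (steps′-reach w vs m)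

    cycle-connected : ∀ c {x y} → x ∈ c → y ∈ c → Star (λ x y → (x , y) ∈ orientedEdges c) x y
    cycle-connected c@(v ∷ vs) x∈ y∈ =
      Star.reverse (λ {x} {y} → orientedEdges-swap c {x} {y}) (from-head x∈) ◅◅ from-head y∈
      where
      from-head : ∀ {x} → x ∈ c → Star (λ x y → (x , y) ∈ orientedEdges c) v x
      from-head m = Star.map ∈-++⁺ˡ (steps′-reach v vs m)

    -- If no edge of `c` leaves `d` at a common vertex, then following the connected cycle `c` from
    -- `v` never leaves `d`.
    diverge : ∀ c d {v} → v ∈ c → v ∈ d →
      (∃[ w ] ∃[ a ] ∃[ b ] (w , a) ∈ orientedEdges c × (w , a) ∉ orientedEdges d × (w , b) ∈ orientedEdges d)
      ⊎ orientedEdges c ⊆ orientedEdges d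
    diverge c d {v} v∈c v∈d with any? (λ e → (proj₁ e ∈? d) ×-dec ¬? (DecMembership._∈?_ (≡-dec Fin._≟_ Fin._≟_) e (orientedEdges d))) (orientedEdges c)
    ... | yes some with find some
    ...   | (w , a) , m , w∈d , ∉d with step-from d w∈d
    ...     | b , p = inj₁ (w , a , b , m , ∉d , ∈-++⁺ˡ p)
    diverge c d {v} v∈c v∈d | no none = inj₂ λ { {w , a} m →
        stay m (follow v∈d (cycle-connected c v∈c (orientedEdges-source c m))) }
      where
      stay : ∀ {w a} → (w , a) ∈ orientedEdges c → w ∈ d → (w , a) ∈ orientedEdges d
      stay {w} {a} m w∈d with DecMembership._∈?_ (≡-dec Fin._≟_ Fin._≟_) (w , a) (orientedEdges d)
      ... | yes p = p
      ... | no ¬p = contradiction (lose m (w∈d , ¬p)) none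
      follow : ∀ {w x} → w ∈ d → Star (λ x y → (x , y) ∈ orientedEdges c) w x → x ∈ d
      follow w∈d ε        = w∈d
      follow w∈d (m ◅ p) = follow (orientedEdges-target d (stay m w∈d)) p

-- Double counting for covers, and leaf removal.

module PeelingTheory where

  open CycleTheory
  open import Data.List.Base using ([_])
  open import Data.List.Properties using (filter-notAll; filter-++; map-++)
  open import Data.List.Relation.Binary.Permutation.Propositional using (prep)
  open import Relation.Binary.PropositionalEquality using (refl; sym)

  flatten : ∀ {A : Set} → List (A × A) → List A
  flatten = concatMap (λ (a , b) → a ∷ b ∷ [])

  module VertexCounting {n : ℕ} (Z : List (Fin n)) where
    open DecMembership (Fin._≟_ {n}) using (_∈?_)

    -- Multiplicities in `xs` count, so that a list of edges can enter through the list of its ends.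
    hits : List (Fin n) → ℕ
    hits xs = length (filter (_∈? Z) xs)

    hits-↭ : ∀ {xs ys} → xs ↭ ys → hits xs ≡ hits ys
    hits-↭ p = Perm.↭-length (Perm.filter-↭ (_∈? Z) p)

    hits-∷ : ∀ x xs → hits xs ℕ.≤ hits (x ∷ xs)
    hits-∷ x xs with x ∈? Z
    ... | yes _ = ℕ.n≤1+n _
    ... | no _  = ℕ.≤-refl

    hits-∈ : ∀ {x} xs → x ∈ Z → hits (x ∷ xs) ≡ suc (hits xs)
    hits-∈ {x} xs x∈ with x ∈? Z
    ... | yes _ = refl
    ... | no x∉ = contradiction x∈ x∉

    covered-hits : ∀ es → All (λ (a , b) → a ∈ Z ⊎ b ∈ Z) es → length es ℕ.≤ hits (flatten es)
    covered-hits [] _ = z≤n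
    covered-hits ((a , b) ∷ es) (inj₁ a∈ ∷ cs) = subst (suc (length es) ℕ.≤_) (sym (hits-∈ (b ∷ flatten es) a∈))
      (s≤s (ℕ.≤-trans (covered-hits es cs) (hits-∷ b _)))
    covered-hits ((a , b) ∷ es) (inj₂ b∈ ∷ cs) = ℕ.≤-trans
      (subst (suc (length es) ℕ.≤_) (sym (hits-∈ (flatten es) b∈)) (s≤s (covered-hits es cs)))
      (hits-∷ a _)

    doubly-covered-hits : ∀ es → All (λ (a , b) → a ∈ Z ⊎ b ∈ Z) es →
      ∀ {a b} → (a , b) ∈ es → a ∈ Z → b ∈ Z → length es ℕ.< hits (flatten es)
    doubly-covered-hits ((a , b) ∷ es) (_ ∷ cs) (here refl) a∈ b∈ =
      subst (suc (suc (length es)) ℕ.≤_)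
        (sym (≡.trans (hits-∈ (b ∷ flatten es) a∈) (cong suc (hits-∈ (flatten es) b∈))))
        (s≤s (s≤s (covered-hits es cs)))
    doubly-covered-hits ((a , b) ∷ es) (inj₁ a∈ ∷ cs) (there m) p q =
      subst (suc (suc (length es)) ℕ.≤_) (sym (hits-∈ (b ∷ flatten es) a∈))
        (s≤s (ℕ.≤-trans (doubly-covered-hits es cs m p q) (hits-∷ b _)))
    doubly-covered-hits ((a , b) ∷ es) (inj₂ b∈ ∷ cs) (there m) p q = ℕ.≤-trans
      (subst (suc (suc (length es)) ℕ.≤_) (sym (hits-∈ (flatten es) b∈)) (s≤s (doubly-covered-hits es cs m p q)))
      (hits-∷ a _)

    module _ {S : List (Fin n)} (uniq : Unique S) where

      unique-hits : hits S ℕ.≤ length Z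
      unique-hits = Unique-⊆-length (Unique.filter⁺ (_∈? Z) uniq) (proj₂ ∘ ∈-filter⁻ (_∈? Z) {xs = S})

      unique-hits-< : ∀ {z} → z ∈ Z → z ∉ S → hits S ℕ.< length Z
      unique-hits-< {z} z∈ z∉ = Unique-⊆-length
        (Unique-∷ (z∉ ∘ proj₁ ∘ ∈-filter⁻ (_∈? Z) {xs = S}) (Unique.filter⁺ (_∈? Z) uniq))
        λ { (here refl) → z∈ ; (there m) → proj₂ (∈-filter⁻ (_∈? Z) {xs = S} m) }

      module _ {es} (double : flatten es ↭ S ++ S)
               (covered : All (λ (a , b) → a ∈ Z ⊎ b ∈ Z) es) where

        hits-double : hits (flatten es) ≡ hits S ℕ.+ hits S
        hits-double = ≡.trans (hits-↭ double)
          (≡.trans (cong length (filter-++ (_∈? Z) S S)) (length-++ (filter (_∈? Z) S)))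

        -- Every edge has an end in `Z` and every vertex of `S` is an end exactly twice, so |es| ≤
        -- 2|Z ∩ S| ≤ 2|Z|.
        double-cover-≤ : length es ℕ.≤ length Z ℕ.+ length Z
        double-cover-≤ = ℕ.≤-trans (covered-hits es covered)
          (ℕ.≤-trans (ℕ.≤-reflexive hits-double) (ℕ.+-mono-≤ unique-hits unique-hits))

        module _ (tight : length Z ℕ.+ length Z ℕ.≤ length es) where

          -- An edge with both ends in `Z`, or as in `tight-⊆` a vertex of `Z` outside `S`, would
          -- make one inequality of `double-cover-≤` strict.
          tight-one-end : ∀ {a b} → (a , b) ∈ es → a ∈ Z → b ∉ Z
          tight-one-end m a∈ b∈ = ℕ.<⇒≱ (doubly-covered-hits es covered m a∈ b∈)
            (ℕ.≤-trans (ℕ.≤-reflexive hits-double) (ℕ.≤-trans (ℕ.+-mono-≤ unique-hits unique-hits) tight))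

          tight-⊆ : Z ⊆ S
          tight-⊆ {z} z∈ with z ∈? S
          ... | yes z∈S = z∈S
          ... | no z∉S = contradiction (ℕ.≤-trans tight (covered-hits es covered))
            (ℕ.<⇒≱ (ℕ.≤-trans (s≤s (ℕ.≤-reflexive hits-double))
              (ℕ.+-mono-<-≤ (unique-hits-< z∈ z∉S) unique-hits)))

  -- In a peeling, y is a leaf with neighbour x among the vertices still present at
  -- the pair (x , y). In this nested order of (row , column) pairs every row then
  -- misses all later columns.
  tri : ∀ {A : Set} → List (A × A) → List (A × A)
  tri []            = []
  tri ((x , y) ∷ L) = (y , x) ∷ tri L ∷ʳ (x , y)

  ends : ∀ {A : Set} → List (A × A) → List A
  ends L = map proj₂ (tri L)

  module _ {A : Set} where

    length-tri : ∀ (L : List (A × A)) → length (tri L) ≡ length L ℕ.+ length L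
    length-tri [] = refl
    length-tri ((x , y) ∷ L) = cong suc (≡.trans (length-++ (tri L))
      (≡.trans (ℕ.+-comm _ 1) (≡.trans (cong suc (length-tri L)) (sym (ℕ.+-suc (length L) (length L))))))

    tri-∈ : ∀ (L : List (A × A)) {ρ s} → (ρ , s) ∈ tri L → (ρ , s) ∈ L ⊎ (s , ρ) ∈ L
    tri-∈ ((x , y) ∷ L) (here refl) = inj₂ (here refl)
    tri-∈ ((x , y) ∷ L) (there m) with ∈-++⁻ (tri L) m
    ... | inj₁ p           = Sum.map there there (tri-∈ L p)
    ... | inj₂ (here refl) = inj₁ (here refl)

    flatten-↭-ends : ∀ (L : List (A × A)) → flatten L ↭ ends L
    flatten-↭-ends [] = ↭-refl
    flatten-↭-ends ((x , y) ∷ L) = prep x (↭-trans (prep y (flatten-↭-ends L))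
      (subst (y ∷ ends L ↭_) (sym (map-++ proj₂ (tri L) [ (x , y) ])) (Perm.∷↭∷ʳ y (ends L))))

    ends-All : ∀ {P : A → Set} (L : List (A × A)) → All (λ (x , y) → P x × P y) L → All P (ends L)
    ends-All {P} L ps = All.map⁺ (All.tabulate pick)
      where
      pick : ∀ {e} → e ∈ tri L → P (proj₂ e)
      pick m with tri-∈ L m
      ... | inj₁ p = proj₂ (All.lookup ps p)
      ... | inj₂ p = proj₁ (All.lookup ps p)

  module Peeling {n : ℕ} (G : Graph (Fin n)) where
    open GraphCycles G public
    open DecMembership (Fin._≟_ {n}) using (_∈?_)

    data Tri : List (Fin n × Fin n) → Set where
      []  : Tri []
      _∷_ : ∀ {ρ s es} → ρ ~ s × All (λ e → ¬ ρ ~ proj₂ e) es → Tri es → Tri ((ρ , s) ∷ es)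

    Tri-∷ʳ : ∀ {es ρ s} → Tri es → All (λ e → ¬ proj₁ e ~ s) es → ρ ~ s → Tri (es ∷ʳ (ρ , s))
    Tri-∷ʳ []            []       r = (r , []) ∷ []
    Tri-∷ʳ ((p , q) ∷ t) (d ∷ ds) r = (p , All.++⁺ q (d ∷ [])) ∷ Tri-∷ʳ t ds r

    Tri-filter : ∀ {P : Fin n × Fin n → Set} (P? : ∀ e → Dec (P e)) {es} → Tri es → Tri (filter P? es)
    Tri-filter P? [] = []
    Tri-filter P? (_∷_ {ρ} {s} (p , q) t) with P? (ρ , s)
    ... | yes _ = (p , All.filter⁺ P? q) ∷ Tri-filter P? t
    ... | no _  = Tri-filter P? t

    Tri-adj : ∀ {es ρ s} → Tri es → (ρ , s) ∈ es → ρ ~ s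
    Tri-adj ((p , _) ∷ _) (here refl) = p
    Tri-adj (_ ∷ t)       (there m)   = Tri-adj t m

    Tri-unique : ∀ {es} → Tri es → Unique (map proj₂ es)
    Tri-unique [] = []
    Tri-unique ((p , q) ∷ t) = All.map⁺ (All.map (λ { ¬r refl → ¬r p }) q) ∷ Tri-unique t

    -- König duality for forests in constructive form: `pairs` gives 2|pairs| independent columns, a
    -- lower bound for the rank, and its first components form a cover, whose upper bound for the
    -- rank inside `W` is the same number.
    record Peel (W : List (Fin n)) : Set where
      field
        pairs      : List (Fin n × Fin n)
        inside     : All (λ (x , y) → x ∈ W × y ∈ W) pairs
        triangular : Tri (tri pairs)
      cover = map proj₁ pairs
      field
        covers     : ∀ {a b} → a ∈ W → b ∈ W → a ~ b → a ∈ cover ⊎ b ∈ cover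

      ends⊆ : ends pairs ⊆ W
      ends⊆ = All.lookup (ends-All pairs inside)

      pairs-adj : ∀ {x y} → (x , y) ∈ pairs → x ~ y
      pairs-adj = adj pairs triangular
        where
        adj : ∀ L → Tri (tri L) → ∀ {x y} → (x , y) ∈ L → x ~ y
        adj ((x , y) ∷ L) t (here refl) = sym-~ (Tri-adj t (here refl))
        adj ((x , y) ∷ L) (_ ∷ t) (there m) = adj L (init t) m
          where
          init : ∀ {es e} → Tri (es ∷ʳ e) → Tri es
          init {[]}     _             = []
          init {_ ∷ es} ((p , q) ∷ t) = (p , All.++⁻ˡ es q) ∷ init t

    abstract
      peel : ∀ W → Acyclic W → Peel W
      peel W acyclic = go (length W) W ℕ.≤-refl acyclic
        where
        go : ∀ k W → length W ℕ.≤ k → Acyclic W → Peel W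
        go k W le acyclic with any? (λ x → any? (λ y → x ~? y) W) W
        ... | no none = record { pairs = [] ; inside = [] ; triangular = []
                ; covers = λ a∈ b∈ a~b → contradiction (lose a∈ (lose b∈ a~b)) none }
        go zero [] le acyclic | yes ()
        go (suc k) W le acyclic | yes some with find some
        ... | u , u∈ , some′ with find some′
        ...   | v , v∈ , u~v with find-leaf acyclic u∈ v∈ u~v
        ...     | y , x , y∈ , x∈ , x~y , only = record
          { pairs = (x , y) ∷ L
          ; inside = (x∈ , y∈) ∷ All.map (λ (p , q) → W′⊆ p , W′⊆ q) inside
          ; triangular = (sym-~ x~y , All.++⁺ (All.tabulate not-y~) (irrefl refl ∷ []))
              ∷ Tri-∷ʳ triangular (All.tabulate not-~y) x~y
          ; covers = covers′ }
          where
          -- Only `x` is removed; the leaf `y` stays behind, isolated.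
          W′ : List (Fin n)
          W′ = filter (λ z → ¬? (z Fin.≟ x)) W
          W′⊆ : W′ ⊆ W
          W′⊆ = proj₁ ∘ ∈-filter⁻ (λ z → ¬? (z Fin.≟ x)) {xs = W}
          x∉W′ : x ∉ W′
          x∉W′ m = proj₂ (∈-filter⁻ (λ z → ¬? (z Fin.≟ x)) {xs = W} m) refl
          rest : Peel W′
          rest = go k W′ (ℕ.≤-pred (ℕ.≤-trans (filter-notAll (λ z → ¬? (z Fin.≟ x)) W (lose x∈ (λ ¬r → ¬r refl))) le))
            (λ c cyc c⊆ → acyclic c cyc (All.map W′⊆ c⊆))
          open Peel rest renaming (pairs to L)
          not-adj : ∀ {z} → z ∈ W′ → ¬ z ~ y
          not-adj z∈ z~y = x∉W′ (subst (_∈ W′) (only _ (W′⊆ z∈) z~y) z∈)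
          rows-inside : ∀ {e} → e ∈ tri L → proj₁ e ∈ W′ × proj₂ e ∈ W′
          rows-inside m with tri-∈ L m
          ... | inj₁ p = All.lookup inside p
          ... | inj₂ p = proj₂ (All.lookup inside p) , proj₁ (All.lookup inside p)
          not-y~ : ∀ {e} → e ∈ tri L → ¬ y ~ proj₂ e
          not-y~ m = not-adj (proj₂ (rows-inside m)) ∘ sym-~
          not-~y : ∀ {e} → e ∈ tri L → ¬ proj₁ e ~ y
          not-~y m = not-adj (proj₁ (rows-inside m))
          covers′ : ∀ {a b} → a ∈ W → b ∈ W → a ~ b → a ∈ x ∷ cover ⊎ b ∈ x ∷ cover
          covers′ {a} {b} a∈ b∈ a~b with a Fin.≟ x | b Fin.≟ x
          ... | yes eq | _      = inj₁ (here eq)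
          ... | no _   | yes eq = inj₂ (here eq)
          ... | no a≢ | no b≢  = Sum.map there there
            (covers (∈-filter⁺ (λ z → ¬? (z Fin.≟ x)) a∈ a≢) (∈-filter⁺ (λ z → ¬? (z Fin.≟ x)) b∈ b≢) a~b)

-- The cyclomatic number and non-tree edges.

module CycleRankTheory where

  open CycleTheory
  open PeelingTheory using (module Peeling)
  open import Data.List.Base using ([_]; cartesianProduct; deduplicate)
  open import Data.List.Membership.Propositional.Properties using (∈-tabulate⁻; ∈-cartesianProduct⁺)
  open import Data.List.Properties using (map-tabulate; filter-all)
  import Data.List.Relation.Unary.AllPairs.Properties as AllPairs
  open import Relation.Binary.Core using (Rel)
  open import Relation.Binary.Definitions using (Decidable; Reflexive; Transitive; tri<; tri≈; tri>)
  open import Relation.Binary.PropositionalEquality using (refl; sym)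
  open import Relation.Nullary.Decidable using (_⊎-dec_)

  module _ {A : Set} {R : Rel A 0ℓ} (R? : Decidable R) where

    deduplicate-covers : Reflexive R → Transitive R →
      ∀ {x} xs → x ∈ xs → Any (λ y → R y x) (deduplicate R? xs)
    deduplicate-covers rfl trs (x ∷ xs) (here refl) = here rfl
    deduplicate-covers rfl trs {x} (h ∷ xs) (there m) with find (deduplicate-covers rfl trs xs m)
    ... | y , y∈ , r with R? h y
    ...   | yes r′ = here (trs r′ r)
    ...   | no ¬r′ = there (lose (∈-filter⁺ (¬? ∘ R? h) y∈ ¬r′) r)

    deduplicate-unrelated : ∀ xs → AllPairs (λ x y → ¬ R x y) (deduplicate R? xs)
    deduplicate-unrelated []       = []
    deduplicate-unrelated (x ∷ xs) =
      All.all-filter (¬? ∘ R? x) (deduplicate R? xs) ∷ AllPairs.filter⁺ (¬? ∘ R? x) (deduplicate-unrelated xs)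

  module CycleRank {n : ℕ} (G : Graph (Fin n)) where
    open Peeling G public
    open DecMembership (≡-dec (Fin._≟_ {n}) (Fin._≟_ {n})) using (_∈?_)

    Edge : Set
    Edge = Fin n × Fin n

    Among : List Edge → Fin n → Fin n → Set
    Among es x y = (x , y) ∈ es ⊎ (y , x) ∈ es

    spanned : List Edge → Graph (Fin n)
    spanned es = record
      { _~_    = λ x y → x ~ y × Among es x y
      ; _~?_   = λ x y → (x ~? y) ×-dec (((x , y) ∈? es) ⊎-dec ((y , x) ∈? es))
      ; sym-~  = λ (e , m) → sym-~ e , Sum.swap m
      ; irrefl = λ eq (e , _) → irrefl eq e
      }

    Conn : List Edge → Fin n → Fin n → Set
    Conn es = Star (Graph._~_ (spanned es))

    abstract
      conn? : ∀ es → Decidable (Conn es)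
      conn? es = connected? (spanned es) Fin._≟_ (allFin n) ∈-allFin

    conn-sym : ∀ {es x y} → Conn es x y → Conn es y x
    conn-sym {es} = Star.reverse (λ {x} {y} → Graph.sym-~ (spanned es) {x} {y})

    conn-mono : ∀ {es es′} → es ⊆ es′ → ∀ {x y} → Conn es x y → Conn es′ x y
    conn-mono s = Star.map (λ (e , m) → e , Sum.map s s m)

    -- The list is read from its back: an edge is redundant if the edges behind it
    -- already connect its ends.
    nontree : List Edge → List Edge
    nontree [] = []
    nontree ((a , b) ∷ es) with conn? es a b
    ... | yes _ = (a , b) ∷ nontree es
    ... | no _  = nontree es

    nontree-closing : ∀ {a b} es → Conn es a b → nontree ((a , b) ∷ es) ≡ (a , b) ∷ nontree es
    nontree-closing {a} {b} es p with conn? es a b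
    ... | yes _ = refl
    ... | no ¬p = contradiction p ¬p

    nontree-∷ : ∀ e es → nontree es ⊆ nontree (e ∷ es)
    nontree-∷ (a , b) es m with conn? es a b
    ... | yes _ = there m
    ... | no _  = m

    -- Repeated passages through the new edge cancel, so one crossing in one direction is enough.
    conn-∷ : ∀ {a b es x y} → Conn ((a , b) ∷ es) x y →
      Conn es x y ⊎ (Conn es x a × Conn es b y) ⊎ (Conn es x b × Conn es a y)
    conn-∷ ε = inj₁ ε
    conn-∷ ((e , inj₁ (here refl)) ◅ p) with conn-∷ p
    ... | inj₁ q              = inj₂ (inj₁ (ε , q))
    ... | inj₂ (inj₁ (_ , q)) = inj₂ (inj₁ (ε , q))
    ... | inj₂ (inj₂ (_ , q)) = inj₁ q
    conn-∷ ((e , inj₂ (here refl)) ◅ p) with conn-∷ p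
    ... | inj₁ q              = inj₂ (inj₂ (ε , q))
    ... | inj₂ (inj₁ (_ , q)) = inj₁ q
    ... | inj₂ (inj₂ (_ , q)) = inj₂ (inj₂ (ε , q))
    conn-∷ ((e , inj₁ (there m)) ◅ p) = Sum.map (s ◅_) (Sum.map (λ (q , r) → s ◅ q , r) (λ (q , r) → s ◅ q , r)) (conn-∷ p)
      where s = e , inj₁ m
    conn-∷ ((e , inj₂ (there m)) ◅ p) = Sum.map (s ◅_) (Sum.map (λ (q , r) → s ◅ q , r) (λ (q , r) → s ◅ q , r)) (conn-∷ p)
      where s = e , inj₂ m

    Separated : List Edge → List (Fin n) → Set
    Separated es = AllPairs (λ x y → ¬ Conn es x y)

    -- A separated list has at most one member in the component of `a`.
    separated-drop : ∀ es a R → Separated es R → length R ℕ.≤ suc (length (filter (¬? ∘ conn? es a) R))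
    separated-drop es a [] _ = z≤n
    separated-drop es a (x ∷ R) (d ∷ ds) with conn? es a x
    ... | no _  = s≤s (separated-drop es a R ds)
    ... | yes p = s≤s (ℕ.≤-reflexive (sym (cong length
                    (filter-all (¬? ∘ conn? es a) (All.map (λ ¬q q → ¬q (conn-sym p ◅◅ q)) d)))))

    -- A redundant edge lengthens `es` and `nontree` alike; a tree edge merges two components and
    -- costs the separated list at most one member. Only a lower bound for the number of components
    -- is needed, so pairwise unconnected vertices can stand in for them.
    separated-list : ∀ es → ∃[ R ] Separated es R × n ℕ.+ length (nontree es) ℕ.≤ length es ℕ.+ length R
    separated-list [] = allFin n , AllPairs.map (λ { x≢y ε → x≢y refl ; x≢y ((_ , inj₁ ()) ◅ _) ; x≢y ((_ , inj₂ ()) ◅ _) }) (Unique.allFin⁺ n)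
      , ℕ.≤-reflexive (≡.trans (ℕ.+-identityʳ n) (sym (length-tabulate id)))
    separated-list ((a , b) ∷ es) with separated-list es | conn? es a b
    ... | R , sep , le | yes p = R , AllPairs.map (λ ¬q q → ¬q (contract q)) sep
        , ℕ.≤-trans (ℕ.≤-reflexive (ℕ.+-suc n _)) (s≤s le)
      where
      contract : ∀ {x y} → Conn ((a , b) ∷ es) x y → Conn es x y
      contract q with conn-∷ q
      ... | inj₁ r              = r
      ... | inj₂ (inj₁ (r , s)) = r ◅◅ p ◅◅ s
      ... | inj₂ (inj₂ (r , s)) = r ◅◅ conn-sym p ◅◅ s
    ... | R , sep , le | no _ = filter (¬? ∘ conn? es a) R
        , separate (All.all-filter (¬? ∘ conn? es a) R) (AllPairs.filter⁺ (¬? ∘ conn? es a) sep)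
        , ℕ.≤-trans le (ℕ.≤-trans (ℕ.+-monoʳ-≤ (length es) (separated-drop es a R sep)) (ℕ.≤-reflexive (ℕ.+-suc (length es) _)))
      where
      avoid : ∀ {x y} → ¬ Conn es a x → ¬ Conn es a y → ¬ Conn es x y → ¬ Conn ((a , b) ∷ es) x y
      avoid ¬ax ¬ay ¬xy q with conn-∷ q
      ... | inj₁ r              = ¬xy r
      ... | inj₂ (inj₁ (r , s)) = ¬ax (conn-sym r)
      ... | inj₂ (inj₂ (r , s)) = ¬ay s
      separate : ∀ {R} → All (λ x → ¬ Conn es a x) R → Separated es R → Separated ((a , b) ∷ es) R
      separate []       []       = []
      separate (p ∷ ps) (d ∷ ds) = All.zipWith (λ (q , r) → avoid p q r) (ps , d) ∷ separate ps ds

    separated-≤-ω : ∀ {es} → (∀ {x y} → x ~ y → Among es x y) → ∀ {R} → Separated es R → length R ℕ.≤ ω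
    separated-≤-ω {es} all-edges {R} sep = pigeonhole (λ x y → Star _~_ y x) R components
      (AllPairs.map (λ ¬c y p q → ¬c (conn-sym (all p) ◅◅ all q)) sep)
      (All.tabulate λ {x} _ → deduplicate-covers _ ε _◅◅_ (allFin n) (∈-allFin x))
      where
      all : ∀ {x y} → Star _~_ x y → Conn es x y
      all = Star.map (λ e → e , all-edges e)

    nontree-bound : ∀ es → (∀ {x y} → x ~ y → Among es x y) → n ℕ.+ length (nontree es) ℕ.≤ length es ℕ.+ ω
    nontree-bound es all-edges with separated-list es
    ... | R , sep , le = ℕ.≤-trans le (ℕ.+-monoʳ-≤ (length es) (separated-≤-ω all-edges sep))

    -- The edge of the cycle at which the list es closes it is not a tree edge.
    cycle-nontree : ∀ es {c} → IsCycle c → (∀ {x y} → (x , y) ∈ orientedEdges c → Among es x y) →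
      ∃[ e ] e ∈ nontree es × e ∈ orientedEdges c
    cycle-nontree [] {[]} (() , _) sub
    cycle-nontree [] {v ∷ vs} cyc sub with step-from (v ∷ vs) (here refl)
    ... | y , m with sub (∈-++⁺ˡ m)
    ...   | inj₁ ()
    ...   | inj₂ ()
    cycle-nontree ((a , b) ∷ es) {c} cyc sub with (a , b) ∈? orientedEdges c
    ... | yes m = (a , b) , subst ((a , b) ∈_) (sym (nontree-closing es (conn-sym (Star.map keep (cycle-arc cyc m))))) (here refl) , m
      where
      keep : ∀ {x y} → Avoiding a b (λ x y → (x , y) ∈ orientedEdges c) x y → Graph._~_ (spanned es) x y
      keep (p , q , r) with sub p
      ... | inj₁ (here eq)  = contradiction eq q
      ... | inj₁ (there s)  = orientedEdges-adj cyc p , inj₁ s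
      ... | inj₂ (here eq)  = contradiction eq r
      ... | inj₂ (there s)  = orientedEdges-adj cyc p , inj₂ s
    ... | no ∉c with cycle-nontree es cyc sub′
      where
      sub′ : ∀ {x y} → (x , y) ∈ orientedEdges c → Among es x y
      sub′ p with sub p
      ... | inj₁ (here refl) = contradiction p ∉c
      ... | inj₁ (there s)   = inj₁ s
      ... | inj₂ (here refl) = contradiction (orientedEdges-swap c p) ∉c
      ... | inj₂ (there s)   = inj₂ s
    ...   | e , m , p = e , nontree-∷ (a , b) es m , p

    edges : List Edge
    edges = filter (λ (u , v) → (u Fin.<? v) ×-dec (u ~? v)) (cartesianProduct (allFin n) (allFin n))

    -- The normal form of an undirected edge, following the convention `u < v` of `∣E∣`.
    ordered : Edge → Edge
    ordered (a , b) with a Fin.<? b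
    ... | yes _ = (a , b)
    ... | no _  = (b , a)

    ordered-cases : ∀ a b → ordered (a , b) ≡ (a , b) ⊎ ordered (a , b) ≡ (b , a)
    ordered-cases a b with a Fin.<? b
    ... | yes _ = inj₁ refl
    ... | no _  = inj₂ refl

    ordered-≡ : ∀ x y a b → ordered (x , y) ≡ ordered (a , b) → (x , y) ≡ (a , b) ⊎ (y , x) ≡ (a , b)
    ordered-≡ x y a b eq with ordered (x , y) | ordered-cases x y | ordered (a , b) | ordered-cases a b
    ordered-≡ x y a b refl | _ | inj₁ refl | _ | inj₁ refl = inj₁ refl
    ordered-≡ x y a b refl | _ | inj₁ refl | _ | inj₂ refl = inj₂ refl
    ordered-≡ x y a b refl | _ | inj₂ refl | _ | inj₁ refl = inj₂ refl
    ordered-≡ x y a b refl | _ | inj₂ refl | _ | inj₂ refl = inj₁ refl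

    ordered-∈ : ∀ {x y} → x ~ y → ordered (x , y) ∈ edges
    ordered-∈ {x} {y} e with x Fin.<? y
    ... | yes x<y = ∈-filter⁺ _ (∈-cartesianProduct⁺ (∈-allFin x) (∈-allFin y)) (x<y , e)
    ... | no x≮y with Fin.<-cmp x y
    ...   | tri< x<y _ _  = contradiction x<y x≮y
    ...   | tri≈ _ refl _ = contradiction e (irrefl refl)
    ...   | tri> _ _ y<x  = ∈-filter⁺ _ (∈-cartesianProduct⁺ (∈-allFin y) (∈-allFin x)) (y<x , sym-~ e)

    -- Edges placed in front are judged last by `nontree`, when all of `rest` is already present; in
    -- this way several prescribed edges can be made non-tree edges at once.
    module Prioritised (es₁ : List Edge) (es₁-edges : All (λ (x , y) → x ~ y) es₁)
                       (es₁-distinct : Unique (map ordered es₁)) where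

      rest : List Edge
      rest = filter (λ e → ¬? (e ∈? map ordered es₁)) edges

      length-≤ : length (es₁ ++ rest) ℕ.≤ ∣E∣
      length-≤ = subst (ℕ._≤ ∣E∣)
        (≡.trans (length-++ (map ordered es₁))
          (≡.trans (cong (ℕ._+ length rest) (length-map ordered es₁)) (sym (length-++ es₁))))
        (Unique-⊆-length (Unique.++⁺ es₁-distinct
            (Unique.filter⁺ _ (Unique.filter⁺ _ (Unique.cartesianProduct⁺ (Unique.allFin⁺ n) (Unique.allFin⁺ n))))
            (λ (p , q) → proj₂ (∈-filter⁻ (λ e → ¬? (e ∈? map ordered es₁)) {xs = edges} q) p))
          ([ inside , proj₁ ∘ ∈-filter⁻ (λ e → ¬? (e ∈? map ordered es₁)) {xs = edges} ]′ ∘ ∈-++⁻ (map ordered es₁)))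
        where
        inside : ∀ {e} → e ∈ map ordered es₁ → e ∈ edges
        inside m with ∈-map⁻ ordered m
        ... | (x , y) , p , refl = ordered-∈ (All.lookup es₁-edges p)

      in-rest : ∀ {x y} → x ~ y → ordered (x , y) ∉ map ordered es₁ → Among rest x y
      in-rest {x} {y} e ∉ with ∈-filter⁺ (λ e → ¬? (e ∈? map ordered es₁)) (ordered-∈ e) ∉
      ... | m with ordered (x , y) | ordered-cases x y
      ...   | _ | inj₁ refl = inj₁ m
      ...   | _ | inj₂ refl = inj₂ m

      all-edges : ∀ {x y} → x ~ y → Among (es₁ ++ rest) x y
      all-edges {x} {y} e with ordered (x , y) ∈? map ordered es₁
      ... | no ∉  = Sum.map (∈-++⁺ʳ es₁) (∈-++⁺ʳ es₁) (in-rest e ∉)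
      ... | yes m with ∈-map⁻ ordered m
      ...   | (a , b) , p , eq with ordered-≡ x y a b eq
      ...     | inj₁ refl = inj₁ (∈-++⁺ˡ p)
      ...     | inj₂ refl = inj₂ (∈-++⁺ˡ p)

      bound : n ℕ.+ length (nontree (es₁ ++ rest)) ℕ.≤ ∣E∣ ℕ.+ ω
      bound = ℕ.≤-trans (nontree-bound (es₁ ++ rest) all-edges) (ℕ.+-monoˡ-≤ ω length-≤)

    outside : List (Fin n) → List (Fin n)
    outside X = filter (λ v → ¬? (DecMembership._∈?_ Fin._≟_ v X)) (allFin n)

    ∈-outside⁺ : ∀ {X v} → v ∉ X → v ∈ outside X
    ∈-outside⁺ {X} = ∈-filter⁺ (λ v → ¬? (DecMembership._∈?_ Fin._≟_ v X)) (∈-allFin _)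

    ∈-outside⁻ : ∀ {X v} → v ∈ outside X → v ∉ X
    ∈-outside⁻ {X} = proj₂ ∘ ∈-filter⁻ (λ v → ¬? (DecMembership._∈?_ Fin._≟_ v X)) {xs = allFin n}

    -- Two cycles parting at w have distinct non-tree edges at w, so that one
    -- vertex accounts for both.
    parting-cycles : ∀ {c d w a b} → IsCycle c → IsCycle d →
      (w , a) ∈ orientedEdges c → (w , a) ∉ orientedEdges d → (w , b) ∈ orientedEdges d →
      ∃[ X ] Acyclic (outside X) × n ℕ.+ suc (length X) ℕ.≤ ∣E∣ ℕ.+ ω
    parting-cycles {c} {d} {w} {a} {b} cycC cycD e∈c e∉d f∈d = w ∷ map proj₁ (nontree rest)
        , (λ c′ cyc′ out → hit c′ cyc′ out)
        , subst (λ l → n ℕ.+ suc (suc l) ℕ.≤ ∣E∣ ℕ.+ ω) (sym (length-map proj₁ (nontree rest)))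
            (subst (λ l → n ℕ.+ length l ℕ.≤ ∣E∣ ℕ.+ ω) nontree-eq bound)
      where
      w~a = orientedEdges-adj cycC e∈c
      w~b = orientedEdges-adj cycD f∈d
      distinct : ordered (w , a) ≢ ordered (w , b)
      distinct eq with ordered-≡ w a w b eq
      ... | inj₁ refl = e∉d f∈d
      ... | inj₂ refl = irrefl refl w~a
      open Prioritised ((w , a) ∷ (w , b) ∷ []) (w~a ∷ w~b ∷ []) ((distinct ∷ []) ∷ [] ∷ [])
      keep-d : ∀ {x y} → Avoiding w b (λ x y → (x , y) ∈ orientedEdges d) x y → Graph._~_ (spanned rest) x y
      keep-d {x} {y} (p , q , r) = orientedEdges-adj cycD p , in-rest (orientedEdges-adj cycD p) ∉
        where
        ∉ : ordered (x , y) ∉ ordered (w , a) ∷ ordered (w , b) ∷ []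
        ∉ (here eq) with ordered-≡ x y w a eq
        ... | inj₁ refl = e∉d p
        ... | inj₂ refl = e∉d (orientedEdges-swap d p)
        ∉ (there (here eq)) with ordered-≡ x y w b eq
        ... | inj₁ eq′ = q eq′
        ... | inj₂ eq′ = r eq′
      keep-c : ∀ {x y} → Avoiding w a (λ x y → (x , y) ∈ orientedEdges c) x y → Graph._~_ (spanned ((w , b) ∷ rest)) x y
      keep-c {x} {y} (p , q , r) with all-edges (orientedEdges-adj cycC p)
      ... | inj₁ (here eq) = contradiction eq q
      ... | inj₁ (there m) = orientedEdges-adj cycC p , inj₁ m
      ... | inj₂ (here eq) = contradiction eq r
      ... | inj₂ (there m) = orientedEdges-adj cycC p , inj₂ m
      -- The order matters: the arc of `d` uses neither chosen edge, whereas the arc of `c` may use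
      -- (w , b), so (w , a) has to be judged after it.
      nontree-eq : nontree ((w , a) ∷ (w , b) ∷ rest) ≡ (w , a) ∷ (w , b) ∷ nontree rest
      nontree-eq = ≡.trans
        (nontree-closing ((w , b) ∷ rest) (conn-sym (Star.map keep-c (cycle-arc cycC e∈c))))
        (cong ((w , a) ∷_) (nontree-closing rest (conn-sym (Star.map keep-d (cycle-arc cycD f∈d)))))
      hit : ∀ c′ → IsCycle c′ → ¬ All (_∈ outside (w ∷ map proj₁ (nontree rest))) c′
      hit c′ cyc′ out with cycle-nontree ((w , a) ∷ (w , b) ∷ rest) cyc′ (all-edges ∘ orientedEdges-adj cyc′)
      ... | e , m , p = ∈-outside⁻ (All.lookup out (orientedEdges-source c′ p)) (in-X (subst (e ∈_) nontree-eq m))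
        where
        in-X : ∀ {e} → e ∈ (w , a) ∷ (w , b) ∷ nontree rest → proj₁ e ∈ w ∷ map proj₁ (nontree rest)
        in-X (here refl)         = here refl
        in-X (there (here refl)) = here refl
        in-X (there (there m))   = there (∈-map⁺ proj₁ m)

    intersecting-cycles : ∀ {c d v} → IsCycle c → IsCycle d → ¬ SameCycle c d → v ∈ c → v ∈ d →
      ∃[ X ] Acyclic (outside X) × n ℕ.+ suc (length X) ℕ.≤ ∣E∣ ℕ.+ ω
    intersecting-cycles {c} {d} cycC cycD diff v∈c v∈d with diverge c d v∈c v∈d | diverge d c v∈d v∈c
    ... | inj₁ (w , a , b , p , q , r) | _ = parting-cycles cycC cycD p q r
    ... | inj₂ _ | inj₁ (w , a , b , p , q , r) = parting-cycles cycD cycC p q r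
    ... | inj₂ s | inj₂ t = contradiction ((λ {e} → s {e}) , (λ {e} → t {e})) diff

    -- One edge is chosen on each cycle. By disjointness the rest of a cycle contains no other
    -- chosen edge, so it closes its own chosen edge within `rest`.
    disjoint-cycles-bound : ∀ {m} (O : Fin m → List (Fin n)) → (∀ k → IsCycle (O k)) →
      (∀ {k l v} → v ∈ O k → v ∈ O l → k ≡ l) → n ℕ.+ m ℕ.≤ ∣E∣ ℕ.+ ω
    disjoint-cycles-bound {m} O cyc disjoint = ℕ.≤-trans (ℕ.+-monoʳ-≤ n many) bound
      where
      edge : ∀ k → ∃[ e ] e ∈ orientedEdges (O k)
      edge k with O k | cyc k
      ... | v ∷ w ∷ vs | _ = (v , w) , here refl
      ... | []    | () , _
      ... | _ ∷ [] | s≤s () , _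
      e : Fin m → Edge
      e k = proj₁ (edge k)
      e∈ : ∀ k → (proj₁ (e k) , proj₂ (e k)) ∈ orientedEdges (O k)
      e∈ k = proj₂ (edge k)
      ordered-e : ∀ {k x y} l → (x , y) ∈ orientedEdges (O k) → ordered (x , y) ≡ ordered (e l) → k ≡ l
      ordered-e {k} {x} {y} l p eq with ordered-≡ x y (proj₁ (e l)) (proj₂ (e l)) eq
      ... | inj₁ refl = disjoint (orientedEdges-source (O k) p) (orientedEdges-source (O l) (e∈ l))
      ... | inj₂ refl = disjoint (orientedEdges-source (O k) p) (orientedEdges-target (O l) (e∈ l))
      open Prioritised (tabulate e) (All.tabulate⁺ (λ k → orientedEdges-adj (cyc k) (e∈ k)))
        (subst Unique (sym (map-tabulate e ordered)) (Unique.tabulate⁺ (λ {k} {l} eq → ordered-e l (e∈ k) eq)))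
      closing : ∀ k → Conn rest (proj₁ (e k)) (proj₂ (e k))
      closing k = conn-sym (Star.map keep (cycle-arc (cyc k) (e∈ k)))
        where
        keep : ∀ {x y} → Avoiding (proj₁ (e k)) (proj₂ (e k)) (λ x y → (x , y) ∈ orientedEdges (O k)) x y →
          Graph._~_ (spanned rest) x y
        keep {x} {y} (p , q , r) = orientedEdges-adj (cyc k) p , in-rest (orientedEdges-adj (cyc k) p) ∉
          where
          ∉ : ordered (x , y) ∉ map ordered (tabulate e)
          ∉ m with ∈-map⁻ ordered m
          ... | _ , m′ , eq with ∈-tabulate⁻ m′
          ...   | l , refl with ordered-e l p eq
          ...     | refl with ordered-≡ x y (proj₁ (e k)) (proj₂ (e k)) eq
          ...       | inj₁ eq′ = q eq′
          ...       | inj₂ eq′ = r eq′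
      many : m ℕ.≤ length (nontree (tabulate e ++ rest))
      many = go e closing
        where
        go : ∀ {m} (e : Fin m → Edge) → (∀ k → Conn rest (proj₁ (e k)) (proj₂ (e k))) →
          m ℕ.≤ length (nontree (tabulate e ++ rest))
        go {zero}  e cl = z≤n
        go {suc m} e cl = subst (λ l → suc m ℕ.≤ length l)
          (sym (nontree-closing (tabulate (e ∘ Fin.suc) ++ rest)
            (conn-mono (∈-++⁺ʳ (tabulate (e ∘ Fin.suc))) (cl Fin.zero))))
          (s≤s (go (e ∘ Fin.suc) (cl ∘ Fin.suc)))

-- The field of complex numbers.

module ComplexTheory where

  open SpanTheory
  open import Algebra.Bundles using (CommutativeRing)
  import Algebra.Properties.Ring as RingProperties
  import Algebra.Solver.Ring.NaturalCoefficients.Default as SemiringSolver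
  open import Algebra.Structures using (IsCommutativeRing)
  open import Relation.Binary.Structures using (IsDecTotalOrder)

  module ComplexField (ℝ : CompleteOrderedField) where
    module ℂ = Complex ℝ
    open ℂ using (ℂ; _+i_)

    private
      open CompleteOrderedField ℝ using (_≤_; isDecTotalOrder; 0≉1; inverse; +-monoˡ-≤; *-nonNeg)
      realRing : CommutativeRing 0ℓ 0ℓ
      realRing = record { isCommutativeRing = CompleteOrderedField.isCommutativeRing ℝ }
      open CommutativeRing realRing hiding (zero)
      open RingProperties ring using (-1*x≈-x; -‿involutive; -‿distribˡ-*; -‿distribʳ-*)
      open SemiringSolver commutativeSemiring using (solve; _:+_; _:*_; _:=_; con)
      open IsDecTotalOrder isDecTotalOrder using (_≟_; total; antisym; ≤-respˡ-≈; ≤-respʳ-≈) renaming (trans to ≤-trans)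

      -- Writing negation as multiplication by a constant turns the ring identities below into
      -- semiring identities with one more variable.
      neg : ∀ x → - x ≈ - 1# * x
      neg x = sym (-1*x≈-x x)

      *-mulRe : ∀ {a b c d} → a * c + - (b * d) ≈ a * c + - 1# * (b * d)
      *-mulRe = +-congˡ (neg _)

      assocRe : ∀ a b c d e f →
        (a * c + - (b * d)) * e + - ((a * d + b * c) * f) ≈ a * (c * e + - (d * f)) + - (b * (c * f + d * e))
      assocRe a b c d e f = trans (+-cong (*-congʳ *-mulRe) (neg _)) (trans
        (solve 7 (λ a b c d e f n → (a :* c :+ n :* (b :* d)) :* e :+ n :* ((a :* d :+ b :* c) :* f)
           := a :* (c :* e :+ n :* (d :* f)) :+ n :* (b :* (c :* f :+ d :* e))) refl a b c d e f (- 1#))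
        (sym (+-cong (*-congˡ *-mulRe) (neg _))))

      assocIm : ∀ a b c d e f →
        (a * c + - (b * d)) * f + (a * d + b * c) * e ≈ a * (c * f + d * e) + b * (c * e + - (d * f))
      assocIm a b c d e f = trans (+-congʳ (*-congʳ *-mulRe)) (trans
        (solve 7 (λ a b c d e f n → (a :* c :+ n :* (b :* d)) :* f :+ (a :* d :+ b :* c) :* e
           := a :* (c :* f :+ d :* e) :+ b :* (c :* e :+ n :* (d :* f))) refl a b c d e f (- 1#))
        (sym (+-congˡ (*-congˡ *-mulRe))))

      x+-0≈x : ∀ {x y} → y ≈ 0# → x + - y ≈ x
      x+-0≈x {x} {y} p = trans (+-congˡ (trans (neg y) (trans (*-congˡ p) (zeroʳ _)))) (+-identityʳ x)

      0≤x² : ∀ x → 0# ≤ x * x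
      0≤x² x with total 0# x
      ... | inj₁ 0≤x = *-nonNeg 0≤x 0≤x
      ... | inj₂ x≤0 = ≤-respʳ-≈ square (*-nonNeg 0≤-x 0≤-x)
        where
        0≤-x : 0# ≤ - x
        0≤-x = ≤-respˡ-≈ (-‿inverseʳ x) (≤-respʳ-≈ (+-identityˡ (- x)) (+-monoˡ-≤ (- x) x≤0))
        square : - x * - x ≈ x * x
        square = trans (sym (-‿distribˡ-* x (- x)))
          (trans (-‿cong (sym (-‿distribʳ-* x x))) (-‿involutive (x * x)))

      x²≈0⇒x≈0 : ∀ x → x * x ≈ 0# → x ≈ 0#
      x²≈0⇒x≈0 x p with x ≟ 0#
      ... | yes q = q
      ... | no x≉0 with inverse x x≉0
      ...   | y , xy≈1 = trans (sym (*-identityʳ x)) (trans (*-congˡ (sym xy≈1))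
                (trans (sym (*-assoc x x y)) (trans (*-congʳ p) (zeroˡ y))))

      x²+y²≈0⇒x≈0 : ∀ x y → x * x + y * y ≈ 0# → x ≈ 0#
      x²+y²≈0⇒x≈0 x y p = x²≈0⇒x≈0 x (antisym
        (≤-respʳ-≈ p (≤-respʳ-≈ (+-comm (y * y) (x * x)) (≤-respˡ-≈ (+-identityˡ (x * x)) (+-monoˡ-≤ (x * x) (0≤x² y)))))
        (0≤x² x))

      isCommutativeRing-ℂ : IsCommutativeRing ℂ._≈_ ℂ._+_ ℂ._*_ ℂ.-_ ℂ.0# ℂ.1#
      isCommutativeRing-ℂ = record
        { isRing = record
          { +-isAbelianGroup = record
            { isGroup = record
              { isMonoid = record
                { isSemigroup = record
                  { isMagma = record
                    { isEquivalence = record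
                      { refl = refl , refl
                      ; sym = λ (p , q) → sym p , sym q
                      ; trans = λ (p , q) (p′ , q′) → trans p p′ , trans q q′
                      }
                    ; ∙-cong = λ (p , q) (p′ , q′) → +-cong p p′ , +-cong q q′
                    }
                  ; assoc = λ x y z → +-assoc _ _ _ , +-assoc _ _ _
                  }
                ; identity = (λ _ → +-identityˡ _ , +-identityˡ _) , (λ _ → +-identityʳ _ , +-identityʳ _)
                }
              ; inverse = (λ _ → -‿inverseˡ _ , -‿inverseˡ _) , (λ _ → -‿inverseʳ _ , -‿inverseʳ _)
              ; ⁻¹-cong = λ (p , q) → -‿cong p , -‿cong q
              }
            ; comm = λ _ _ → +-comm _ _ , +-comm _ _
            }
          ; *-cong = λ (p , q) (p′ , q′) →
              +-cong (*-cong p p′) (-‿cong (*-cong q q′)) , +-cong (*-cong p q′) (*-cong q p′)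
          ; *-assoc = λ (a +i b) (c +i d) (e +i f) → assocRe a b c d e f , assocIm a b c d e f
          ; *-identity = (λ (a +i b) → *-identityˡ-ℂ a b) , λ (a +i b) →
              trans (x+-0≈x (zeroʳ b)) (*-identityʳ a) , trans (+-cong (zeroʳ a) (*-identityʳ b)) (+-identityˡ b)
          ; distrib = (λ (a +i b) (c +i d) (e +i f) → distribˡ-Re a b c d e f
                        , solve 6 (λ a b c d e f → a :* (d :+ f) :+ b :* (c :+ e)
                            := a :* d :+ b :* c :+ (a :* f :+ b :* e)) refl a b c d e f)
                    , (λ (a +i b) (c +i d) (e +i f) → distribʳ-Re a b c d e f
                        , solve 6 (λ a b c d e f → (c :+ e) :* b :+ (d :+ f) :* a
                            := c :* b :+ d :* a :+ (e :* b :+ f :* a)) refl a b c d e f)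
          }
        ; *-comm = λ (a +i b) (c +i d) → +-cong (*-comm a c) (-‿cong (*-comm b d))
            , trans (+-comm _ _) (+-cong (*-comm b c) (*-comm a d))
        }
        where
        *-identityˡ-ℂ : ∀ a b → (1# * a + - (0# * b) ≈ a) × (1# * b + 0# * a ≈ b)
        *-identityˡ-ℂ a b = trans (x+-0≈x (zeroˡ b)) (*-identityˡ a)
          , trans (+-cong (*-identityˡ b) (zeroˡ a)) (+-identityʳ b)
        distribˡ-Re : ∀ a b c d e f →
          a * (c + e) + - (b * (d + f)) ≈ a * c + - (b * d) + (a * e + - (b * f))
        distribˡ-Re a b c d e f = trans *-mulRe (trans
          (solve 7 (λ a b c d e f n → a :* (c :+ e) :+ n :* (b :* (d :+ f))
             := a :* c :+ n :* (b :* d) :+ (a :* e :+ n :* (b :* f))) refl a b c d e f (- 1#))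
          (sym (+-cong *-mulRe *-mulRe)))
        distribʳ-Re : ∀ a b c d e f →
          (c + e) * a + - ((d + f) * b) ≈ c * a + - (d * b) + (e * a + - (f * b))
        distribʳ-Re a b c d e f = trans *-mulRe (trans
          (solve 7 (λ a b c d e f n → (c :+ e) :* a :+ n :* ((d :+ f) :* b)
             := c :* a :+ n :* (d :* b) :+ (e :* a :+ n :* (f :* b))) refl a b c d e f (- 1#))
          (sym (+-cong *-mulRe *-mulRe)))

      -- The imaginary part of z times its conjugate scaled by `r`; `norm` is the real part.
      cross : ∀ x y r → x * (- y * r) + y * (x * r) ≈ 0#
      cross x y r = trans (+-congʳ (*-congˡ (*-congʳ (neg y)))) (trans
        (solve 4 (λ x y r n → x :* (n :* y :* r) :+ y :* (x :* r) := (con 1 :+ n) :* (x :* y :* r)) refl x y r (- 1#))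
        (trans (*-congʳ (-‿inverseʳ 1#)) (zeroˡ _)))

      norm : ∀ x y r → x * (x * r) + - (y * (- y * r)) ≈ (x * x + y * y) * r
      norm x y r = trans (+-congˡ (trans (-‿cong (trans (*-congˡ (sym (-‿distribˡ-* y r))) (sym (-‿distribʳ-* y (y * r)))))
        (-‿involutive _)))
        (solve 3 (λ x y r → x :* (x :* r) :+ y :* (y :* r) := (x :* x :+ y :* y) :* r) refl x y r)

    complexField : Field
    complexField = record
      { commutativeRing = record { isCommutativeRing = isCommutativeRing-ℂ }
      ; _≈?_ = λ (a +i b) (c +i d) → (a ≟ c) ×-dec (b ≟ d)
      ; inverse = inverse-ℂ
      ; 1≉0 = λ (p , _) → 0≉1 (sym p)
      ; 2≉0 = λ (p , _) → 0≉1 (antisym 0≤1 (≤-respʳ-≈ p (≤-respˡ-≈ (+-identityˡ 1#) (+-monoˡ-≤ 1# 0≤1))))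
      }
      where
      0≤1 : 0# ≤ 1#
      0≤1 = ≤-respʳ-≈ (*-identityˡ 1#) (0≤x² 1#)
      inverse-ℂ : ∀ z → ¬ (z ℂ.≈ ℂ.0#) → ∃[ w ] z ℂ.* w ℂ.≈ ℂ.1#
      inverse-ℂ (a +i b) z≉0 with a * a + b * b ≟ 0#
      ... | yes p = contradiction
            (x²+y²≈0⇒x≈0 a b p , x²+y²≈0⇒x≈0 b a (trans (+-comm _ _) p)) z≉0
      ... | no p with inverse (a * a + b * b) p
      -- The conjugate divided by the squared modulus, which is nonzero since a sum of two squares
      -- vanishes only with both terms.
      ...   | r , q = (a * r +i - b * r) , trans (norm a b r) q , cross a b r

    unit-modulus : ∀ z → ℂ.IsModulus z 1# → z ℂ.* ℂ.conj z ℂ.≈ ℂ.1#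
    unit-modulus (a +i b) (_ , p) =
        trans (+-congˡ (trans (-‿cong (sym (-‿distribʳ-* b b))) (-‿involutive (b * b))))
          (trans (sym p) (*-identityˡ 1#))
      , trans (+-cong (*-congˡ (sym (*-identityʳ (- b)))) (*-congˡ (sym (*-identityʳ a)))) (cross a b 1#)

-- Consequences of extremality for sets meeting all cycles.

module ExtremalTheory where

  open SpanTheory using (Field)
  open RankTheory using (module MatrixRank)
  open CycleTheory
  open PeelingTheory
  open CycleRankTheory
  open import Data.List.Base using ([_]; upTo)
  open import Data.List.Membership.Propositional.Properties using (∈-tabulate⁺; ∈-deduplicate⁻; ∈-concatMap⁺; ∈-upTo⁺; ∈-cartesianProductWith⁺)
  open import Data.Nat.Solver using (module +-*-Solver)

  module _ where
    open +-*-Solver using (solve; _:+_; _:=_)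

    +-interchange-double : ∀ x p → (x ℕ.+ p) ℕ.+ (x ℕ.+ p) ≡ (x ℕ.+ x) ℕ.+ (p ℕ.+ p)
    +-interchange-double = solve 2 (λ x p → (x :+ p) :+ (x :+ p) := (x :+ x) :+ (p :+ p)) ≡.refl

    regroup : ∀ x r n → ((x ℕ.+ x) ℕ.+ r) ℕ.+ (n ℕ.+ n) ≡ r ℕ.+ ((n ℕ.+ x) ℕ.+ (n ℕ.+ x))
    regroup = solve 3 (λ x r n → ((x :+ x) :+ r) :+ (n :+ n) := r :+ ((n :+ x) :+ (n :+ x))) ≡.refl

  halve : ∀ {a b} → a ℕ.+ a ℕ.≤ b ℕ.+ b → a ℕ.≤ b
  halve le = ℕ.≮⇒≥ λ lt → ℕ.<⇒≱ (ℕ.+-mono-< lt lt) le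

  lookup-unrelated : ∀ {A : Set} {R : A → A → Set} (P : A → A → Set) → (∀ {x y} → P x y → ¬ R x y) →
    (∀ {x y} → P x y → P y x) → ∀ xs → AllPairs R xs → ∀ k l → P (lookup xs k) (lookup xs l) → k ≡ l
  lookup-unrelated P c s (x ∷ xs) (r ∷ rs) zero    zero    p = ≡.refl
  lookup-unrelated P c s (x ∷ xs) (r ∷ rs) zero    (suc l) p = contradiction (All.lookup r (∈-lookup l)) (c p)
  lookup-unrelated P c s (x ∷ xs) (r ∷ rs) (suc k) zero    p = contradiction (All.lookup r (∈-lookup k)) (c (s p))
  lookup-unrelated P c s (x ∷ xs) (r ∷ rs) (suc k) (suc l) p = cong suc (lookup-unrelated P c s xs rs k l p)

  module CycleList {n : ℕ} (G : Graph (Fin n)) where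
    open CycleRank G public

    sameCycle-refl : ∀ {c} → SameCycle c c
    sameCycle-refl = id , id

    sameCycle-sym : ∀ c d → SameCycle c d → SameCycle d c
    sameCycle-sym c d (s , t) = t , s

    sameCycle-trans : ∀ {c d e} → SameCycle c d → SameCycle d e → SameCycle c e
    sameCycle-trans (s , t) (s′ , t′) = s′ ∘ s , t ∘ t′

    sameCycle-∈ : ∀ c d {v} → SameCycle c d → v ∈ c → v ∈ d
    sameCycle-∈ c d (s , _) v∈ with step-from c v∈
    ... | _ , m = orientedEdges-source d (s (∈-++⁺ˡ m))

    O-cycle : ∀ k → IsCycle (O k)
    O-cycle k = proj₂ (∈-filter⁻ isCycle? {xs = concatMap sequences (upTo (suc n))}
      (∈-deduplicate⁻ sameCycle? _ (∈-lookup k)))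

    ∈-sequences : ∀ c → c ∈ sequences (length c)
    ∈-sequences []      = here ≡.refl
    ∈-sequences (x ∷ c) = ∈-cartesianProductWith⁺ _∷_ (∈-allFin x) (∈-sequences c)

    O-complete : ∀ {c} → IsCycle c → ∃[ k ] SameCycle (O k) c
    O-complete {c} cyc = at (deduplicate-covers sameCycle? (λ {c} → sameCycle-refl {c})
        (λ {c} {d} {e} → sameCycle-trans {c} {d} {e}) _
        (∈-filter⁺ isCycle? (∈-concatMap⁺ sequences (lose (∈-upTo⁺ (s≤s length≤n)) (∈-sequences c))) cyc))
      where
      length≤n : length c ℕ.≤ n
      length≤n = ℕ.≤-trans (Unique-⊆-length (proj₁ (proj₂ cyc)) (λ _ → ∈-allFin _)) (ℕ.≤-reflexive (length-tabulate id))
      at : ∀ {cs} → Any (λ d → SameCycle d c) cs → ∃[ k ] SameCycle (lookup cs k) c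
      at (here p)  = zero , p
      at (there m) with at m
      ... | k , p = suc k , p

    module _ (disjoint : PairwiseDisjointCycles) where

      O-disjoint : ∀ {k l v} → v ∈ O k → v ∈ O l → k ≡ l
      O-disjoint {k} {l} v∈k v∈l with sameCycle? (O k) (O l)
      ... | yes same = lookup-unrelated SameCycle (λ s ¬s → ¬s s) (λ {c} {d} → sameCycle-sym c d) 𝒞
              (deduplicate-unrelated sameCycle? _) k l same
      ... | no diff = contradiction v∈l (disjoint (O k) (O l) (O-cycle k) (O-cycle l) diff _ v∈k)

  module WeightedGraph (F : Field) {n : ℕ} (G : Graph (Fin n)) where
    open MatrixRank F
    open CycleList G
    open DecMembership (Fin._≟_ {n}) using (_∈?_)

    -- The common ground of the two matrices. For the gain matrix `inv` says that a gain times its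
    -- conjugate is 1; in this form no conjugation is left and the field can stay abstract.
    record Weighted (M : Fin n → Fin n → Carrier) : Set where
      field
        off  : ∀ {x y} → ¬ x ~ y → M x y ≈ 0#
        inv  : ∀ {x y} → x ~ y → M x y * M y x ≈ 1#

      nonzero : ∀ {x y} → x ~ y → ¬ (M x y ≈ 0#)
      nonzero e p = 1≉0 (trans (sym (inv e)) (trans (*-congʳ p) (zeroˡ _)))

      triangular : ∀ {es} → Tri es → Triangular {M = M} es
      triangular []            = []
      triangular ((p , q) ∷ t) = (nonzero p , All.map off q) ∷ triangular t

      peel-indep : ∀ {W} (P : Peel W) → ¬ Dep (map (col M) (ends (Peel.pairs P)))
      peel-indep P = triangular⇒¬dep (triangular (Peel.triangular P))

      peel-rank : ∀ {r} → HasRank M r → ∀ {W} (P : Peel W) → length (Peel.pairs P) ℕ.+ length (Peel.pairs P) ℕ.≤ r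
      peel-rank R P = subst (ℕ._≤ _) (≡.trans (length-map proj₂ (tri pairs)) (length-tri pairs))
        (rank-≥ R (ends pairs) (peel-indep P))
        where open Peel P

      cover-rank : ∀ {r} → HasRank M r → ∀ Z → (∀ {x y} → x ~ y → x ∈ Z ⊎ y ∈ Z) → r ℕ.≤ length Z ℕ.+ length Z
      cover-rank R Z covers = subst (_ ℕ.≤_)
        (≡.trans (length-++ (map e Z)) (≡.cong₂ ℕ._+_ (length-map _ Z) (length-map _ Z)))
        (rank-≤ R _ (cover-spans Fin._≟_ M Z λ i j i∉ j∉ → off ([ i∉ , j∉ ]′ ∘ covers)))
        where e = δ Fin._≟_

    open Weighted public

    -- The equation `extremal` is r(Φ) = r(G) + 2θ(G) with 2n added on both sides, which keeps it
    -- among the natural numbers.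
    record Extremal : Set₁ where
      field
        {A Φ}    : Fin n → Fin n → Carrier
        wA       : Weighted A
        A-sym    : ∀ i j → A i j ≈ A j i
        A-one    : ∀ {i j} → i ~ j → A i j ≈ 1#
        wΦ       : Weighted Φ
        {rG rΦ}  : ℕ
        RA       : HasRank A rG
        RΦ       : HasRank Φ rΦ
        extremal : rΦ ℕ.+ (n ℕ.+ n) ≡ rG ℕ.+ ((∣E∣ ℕ.+ ω) ℕ.+ (∣E∣ ℕ.+ ω))

  module Transversals (F : Field) {n : ℕ} (G : Graph (Fin n)) (E : WeightedGraph.Extremal F G) where
    open MatrixRank F public
    open CycleList G public
    open WeightedGraph F G public
    open WeightedGraph.Extremal E public
    open DecMembership (Fin._≟_ {n}) using (_∈?_)

    module Feedback (X : List (Fin n)) (acyclic : Acyclic (outside X)) where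
      P : Peel (outside X)
      P = peel (outside X) acyclic
      open Peel P public

      Z : List (Fin n)
      Z = X ++ cover

      Z-covers : ∀ {x y} → x ~ y → x ∈ Z ⊎ y ∈ Z
      Z-covers {x} {y} e with x ∈? X | y ∈? X
      ... | yes x∈ | _      = inj₁ (∈-++⁺ˡ x∈)
      ... | no _   | yes y∈ = inj₂ (∈-++⁺ˡ y∈)
      ... | no x∉  | no y∉  = Sum.map (∈-++⁺ʳ X) (∈-++⁺ʳ X) (covers (∈-outside⁺ x∉) (∈-outside⁺ y∉) e)

      length-Z : length Z ≡ length X ℕ.+ length pairs
      length-Z = ≡.trans (length-++ X) (cong (length X ℕ.+_) (length-map proj₁ pairs))

      upper : rΦ ℕ.≤ (length X ℕ.+ length X) ℕ.+ (length pairs ℕ.+ length pairs)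
      upper = subst (rΦ ℕ.≤_)
        (≡.trans (≡.cong₂ ℕ._+_ length-Z length-Z)
          (+-interchange-double (length X) (length pairs)))
        (cover-rank wΦ RΦ Z Z-covers)

      lower : length pairs ℕ.+ length pairs ℕ.≤ rG
      lower = peel-rank wA RA P

      bound : ∣E∣ ℕ.+ ω ℕ.≤ n ℕ.+ length X
      bound = halve (ℕ.+-cancelˡ-≤ rG _ _ (ℕ.≤-trans (ℕ.≤-reflexive (≡.sym extremal))
        (ℕ.≤-trans (ℕ.+-monoˡ-≤ (n ℕ.+ n) (ℕ.≤-trans upper (ℕ.+-monoʳ-≤ (length X ℕ.+ length X) lower)))
          (ℕ.≤-reflexive (regroup (length X) rG n)))))

    pairwiseDisjoint : PairwiseDisjointCycles
    pairwiseDisjoint c d cycC cycD diff v v∈c v∈d with intersecting-cycles cycC cycD diff v∈c v∈d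
    ... | X , acyclic , le = ℕ.<⇒≱ (ℕ.n<1+n (length X))
      (ℕ.+-cancelˡ-≤ n _ _ (ℕ.≤-trans le (Feedback.bound X acyclic)))

    #𝒞 : ℕ
    #𝒞 = length 𝒞

    same-cycle-index : ∀ {k l v} → v ∈ O k → v ∈ O l → k ≡ l
    same-cycle-index = O-disjoint pairwiseDisjoint

    record Transversal : Set where
      field
        pick   : C → Fin n
        pick-∈ : ∀ k → pick k ∈ O k

      X : List (Fin n)
      X = tabulate pick

      X-acyclic : Acyclic (outside X)
      X-acyclic c cyc out with O-complete cyc
      ... | k , same = ∈-outside⁻ (All.lookup out (sameCycle-∈ (O k) c same (pick-∈ k))) (∈-tabulate⁺ k)

      open Feedback X X-acyclic public

      length-X : length X ≡ #𝒞
      length-X = length-tabulate pick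

    -- That is, θ(G) is the number of cycles: a transversal meets all of them, and disjoint cycles
    -- contribute different non-tree edges.
    excess : ∣E∣ ℕ.+ ω ≡ n ℕ.+ #𝒞
    excess = ℕ.≤-antisym (subst (λ m → ∣E∣ ℕ.+ ω ℕ.≤ n ℕ.+ m) (Transversal.length-X heads) (Transversal.bound heads))
      (disjoint-cycles-bound O O-cycle same-cycle-index)
      where
      head-of : ∀ c → IsCycle c → ∃[ v ] v ∈ c
      head-of (v ∷ _) _ = v , here ≡.refl
      heads : Transversal
      heads = record { pick = λ k → proj₁ (head-of (O k) (O-cycle k)) ; pick-∈ = λ k → proj₂ (head-of (O k) (O-cycle k)) }

    rank-difference : rΦ ≡ rG ℕ.+ (#𝒞 ℕ.+ #𝒞)
    rank-difference = ℕ.+-cancelʳ-≡ (n ℕ.+ n) _ _ (≡.trans extremal (≡.trans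
      (cong (λ e → rG ℕ.+ (e ℕ.+ e)) excess)
      (≡.trans (≡.sym (regroup #𝒞 rG n)) (cong (ℕ._+ (n ℕ.+ n)) (ℕ.+-comm (#𝒞 ℕ.+ #𝒞) rG)))))

    module _ (Y : Transversal) where
      open Transversal Y

      -- With p pairs, r(Φ) ≤ 2|X| + 2p and 2p ≤ r(G), while r(Φ) = r(G) + 2|X| leaves no room for
      -- either to be strict.
      rG≡ : rG ≡ length pairs ℕ.+ length pairs
      rG≡ = ℕ.≤-antisym (ℕ.+-cancelˡ-≤ (#𝒞 ℕ.+ #𝒞) _ _
          (≡.subst₂ ℕ._≤_ (≡.trans rank-difference (ℕ.+-comm rG _)) (cong (λ m → (m ℕ.+ m) ℕ.+ (length pairs ℕ.+ length pairs)) length-X) upper)) lower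

      rΦ≡ : rΦ ≡ length Z ℕ.+ length Z
      rΦ≡ = ≡.trans rank-difference (≡.trans (cong (ℕ._+ (#𝒞 ℕ.+ #𝒞)) rG≡)
        (≡.trans (≡.trans (ℕ.+-comm _ (#𝒞 ℕ.+ #𝒞)) (≡.sym (+-interchange-double #𝒞 (length pairs))))
          (≡.cong₂ ℕ._+_ (≡.sym length-Z′) (≡.sym length-Z′))))
        where
        length-Z′ : length Z ≡ #𝒞 ℕ.+ length pairs
        length-Z′ = ≡.trans length-Z (cong (ℕ._+ length pairs) length-X)

      -- The ends of the peeling of G − X index a column basis, so every column
      -- outside it gives a kernel vector.
      kernel-vector : ∀ k → ∃[ z ] (∀ i → (A ∙ z) i ≈ 0#) × z (pick k) ≈ 1# × (∀ l → l ≢ k → z (pick l) ≈ 0#)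
      kernel-vector k = restrict (span⇒kernel A (large-indep-spans RA (ends pairs) (peel-indep wA P)
          (ℕ.≤-reflexive (≡.trans rG≡ (≡.sym (≡.trans (length-map proj₂ (tri pairs)) (length-tri pairs))))) (pick k))
          (not-end k))
        where
        not-end : ∀ l → pick l ∉ ends pairs
        not-end l m = ∈-outside⁻ (ends⊆ m) (∈-tabulate⁺ {f = pick} l)
        restrict : (∃[ z ] (∀ i → (A ∙ z) i ≈ 0#) × z (pick k) ≈ 1# × (∀ j → j ∉ ends pairs → j ≢ pick k → z j ≈ 0#)) →
          ∃[ z ] (∀ i → (A ∙ z) i ≈ 0#) × z (pick k) ≈ 1# × (∀ l → l ≢ k → z (pick l) ≈ 0#)
        restrict (z , ker , one , supp) = z , ker , one , λ l l≢k → supp (pick l) (not-end l)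
          (λ eq → l≢k (same-cycle-index (pick-∈ l) (subst (_∈ O k) (≡.sym eq) (pick-∈ k))))

-- The graph off the cycles and its attachments.

module OffCycleTheory where

  open SpanTheory using (Field)
  open CycleTheory
  open PeelingTheory
  open CycleRankTheory
  open ExtremalTheory
  open import Data.List.Base using ([_])
  open import Data.List.Properties using (concatMap-++)

  module OffCycles (F : Field) {n : ℕ} (G : Graph (Fin n)) (E : WeightedGraph.Extremal F G) where
    open Transversals F G E public
    open DecMembership (Fin._≟_ {n}) using (_∈?_)

    OnCycle : Fin n → Set
    OnCycle v = ∃[ k ] v ∈ O k

    abstract
      onCycle? : ∀ v → Dec (OnCycle v)
      onCycle? v = Fin.any? (λ k → v ∈? O k)

    W : List (Fin n)
    W = filter (¬? ∘ onCycle?) (allFin n)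

    ∈-W⁺ : ∀ {v} → ¬ OnCycle v → v ∈ W
    ∈-W⁺ = ∈-filter⁺ (¬? ∘ onCycle?) (∈-allFin _)

    ∈-W⁻ : ∀ {v} → v ∈ W → ¬ OnCycle v
    ∈-W⁻ = proj₂ ∘ ∈-filter⁻ (¬? ∘ onCycle?) {xs = allFin n}

    cycle⇒onCycle : ∀ {c v} → IsCycle c → v ∈ c → OnCycle v
    cycle⇒onCycle {c} cyc v∈ with O-complete cyc
    ... | k , same = k , sameCycle-∈ c (O k) (sameCycle-sym (O k) c same) v∈

    O-inhabited : ∀ k → ∃[ v ] v ∈ O k
    O-inhabited k = inhabited (O k) (O-cycle k)
      where
      inhabited : ∀ c → IsCycle c → ∃[ v ] v ∈ c
      inhabited (v ∷ _) _ = v , here ≡.refl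

    Γ-acyclic : ∀ {W′} → W′ ⊆ W → Acyclic W′
    Γ-acyclic W′⊆W c cyc all with O-complete cyc
    ... | k , same with O-inhabited k
    ...   | v , v∈ = ∈-W⁻ (W′⊆W (All.lookup all (sameCycle-∈ (O k) c same v∈))) (k , v∈)

    offCycles : Graph (Fin n)
    offCycles = record
      { _~_    = λ x y → x ~ y × ¬ OnCycle x × ¬ OnCycle y
      ; _~?_   = λ x y → (x ~? y) ×-dec (¬? (onCycle? x) ×-dec ¬? (onCycle? y))
      ; sym-~  = λ (e , p , q) → sym-~ e , q , p
      ; irrefl = λ eq (e , _) → irrefl eq e
      }

    ConnΓ : Fin n → Fin n → Set
    ConnΓ = Star (Graph._~_ offCycles)

    abstract
      connΓ? : ∀ x y → Dec (ConnΓ x y)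
      connΓ? = connected? offCycles Fin._≟_ (allFin n) ∈-allFin

    connΓ-sym : ∀ {x y} → ConnΓ x y → ConnΓ y x
    connΓ-sym = Star.reverse (λ {x} {y} → Graph.sym-~ offCycles {x} {y})

    -- Two different edges from one component of Γ to one cycle would close up, through the cycle
    -- and the component, to a cycle through `u`, which lies on none.
    unique-attachment : ∀ {u u′ w w′ k} → ConnΓ u u′ → ¬ OnCycle u → ¬ OnCycle u′ →
      u ~ w → u′ ~ w′ → w ∈ O k → w′ ∈ O k → u ≡ u′ × w ≡ w′
    unique-attachment {u} {u′} {w} {w′} {k} conn ¬cu ¬cu′ u~w u′~w′ w∈ w′∈ with (u Fin.≟ u′) ×-dec (w Fin.≟ w′)
    ... | yes p = p
    ... | no distinct with cycle-through u~w (Star.map along (cycle-connected (O k) w∈ w′∈)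
                           ◅◅ bridge ◅ Star.map inΓ (connΓ-sym conn))
      where
      along : ∀ {x y} → (x , y) ∈ orientedEdges (O k) → Avoiding u w _~_ x y
      along m = orientedEdges-adj (O-cycle k) m
        , (λ { ≡.refl → ¬cu (k , orientedEdges-source (O k) m) })
        , (λ { ≡.refl → ¬cu (k , orientedEdges-target (O k) m) })
      bridge : Avoiding u w _~_ w′ u′
      bridge = sym-~ u′~w′
        , (λ { ≡.refl → ¬cu (k , w′∈) })
        , (λ { ≡.refl → distinct (≡.refl , ≡.refl) })
      inΓ : ∀ {x y} → Graph._~_ offCycles x y → Avoiding u w _~_ x y
      inΓ (e , ¬cx , ¬cy) = e , (λ { ≡.refl → ¬cy (k , w∈) }) , (λ { ≡.refl → ¬cx (k , w∈) })
    ... | c , cyc , m = contradiction (cycle⇒onCycle cyc (step-source c m)) ¬cu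

    -- A chord would lie on some cycle; sharing the vertex `a` with `O k`, that cycle is `O k`
    -- itself and the chord one of its edges.
    no-chords : ∀ {k a b} → a ∈ O k → b ∈ O k → a ~ b → (a , b) ∈ orientedEdges (O k)
    no-chords {k} {a} {b} a∈ b∈ a~b = decide (DecMembership._∈?_ (≡-dec Fin._≟_ Fin._≟_) (a , b) (orientedEdges (O k)))
      where
      along : (a , b) ∉ orientedEdges (O k) → ∀ {x y} → (x , y) ∈ orientedEdges (O k) → Avoiding a b _~_ x y
      along ∉ m = orientedEdges-adj (O-cycle k) m , (λ { ≡.refl → ∉ m })
        , (λ { ≡.refl → ∉ (orientedEdges-swap (O k) m) })
      on-same : ∀ c → (a , b) ∈ steps c → (∃[ l ] SameCycle (O l) c) → (a , b) ∈ orientedEdges (O k)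
      on-same c m (l , same) = subst (λ l → (a , b) ∈ orientedEdges (O l))
        (same-cycle-index {l} {k} (sameCycle-∈ c (O l) (sameCycle-sym (O l) c same) (step-source c m)) a∈)
        (proj₂ same (∈-++⁺ˡ m))
      decide : Dec ((a , b) ∈ orientedEdges (O k)) → (a , b) ∈ orientedEdges (O k)
      decide (yes m) = m
      decide (no ∉) with cycle-through a~b (Star.map (along ∉) (cycle-connected (O k) b∈ a∈))
      ... | c , cyc , m = on-same c m (O-complete cyc)

    Attached : Fin n → Fin n → Set
    Attached r v = ∃[ u ] u ~ v × ¬ OnCycle u × ConnΓ r u

    attached? : ∀ r v → Dec (Attached r v)
    attached? r v = Fin.any? (λ u → (u ~? v) ×-dec (¬? (onCycle? u) ×-dec connΓ? r u))

    abstract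
      -- Uniqueness lets a single transversal contain every vertex at which the component of `r`
      -- touches a cycle. On untouched cycles the choice is arbitrary.
      attachment : ∀ r k → ∃[ v ] v ∈ O k × (∀ v′ → v′ ∈ O k → Attached r v′ → v′ ≡ v)
      attachment r k with any? (attached? r) (O k)
      ... | no none with O-inhabited k
      ...   | v , v∈ = v , v∈ , λ v′ v′∈ att → contradiction (lose v′∈ att) none
      attachment r k | yes some with find some
      ... | v , v∈ , u , u~v , ¬cu , conn = v , v∈ , λ { v′ v′∈ (u′ , u′~v′ , ¬cu′ , conn′) →
            proj₂ (unique-attachment (connΓ-sym conn′ ◅◅ conn) ¬cu′ ¬cu u′~v′ u~v v′∈ v∈) }

    attachments : Fin n → Transversal
    attachments r = record { pick = λ k → proj₁ (attachment r k) ; pick-∈ = λ k → proj₁ (proj₂ (attachment r k)) }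

    PΓ : Peel W
    PΓ = peel W (Γ-acyclic id)
    open Peel PΓ using () renaming (pairs to L; inside to L-inside; triangular to L-triangular; covers to L-covers; cover to L-cover; pairs-adj to L-adj)

    μ : ℕ
    μ = length L

    CoverΓ : List (Fin n) → Set
    CoverΓ K = ∀ {x y} → ¬ OnCycle x → ¬ OnCycle y → x ~ y → x ∈ K ⊎ y ∈ K

    coverΓ-pairs : ∀ {K} → CoverΓ K → All (λ (x , y) → x ∈ K ⊎ y ∈ K) L
    coverΓ-pairs cov = All.tabulate λ m → cov
      (∈-W⁻ (proj₁ (All.lookup L-inside m))) (∈-W⁻ (proj₂ (All.lookup L-inside m))) (L-adj m)

    module _ {K : List (Fin n)} (cov : CoverΓ K) (small : length K ℕ.≤ μ) where
      private
        open VertexCounting K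
        -- The ends of `L` are distinct, so listing `L` twice gives each of them multiplicity two.
        double : flatten (L ++ L) ↭ ends L ++ ends L
        double = subst (_↭ ends L ++ ends L) (≡.sym (concatMap-++ _ L L))
          (Perm.++⁺ (flatten-↭-ends L) (flatten-↭-ends L))
        small₂ : length K ℕ.+ length K ℕ.≤ length (L ++ L)
        small₂ = ℕ.≤-trans (ℕ.+-mono-≤ small small) (ℕ.≤-reflexive (≡.sym (length-++ L)))

      coverΓ-one-end : ∀ {x y} → (x , y) ∈ L → x ∈ K → y ∉ K
      coverΓ-one-end m = tight-one-end (Tri-unique L-triangular) double
        (All.++⁺ (coverΓ-pairs cov) (coverΓ-pairs cov)) small₂ (∈-++⁺ˡ m)

      coverΓ-⊆-ends : K ⊆ ends L
      coverΓ-⊆-ends = tight-⊆ (Tri-unique L-triangular) double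
        (All.++⁺ (coverΓ-pairs cov) (coverΓ-pairs cov)) small₂

      private
        selected : List Edge
        selected = filter (λ e → proj₂ e ∈? K) (tri L)

        selected-col : ∀ {j} → j ∈ K → j ∈ map proj₂ selected
        selected-col {j} j∈K = select (∈-map⁻ proj₂ {xs = tri L} (coverΓ-⊆-ends j∈K))
          where
          select : (∃[ e ] e ∈ tri L × j ≡ proj₂ e) → j ∈ map proj₂ selected
          select (e , m , eq) = subst (_∈ map proj₂ selected) (≡.sym eq)
            (∈-map⁺ proj₂ {xs = selected} (∈-filter⁺ (λ e → proj₂ e ∈? K) {xs = tri L} m (subst (_∈ K) eq j∈K)))

        selected-row : ∀ {ρ s} → (ρ , s) ∈ selected → ¬ OnCycle ρ × ρ ∉ K
        selected-row {ρ} {s} m = select (tri-∈ L (proj₁ m′))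
          where
          m′ : (ρ , s) ∈ tri L × s ∈ K
          m′ = ∈-filter⁻ (λ e → proj₂ e ∈? K) {xs = tri L} m
          select : (ρ , s) ∈ L ⊎ (s , ρ) ∈ L → ¬ OnCycle ρ × ρ ∉ K
          select (inj₁ p) = ∈-W⁻ (proj₁ (All.lookup L-inside p)) , λ ρ∈K → coverΓ-one-end p ρ∈K (proj₂ m′)
          select (inj₂ p) = ∈-W⁻ (proj₂ (All.lookup L-inside p)) , coverΓ-one-end p (proj₂ m′)

      -- A cover of size at most μ takes exactly one end of each pair of `L`, so the pivots with
      -- column in `K` have their rows outside `K` and exhaust `K` by their columns. At such a row
      -- only `K` can contribute, and forward substitution applies.
      kernel-vanishes-on-cover : ∀ {M} → Weighted M → ∀ z →
        (∀ i → ¬ OnCycle i → i ∉ K → (M ∙ z) i ≈ 0#) →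
        (∀ i j → ¬ OnCycle i → i ∉ K → i ~ j → j ∈ K ⊎ z j ≈ 0#) →
        ∀ {s} → s ∈ K → z s ≈ 0#
      kernel-vanishes-on-cover {M} wM z rows nbrs {s} s∈K = All.lookup cols (selected-col s∈K)
        where
        off-row : ∀ e j → e ∈ selected → j ∉ map proj₂ selected → M (proj₁ e) j * z j ≈ 0#
        off-row e j m j∉ = zero-term (proj₁ e ~? j)
          where
          zero-term : Dec (proj₁ e ~ j) → M (proj₁ e) j * z j ≈ 0#
          zero-term (no ≁)    = trans (*-congʳ (off wM ≁)) (zeroˡ _)
          zero-term (yes e~j) = [ (λ j∈K → contradiction (selected-col j∈K) j∉) , (λ zj → trans (*-congˡ zj) (zeroʳ _)) ]′
            (nbrs (proj₁ e) j (proj₁ (selected-row m)) (proj₂ (selected-row m)) e~j)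
        rows-vanish : All (λ e → (M ∙ z) (proj₁ e) ≈ 0#) selected
        rows-vanish = All.tabulate λ m → rows _ (proj₁ (selected-row m)) (proj₂ (selected-row m))
        cols : All (λ s → z s ≈ 0#) (map proj₂ selected)
        cols = All.map⁺ (triangular-kernel M (triangular wM (Tri-filter (λ e → proj₂ e ∈? K) L-triangular)) z rows-vanish off-row)

    module _ {M : Fin n → Fin n → Carrier} (wM : Weighted M) where

      -- The block off the cycles is kept at full size with zeros around it, so that its kernel
      -- vectors are vectors on the vertices of G.
      restrictΓ : Fin n → Fin n → Carrier
      restrictΓ i j = if does (onCycle? i) then 0# else if does (onCycle? j) then 0# else M i j

      restrictΓ-≈ : ∀ {i j} → ¬ OnCycle i → ¬ OnCycle j → restrictΓ i j ≈ M i j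
      restrictΓ-≈ {i} {j} ¬ci ¬cj with onCycle? i | onCycle? j
      ... | yes ci | _      = contradiction ci ¬ci
      ... | no _   | yes cj = contradiction cj ¬cj
      ... | no _   | no _   = refl

      restrictΓ-off : ∀ {i j} → ¬ (i ~ j × ¬ OnCycle i × ¬ OnCycle j) → restrictΓ i j ≈ 0#
      restrictΓ-off {i} {j} ¬e with onCycle? i | onCycle? j
      ... | yes _  | _      = refl
      ... | no _   | yes _  = refl
      ... | no ¬ci | no ¬cj = off wM λ e → ¬e (e , ¬ci , ¬cj)

      restrictΓ-∙ : ∀ z → (∀ j → OnCycle j → z j ≈ 0#) → ∀ i → ¬ OnCycle i → (M ∙ z) i ≈ (restrictΓ ∙ z) i
      restrictΓ-∙ z supp i ¬ci = sum-cong-≋ entry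
        where
        entry : ∀ j → M i j * z j ≈ restrictΓ i j * z j
        entry j = cases (onCycle? j)
          where
          cases : Dec (OnCycle j) → M i j * z j ≈ restrictΓ i j * z j
          cases (yes cj) = trans (trans (*-congˡ (supp j cj)) (zeroʳ _)) (sym (trans (*-congˡ (supp j cj)) (zeroʳ _)))
          cases (no ¬cj) = *-congʳ (sym (restrictΓ-≈ ¬ci ¬cj))

      restrictΓ-indep : ∀ {W′} (P : Peel W′) → W′ ⊆ W → ¬ Dep (map (col restrictΓ) (ends (Peel.pairs P)))
      restrictΓ-indep P ⊆W = triangular⇒¬dep (go (Peel.triangular P) (All.tabulate inside-W))
        where
        inside-W : ∀ {e} → e ∈ tri (Peel.pairs P) → ¬ OnCycle (proj₁ e) × ¬ OnCycle (proj₂ e)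
        inside-W m with tri-∈ (Peel.pairs P) m
        ... | inj₁ p = let (a , b) = All.lookup (Peel.inside P) p in ∈-W⁻ (⊆W a) , ∈-W⁻ (⊆W b)
        ... | inj₂ p = let (a , b) = All.lookup (Peel.inside P) p in ∈-W⁻ (⊆W b) , ∈-W⁻ (⊆W a)
        go : ∀ {es} → Tri es → All (λ e → ¬ OnCycle (proj₁ e) × ¬ OnCycle (proj₂ e)) es → Triangular {M = restrictΓ} es
        go [] [] = []
        go ((p , q) ∷ t) ((¬cρ , ¬cs) ∷ cs) =
          ((λ z → nonzero wM p (trans (sym (restrictΓ-≈ ¬cρ ¬cs)) z)) , All.map (λ ≁ → restrictΓ-off (≁ ∘ proj₁)) q) ∷ go t cs

      -- A maximum peeling of Γ spans all columns: the cover of PΓ bounds the rank by 2μ.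
      restrictΓ-kernel : ∀ {W′} (P : Peel W′) → W′ ⊆ W → μ ℕ.≤ length (Peel.pairs P) →
        ∀ {j} → j ∉ ends (Peel.pairs P) → ¬ OnCycle j →
        ∃[ z ] (∀ i → (restrictΓ ∙ z) i ≈ 0#) × z j ≈ 1# ×
          (∀ l → l ∉ ends (Peel.pairs P) → l ≢ j → z l ≈ 0#) × (∀ l → OnCycle l → z l ≈ 0#)
      restrictΓ-kernel {W′} P ⊆W large {j} j∉ ¬cj = vanish-on-cycles (span⇒kernel restrictΓ
          (maximal-indep-spans us (All.map⁺ (All.universal spans (ends (Peel.pairs P)))) (restrictΓ-indep P ⊆W) counts (spans j)) j∉)
        where
        us = map (δ Fin._≟_) L-cover ++ map (col restrictΓ) L-cover
        spans : ∀ j → Span us (col restrictΓ j)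
        spans = cover-spans Fin._≟_ restrictΓ L-cover λ i j i∉ j∉ → restrictΓ-off λ (e , ¬ci , ¬cj) →
          [ i∉ , j∉ ]′ (L-covers (∈-W⁺ ¬ci) (∈-W⁺ ¬cj) e)
        counts : length us ℕ.≤ length (map (col restrictΓ) (ends (Peel.pairs P)))
        counts = ≡.subst₂ ℕ._≤_
          (≡.sym (≡.trans (length-++ (map (δ Fin._≟_) L-cover))
            (≡.cong₂ ℕ._+_ (≡.trans (length-map _ L-cover) (length-map proj₁ L)) (≡.trans (length-map _ L-cover) (length-map proj₁ L)))))
          (≡.sym (≡.trans (length-map _ (ends (Peel.pairs P))) (≡.trans (length-map proj₂ (tri (Peel.pairs P))) (length-tri (Peel.pairs P)))))
          (ℕ.+-mono-≤ large large)
        vanish-on-cycles : (∃[ z ] (∀ i → (restrictΓ ∙ z) i ≈ 0#) × z j ≈ 1# × (∀ l → l ∉ ends (Peel.pairs P) → l ≢ j → z l ≈ 0#)) →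
          ∃[ z ] (∀ i → (restrictΓ ∙ z) i ≈ 0#) × z j ≈ 1# ×
            (∀ l → l ∉ ends (Peel.pairs P) → l ≢ j → z l ≈ 0#) × (∀ l → OnCycle l → z l ≈ 0#)
        vanish-on-cycles (z , ker , one , supp) = z , ker , one , supp , λ l cl → supp l
          (λ m → ∈-W⁻ (⊆W (Peel.ends⊆ P m)) cl) (λ { ≡.refl → ¬cj cl })

-- Small covers through attached vertices, and the bound 2μ + |Q|.

module RankBoundTheory where

  open SpanTheory using (Field)
  open CycleTheory
  open PeelingTheory
  open CycleRankTheory
  open ExtremalTheory
  open OffCycleTheory
  open import Data.Empty using (⊥-elim)
  open import Data.List.Base using ([_])
  open import Data.List.Membership.Propositional.Properties using (∈-concat⁺′)
  open import Data.List.Properties using (concatMap-++; ++-assoc)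
  open import Data.List.Relation.Binary.Permutation.Propositional using (↭-reflexive)

  ++-interchange : ∀ {A : Set} (xs ys : List A) → (xs ++ xs) ++ (ys ++ ys) ↭ (xs ++ ys) ++ (xs ++ ys)
  ++-interchange xs ys = ↭-trans (↭-reflexive (++-assoc xs xs (ys ++ ys)))
    (↭-trans (Perm.++⁺ˡ xs (Perm.shifts xs ys)) (↭-reflexive (≡.sym (++-assoc xs ys (xs ++ ys)))))

  flatten-++ : ∀ {A : Set} (xs ys : List (A × A)) → flatten (xs ++ ys) ≡ flatten xs ++ flatten ys
  flatten-++ xs ys = concatMap-++ _ xs ys

  module RankBound (F : Field) {n : ℕ} (G : Graph (Fin n)) (E : WeightedGraph.Extremal F G) where
    open OffCycles F G E public
    open DecMembership (Fin._≟_ {n}) using (_∈?_)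
    open Peel PΓ using () renaming (pairs to L)

    -- The component of u in Γ meets the cycles only in the attachments of u, so
    -- the kernel vector of G at one of them, zero at the others, contradicts κ u ≈ 1.
    module _ {u v k} (¬cu : ¬ OnCycle u) (u~v : u ~ v) (v∈ : v ∈ O k) (κ : Fin n → Carrier)
             (ker : ∀ i → (restrictΓ wA ∙ κ) i ≈ 0#) (one : κ u ≈ 1#) (supp : ∀ l → OnCycle l → κ l ≈ 0#) where
      private
        Y : Transversal
        Y = attachments u

        comp : Fin n → Carrier
        comp j = if does (connΓ? u j) then κ j else 0#

        comp-in : ∀ {j} → ConnΓ u j → comp j ≈ κ j
        comp-in {j} c with connΓ? u j
        ... | yes _ = refl
        ... | no ¬c = contradiction c ¬c

        comp-out : ∀ {j} → ¬ ConnΓ u j → comp j ≈ 0#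
        comp-out {j} ¬c with connΓ? u j
        ... | yes c = contradiction c ¬c
        ... | no _  = refl

        comp-cycle : ∀ {j} → OnCycle j → comp j ≈ 0#
        comp-cycle {j} cj with connΓ? u j
        ... | yes _ = supp j cj
        ... | no _  = refl

        zero-term : ∀ {i j} → (i ~ j → ConnΓ u j → ¬ OnCycle j → A i j * comp j ≈ 0#) → A i j * comp j ≈ 0#
        zero-term {i} {j} h = cases (i ~? j) (connΓ? u j) (onCycle? j)
          where
          cases : Dec (i ~ j) → Dec (ConnΓ u j) → Dec (OnCycle j) → A i j * comp j ≈ 0#
          cases (no ≁) _ _               = trans (*-congʳ (off wA ≁)) (zeroˡ _)
          cases (yes _) (no ¬c) _        = trans (*-congˡ (comp-out ¬c)) (zeroʳ _)
          cases (yes _) (yes _) (yes cj) = trans (*-congˡ (comp-cycle cj)) (zeroʳ _)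
          cases (yes e) (yes c) (no ¬cj) = h e c ¬cj

        off-cycle-rows : ∀ {i} → ¬ OnCycle i → (A ∙ comp) i ≈ 0#
        off-cycle-rows {i} ¬ci = cases (connΓ? u i)
          where
          same : ConnΓ u i → ∀ j → A i j * comp j ≈ A i j * κ j
          same ci j = cases (i ~? j) (onCycle? j)
            where
            cases : Dec (i ~ j) → Dec (OnCycle j) → A i j * comp j ≈ A i j * κ j
            cases (no ≁) _         = trans (trans (*-congʳ (off wA ≁)) (zeroˡ _)) (sym (trans (*-congʳ (off wA ≁)) (zeroˡ _)))
            cases (yes _) (yes cj) = *-congˡ (trans (comp-cycle cj) (sym (supp j cj)))
            cases (yes e) (no ¬cj) = *-congˡ (comp-in (ci ◅◅ (e , ¬ci , ¬cj) ◅ ε))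
          cases : Dec (ConnΓ u i) → (A ∙ comp) i ≈ 0#
          cases (yes ci) = trans (sum-cong-≋ (same ci)) (trans (restrictΓ-∙ wA κ supp i ¬ci) (ker i))
          cases (no ¬c)  = sum-zero _ (λ j → zero-term {_} {j} λ e cj ¬cj →
            contradiction (cj ◅◅ (sym-~ e , ¬cj , ¬ci) ◅ ε) ¬c)

        pick-v : Transversal.pick Y k ≡ v
        pick-v = ≡.sym (proj₂ (proj₂ (attachment u k)) v v∈ (u , u~v , ¬cu , ε))

        -- A cycle vertex with a neighbour in the component of `u` is an attachment and therefore
        -- picked by `Y`.
        cycle-rows : ∀ {i l} → i ∈ O l → i ≢ Transversal.pick Y l → (A ∙ comp) i ≈ 0#
        cycle-rows {i} {l} i∈ i≢ = sum-zero _ (λ j → zero-term {_} {j} λ e cj ¬cj →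
          contradiction (proj₂ (proj₂ (attachment u l)) i i∈ (j , sym-~ e , ¬cj , cj)) i≢)

        -- Since attaching edges are unique, `u` is the only neighbour of `v` in its component.
        row-v : (A ∙ comp) v ≈ A v u
        row-v = trans (sum-single _ u (λ j j≢u → zero-term {_} {j} λ e cj ¬cj →
            contradiction (≡.sym (proj₁ (unique-attachment cj ¬cu ¬cj u~v (sym-~ e) v∈ v∈))) j≢u))
          (trans (*-congˡ (trans (comp-in ε) one)) (*-identityʳ _))

      no-kernel-at-attachment : ⊥
      no-kernel-at-attachment = impossible (kernel-vector Y k)
        where
        impossible : (∃[ z ] (∀ i → (A ∙ z) i ≈ 0#) × z (Transversal.pick Y k) ≈ 1#
          × (∀ l → l ≢ k → z (Transversal.pick Y l) ≈ 0#)) → ⊥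
        impossible (ζ , kerζ , oneζ , zeroζ) = contradiction
          (begin
            A v u                               ≈⟨ row-v ⟨
            (A ∙ comp) v                        ≈⟨ *-identityˡ _ ⟨
            1# * (A ∙ comp) v                   ≈⟨ *-congʳ (trans (reflexive (cong ζ (≡.sym pick-v))) oneζ) ⟨
            -- All other terms vanish: off the cycles and at unpicked cycle vertices the image of
            -- `comp` is 0, and at the other picked vertices `ζ` is 0.
            ζ v * (A ∙ comp) v                  ≈⟨ sum-single _ v (λ i i≢v → other i i≢v (onCycle? i)) ⟨
            sum (λ i → ζ i * (A ∙ comp) i)      ≈⟨ ∙-adjoint A A-sym ζ comp ⟩
            sum (λ j → comp j * (A ∙ ζ) j)      ≈⟨ sum-zero _ (λ j → trans (*-congˡ (kerζ j)) (zeroʳ _)) ⟩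
            0# ∎)
          (nonzero wA (sym-~ u~v))
          where
          other : ∀ i → i ≢ v → Dec (OnCycle i) → ζ i * (A ∙ comp) i ≈ 0#
          other i i≢v (no ¬ci) = trans (*-congˡ (off-cycle-rows ¬ci)) (zeroʳ _)
          other i i≢v (yes (l , i∈)) = cases (i Fin.≟ Transversal.pick Y l) (l Fin.≟ k)
            where
            cases : Dec (i ≡ Transversal.pick Y l) → Dec (l ≡ k) → ζ i * (A ∙ comp) i ≈ 0#
            cases (no i≢) _ = trans (*-congˡ (cycle-rows i∈ i≢)) (zeroʳ _)
            cases (yes eq) (yes l≡k) = contradiction (≡.trans eq (≡.trans (cong (Transversal.pick Y) l≡k) pick-v)) i≢v
            cases (yes eq) (no l≢k) = trans (*-congʳ (trans (reflexive (cong ζ eq)) (zeroζ l l≢k))) (zeroˡ _)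

    -- If Γ without `u` still had μ pairs, their columns would span the column of `u`, and the
    -- resulting kernel vector is impossible at an attached vertex. So there are fewer than μ pairs,
    -- and `u` can be added to their cover.
    small-cover-through : ∀ {u v k} → ¬ OnCycle u → u ~ v → v ∈ O k →
      ∃[ K ] CoverΓ K × length K ℕ.≤ μ × u ∈ K
    small-cover-through {u} {v} {k} ¬cu u~v v∈ = decide (μ ℕ.≤? length (Peel.pairs P′))
      where
      W′ : List (Fin n)
      W′ = filter (λ z → ¬? (z Fin.≟ u)) W
      W′⊆W : W′ ⊆ W
      W′⊆W m = proj₁ (∈-filter⁻ (λ z → ¬? (z Fin.≟ u)) {xs = W} m)
      u∉W′ : u ∉ W′
      u∉W′ m = proj₂ (∈-filter⁻ (λ z → ¬? (z Fin.≟ u)) {xs = W} m) ≡.refl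
      P′ : Peel W′
      P′ = peel W′ (Γ-acyclic W′⊆W)
      clash : (∃[ z ] (∀ i → (restrictΓ wA ∙ z) i ≈ 0#) × z u ≈ 1# ×
          (∀ l → l ∉ ends (Peel.pairs P′) → l ≢ u → z l ≈ 0#) × (∀ l → OnCycle l → z l ≈ 0#)) → ⊥
      clash (κ , ker , one , _ , supp) = no-kernel-at-attachment ¬cu u~v v∈ κ ker one supp
      covers′ : CoverΓ (u ∷ Peel.cover P′)
      covers′ {x} {y} ¬cx ¬cy e = cases (x Fin.≟ u) (y Fin.≟ u)
        where
        cases : Dec (x ≡ u) → Dec (y ≡ u) → x ∈ u ∷ Peel.cover P′ ⊎ y ∈ u ∷ Peel.cover P′
        cases (yes eq) _       = inj₁ (here eq)
        cases (no _) (yes eq)  = inj₂ (here eq)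
        cases (no x≢) (no y≢) = Sum.map there there (Peel.covers P′
          (∈-filter⁺ (λ z → ¬? (z Fin.≟ u)) (∈-W⁺ ¬cx) x≢) (∈-filter⁺ (λ z → ¬? (z Fin.≟ u)) (∈-W⁺ ¬cy) y≢) e)
      decide : Dec (μ ℕ.≤ length (Peel.pairs P′)) → ∃[ K ] CoverΓ K × length K ℕ.≤ μ × u ∈ K
      decide (yes large) = ⊥-elim (clash (restrictΓ-kernel wA P′ W′⊆W large (λ m → u∉W′ (Peel.ends⊆ P′ m)) ¬cu))
      decide (no small)  = u ∷ Peel.cover P′ , covers′
        , subst (ℕ._≤ μ) (cong suc (≡.sym (length-map proj₁ (Peel.pairs P′)))) (ℕ.≰⇒> small) , here ≡.refl

    -- A column relation of the block off the cycles persists in the whole matrix: a row on a cycle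
    -- sees only attached vertices, and there the kernel vector vanishes because each of them lies
    -- in a cover of Γ of size at most μ.
    span-off-cycles : ∀ j → ¬ OnCycle j → Span (map (col Φ) (ends L)) (col Φ j)
    span-off-cycles j ¬cj = decide (j ∈? ends L)
      where
      lift-kernel : (∃[ z ] (∀ i → (restrictΓ wΦ ∙ z) i ≈ 0#) × z j ≈ 1# ×
          (∀ l → l ∉ ends L → l ≢ j → z l ≈ 0#) × (∀ l → OnCycle l → z l ≈ 0#)) →
        Span (map (col Φ) (ends L)) (col Φ j)
      lift-kernel (κ , ker , one , supp , vanish) = kernel⇒span Φ κ (λ i → row i (onCycle? i)) one supp
        where
        off-cycle-row : ∀ i → ¬ OnCycle i → (Φ ∙ κ) i ≈ 0#
        off-cycle-row i ¬ci = trans (restrictΓ-∙ wΦ κ vanish i ¬ci) (ker i)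
        attached-zero : ∀ {x k i} → ¬ OnCycle x → x ~ i → i ∈ O k →
          (∃[ K ] CoverΓ K × length K ℕ.≤ μ × x ∈ K) → κ x ≈ 0#
        attached-zero ¬cx x~i i∈ (K , cov , small , x∈K) = kernel-vanishes-on-cover cov small wΦ κ
          (λ i ¬ci _ → off-cycle-row i ¬ci) nbrs x∈K
          where
          nbrs : ∀ i j → ¬ OnCycle i → i ∉ K → i ~ j → j ∈ K ⊎ κ j ≈ 0#
          nbrs i j ¬ci i∉K e = cases (onCycle? j)
            where
            cases : Dec (OnCycle j) → j ∈ K ⊎ κ j ≈ 0#
            cases (yes cj) = inj₂ (vanish j cj)
            cases (no ¬cj) = inj₁ ([ (λ i∈K → contradiction i∈K i∉K) , id ]′ (cov ¬ci ¬cj e))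
        row : ∀ i → Dec (OnCycle i) → (Φ ∙ κ) i ≈ 0#
        row i (no ¬ci) = off-cycle-row i ¬ci
        row i (yes (k , i∈)) = sum-zero _ (λ x → term x (i ~? x) (onCycle? x))
          where
          term : ∀ x → Dec (i ~ x) → Dec (OnCycle x) → Φ i x * κ x ≈ 0#
          term x (no ≁) _         = trans (*-congʳ (off wΦ ≁)) (zeroˡ _)
          term x (yes _) (yes cx) = trans (*-congˡ (vanish x cx)) (zeroʳ _)
          term x (yes e) (no ¬cx) = trans (*-congˡ (attached-zero ¬cx (sym-~ e) i∈ (small-cover-through ¬cx (sym-~ e) i∈))) (zeroʳ _)
      decide : Dec (j ∈ ends L) → Span (map (col Φ) (ends L)) (col Φ j)
      decide (yes m) = span-∈ (∈-map⁺ (col Φ) m)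
      decide (no j∉) = lift-kernel (restrictΓ-kernel wΦ PΓ id ℕ.≤-refl j∉ ¬cj)

    Q : List (Fin n)
    Q = concat 𝒞

    ∈-Q⁺ : ∀ {v} → OnCycle v → v ∈ Q
    ∈-Q⁺ (k , v∈) = ∈-concat⁺′ {xss = 𝒞} v∈ (∈-lookup {xs = 𝒞} k)

    rank-bound : rΦ ℕ.≤ (μ ℕ.+ μ) ℕ.+ length Q
    rank-bound = subst (rΦ ℕ.≤_) count (rank-≤ RΦ us (λ j → spans j (onCycle? j)))
      where
      us : List (Fin n → Carrier)
      us = map (col Φ) (ends L) ++ map (col Φ) Q
      spans : ∀ j → Dec (OnCycle j) → Span us (col Φ j)
      spans j (yes cj) = span-++ʳ (map (col Φ) (ends L)) (span-∈ (∈-map⁺ (col Φ) (∈-Q⁺ cj)))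
      spans j (no ¬cj) = span-++ˡ (span-off-cycles j ¬cj)
      count : length us ≡ (μ ℕ.+ μ) ℕ.+ length Q
      count = ≡.trans (length-++ (map (col Φ) (ends L))) (≡.cong₂ ℕ._+_
        (≡.trans (length-map _ (ends L)) (≡.trans (length-map proj₂ (tri L)) (length-tri L))) (length-map _ Q))

-- Tight covers of the matched edges and the cycles.

module TightnessTheory where

  open SpanTheory using (Field)
  open CycleTheory
  open PeelingTheory
  open CycleRankTheory
  open ExtremalTheory
  open OffCycleTheory
  open RankBoundTheory
  open import Data.List.Base using ([_]; upTo)
  open import Data.List.Membership.Propositional.Properties using (∈-concat⁻′; ∈-concatMap⁻; ∈-deduplicate⁻; ∈-concatMap⁺; ∈-tabulate⁺)
  open import Data.List.Relation.Binary.Disjoint.Propositional using (Disjoint)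
  open import Data.List.Relation.Binary.Permutation.Propositional using (prep; ↭-sym; ↭-reflexive)

  flatten-steps′ : ∀ {A : Set} v vs (e : A) → flatten (steps′ v vs e) ↭ (v ∷ vs) ++ (vs ++ [ e ])
  flatten-steps′ v []       e = ↭-refl
  flatten-steps′ v (w ∷ vs) e = prep v (↭-trans (prep w (flatten-steps′ w vs e)) (move w vs (vs ++ [ e ])))
    where
    move : ∀ w vs xs → w ∷ (w ∷ vs) ++ xs ↭ w ∷ vs ++ w ∷ xs
    move w vs xs = prep w (↭-sym (Perm.shift w vs xs))

  length-steps′ : ∀ {A : Set} v vs (e : A) → length (steps′ v vs e) ≡ length (v ∷ vs)
  length-steps′ v []       e = ≡.refl
  length-steps′ v (w ∷ vs) e = cong suc (length-steps′ w vs e)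

  module Tightness (F : Field) {n : ℕ} (G : Graph (Fin n)) (E : WeightedGraph.Extremal F G) where
    open RankBound F G E public
    open DecMembership (Fin._≟_ {n}) using (_∈?_)
    open Peel PΓ using () renaming (pairs to L; triangular to L-triangular; ends⊆ to L-ends⊆; pairs-adj to L-adj)

    flatten-steps : ∀ c → flatten (steps c) ↭ c ++ c
    flatten-steps []       = ↭-refl
    flatten-steps (v ∷ vs) = ↭-trans (flatten-steps′ v vs v) (Perm.++⁺ˡ (v ∷ vs) (↭-sym (Perm.∷↭∷ʳ v vs)))

    length-steps : ∀ c → length (steps c) ≡ length c
    length-steps []       = ≡.refl
    length-steps (v ∷ vs) = length-steps′ v vs v

    flatten-cycles : ∀ cs → flatten (concatMap steps cs) ↭ concat cs ++ concat cs
    flatten-cycles []       = ↭-refl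
    flatten-cycles (c ∷ cs) = ↭-trans (↭-reflexive (flatten-++ (steps c) (concatMap steps cs)))
      (↭-trans (Perm.++⁺ (flatten-steps c) (flatten-cycles cs)) (++-interchange c (concat cs)))

    length-cycles : ∀ cs → length (concatMap steps cs) ≡ length (concat cs)
    length-cycles []       = ≡.refl
    length-cycles (c ∷ cs) = ≡.trans (length-++ (steps c))
      (≡.trans (≡.cong₂ ℕ._+_ (length-steps c) (length-cycles cs)) (≡.sym (length-++ c)))

    -- A two-regular multigraph on `vertices`: the matched edges of Γ as digons, next to the cycles.
    allEdges : List Edge
    allEdges = (L ++ L) ++ concatMap steps 𝒞

    vertices : List (Fin n)
    vertices = ends L ++ Q

    allEdges-double : flatten allEdges ↭ vertices ++ vertices
    allEdges-double = ↭-trans (↭-reflexive (flatten-++ (L ++ L) (concatMap steps 𝒞)))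
      (↭-trans (Perm.++⁺
          (↭-trans (↭-reflexive (flatten-++ L L)) (Perm.++⁺ (flatten-↭-ends L) (flatten-↭-ends L)))
          (flatten-cycles 𝒞))
        (++-interchange (ends L) Q))

    length-allEdges : length allEdges ≡ (μ ℕ.+ μ) ℕ.+ length Q
    length-allEdges = ≡.trans (length-++ (L ++ L)) (≡.cong₂ ℕ._+_ (length-++ L) (length-cycles 𝒞))

    Q-unique : Unique Q
    Q-unique = Unique.concat⁺ (All.map (proj₁ ∘ proj₂) cycles) (disjoint cycles (deduplicate-unrelated sameCycle? _))
      where
      cycles : All IsCycle 𝒞
      cycles = All.tabulate λ {c} m → proj₂ (∈-filter⁻ isCycle? {xs = concatMap sequences (upTo (suc n))}
        (∈-deduplicate⁻ sameCycle? _ m))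
      disjoint : ∀ {cs} → All IsCycle cs → AllPairs (λ c d → ¬ SameCycle c d) cs → AllPairs Disjoint cs
      disjoint [] [] = []
      disjoint {c ∷ cs} (cyc ∷ cycs) (d ∷ ds) = All.zipWith
        (λ { {d} (cycD , diff) (p , q) → pairwiseDisjoint c d cyc cycD diff _ p q }) (cycs , d) ∷ disjoint cycs ds

    ∈-Q⁻ : ∀ {v} → v ∈ Q → OnCycle v
    ∈-Q⁻ v∈ with ∈-concat⁻′ 𝒞 v∈
    ... | c , v∈c , c∈ = Any.index c∈ , subst (_ ∈_) (Any.lookup-index c∈) v∈c

    vertices-unique : Unique vertices
    vertices-unique = Unique.++⁺ (Tri-unique L-triangular) Q-unique λ (p , q) → ∈-W⁻ (L-ends⊆ p) (∈-Q⁻ q)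

    allEdges-adj : ∀ {a b} → (a , b) ∈ allEdges → a ~ b
    allEdges-adj {a} {b} m = cases (∈-++⁻ (L ++ L) m)
      where
      cases : (a , b) ∈ L ++ L ⊎ (a , b) ∈ concatMap steps 𝒞 → a ~ b
      cases (inj₁ p) = [ L-adj , L-adj ]′ (∈-++⁻ L p)
      cases (inj₂ p) = on-cycle (find (∈-concatMap⁻ steps {xs = 𝒞} p))
        where
        on-cycle : (∃[ c ] c ∈ 𝒞 × (a , b) ∈ steps c) → a ~ b
        on-cycle (c , c∈ , s) = subst (λ c → (a , b) ∈ steps c → a ~ b) (≡.sym (Any.lookup-index c∈))
          (λ s → orientedEdges-adj (O-cycle (Any.index c∈)) (∈-++⁺ˡ s)) s

    module TightCover (Y : Transversal) where
      open Transversal Y public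
      open VertexCounting Z

      covered : All (λ (a , b) → a ∈ Z ⊎ b ∈ Z) allEdges
      covered = All.tabulate λ m → Z-covers (allEdges-adj m)

      -- Extremality made r(Φ) equal to 2|Z|, so the bound on r(Φ) is a bound on the cover.
      tight : length Z ℕ.+ length Z ℕ.≤ length allEdges
      tight = ≡.subst₂ ℕ._≤_ (rΦ≡ Y) (≡.sym length-allEdges) rank-bound

      -- The missing inequality is the double count: 2|Z| is at least the number of edges covered.
      rank-exact : rΦ ≡ (μ ℕ.+ μ) ℕ.+ length Q
      rank-exact = ℕ.≤-antisym rank-bound (≡.subst₂ ℕ._≤_ length-allEdges (≡.sym (rΦ≡ Y))
        (double-cover-≤ vertices-unique allEdges-double covered))

      one-end : ∀ {a b} → (a , b) ∈ allEdges → a ∈ Z → b ∉ Z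
      one-end = tight-one-end vertices-unique allEdges-double covered tight

      pair-one-end : ∀ {a b} → (a , b) ∈ L → a ∈ Z → b ∉ Z
      pair-one-end m = one-end (∈-++⁺ˡ (∈-++⁺ˡ m))

      step-one-end : ∀ {k a b} → (a , b) ∈ steps (O k) → a ∈ Z → b ∉ Z
      step-one-end {k} m = one-end (∈-++⁺ʳ (L ++ L) (∈-concatMap⁺ steps {xs = 𝒞} (lose (∈-lookup {xs = 𝒞} k) m)))

      Z-off-cycle : ∀ {v} → v ∈ Z → ¬ OnCycle v → v ∈ ends L
      Z-off-cycle v∈ ¬cv = [ id , (λ q → contradiction (∈-Q⁻ q) ¬cv) ]′
        (∈-++⁻ (ends L) (tight-⊆ vertices-unique allEdges-double covered tight v∈))

      pick-∈-Z : ∀ k → pick k ∈ Z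
      pick-∈-Z k = ∈-++⁺ˡ (∈-tabulate⁺ {f = pick} k)

    -- A transversal of predecessors: its minimum vertex cover alternates along the
    -- cycles, hence misses Y and contains all neighbours of Y.
    predecessors : Transversal → Transversal
    predecessors Y = record { pick = λ k → proj₁ (pred k) ; pick-∈ = λ k → step-source (O k) (proj₂ (pred k)) }
      where
      pred : ∀ k → ∃[ x ] (x , Transversal.pick Y k) ∈ steps (O k)
      pred k = step-into (O k) (Transversal.pick-∈ Y k)

    module Missing (Y : Transversal) where
      open TightCover (predecessors Y) public using (Z; Z-covers; Z-off-cycle; pair-one-end; step-one-end; pick-∈-Z)

      misses : ∀ k → Transversal.pick Y k ∉ Z
      misses k = step-one-end {k} (proj₂ (step-into (O k) (Transversal.pick-∈ Y k))) (pick-∈-Z k)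

      neighbours : ∀ {v} k → v ~ Transversal.pick Y k → v ∈ Z
      neighbours k e = [ id , (λ m → contradiction m (misses k)) ]′ (Z-covers e)

    -- If the cycles differed, one transversal could contain both `v` and `w`, and the cover that
    -- misses this transversal would miss both ends of the edge.
    no-edges-between-cycles : ∀ {k l v w} → v ∈ O k → w ∈ O l → v ~ w → k ≡ l
    no-edges-between-cycles {k} {l} {v} {w} v∈ w∈ v~w = decide (k Fin.≟ l)
      where
      choose : ∀ j → ∃[ x ] x ∈ O j × (j ≡ k → x ≡ v) × (j ≡ l → j ≢ k → x ≡ w)
      choose j = cases (j Fin.≟ k) (j Fin.≟ l)
        where
        cases : Dec (j ≡ k) → Dec (j ≡ l) → ∃[ x ] x ∈ O j × (j ≡ k → x ≡ v) × (j ≡ l → j ≢ k → x ≡ w)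
        cases (yes ≡.refl) _ = v , v∈ , (λ _ → ≡.refl) , λ _ ne → contradiction ≡.refl ne
        cases (no ne) (yes ≡.refl) = w , w∈ , (λ eq → contradiction eq ne) , λ _ _ → ≡.refl
        cases (no ne) (no ne′) = proj₁ (O-inhabited j) , proj₂ (O-inhabited j)
          , (λ eq → contradiction eq ne) , λ eq _ → contradiction eq ne′
      Y : Transversal
      Y = record { pick = λ j → proj₁ (choose j) ; pick-∈ = λ j → proj₁ (proj₂ (choose j)) }
      decide : Dec (k ≡ l) → k ≡ l
      decide (yes eq) = eq
      decide (no ne) = contradiction
        (Missing.neighbours Y k (subst (w ~_) (≡.sym (proj₁ (proj₂ (proj₂ (choose k))) ≡.refl)) (sym-~ v~w)))
        (subst (_∉ Missing.Z Y) (proj₂ (proj₂ (proj₂ (choose l))) ≡.refl (ne ∘ ≡.sym)) (Missing.misses Y l))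

-- The glued cover and the ranks of T, Γ and G.

module StructureTheory where

  open SpanTheory using (Field)
  open CycleTheory
  open PeelingTheory
  open CycleRankTheory
  open ExtremalTheory
  open OffCycleTheory
  open RankBoundTheory
  open TightnessTheory
  open import Data.Empty using (⊥-elim-irr)
  open import Data.Irrelevant using () renaming ([_] to irr)
  open import Data.List.Base using ([_])
  open import Data.List.Properties using (filter-≐)
  open import Data.Nat.ListAction using () renaming (sum to sumℕ)
  open import Data.Nat.Solver using (module +-*-Solver)
  open import Data.Refinement.Base using (value; _,_)
  open import Data.Refinement.Properties using () renaming (_≟_ to ≟-refinement)
  import Data.Sum.Properties as Sum
  open import Relation.Binary.Definitions using (DecidableEquality)
  open import Relation.Nullary.Decidable using (dec-true; dec-false)

  shuffle : ∀ a s m → (a ℕ.+ s) ℕ.+ (suc m ℕ.+ suc m) ≡ (a ℕ.+ 2) ℕ.+ (s ℕ.+ (m ℕ.+ m))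
  shuffle = solve 3 (λ a s m → (a :+ s) :+ ((con 1 :+ m) :+ (con 1 :+ m)) := (a :+ con 2) :+ (s :+ (m :+ m))) ≡.refl
    where open +-*-Solver using (solve; _:+_; _:=_; con)

  module Structure (F : Field) {n : ℕ} (G : Graph (Fin n)) (E : WeightedGraph.Extremal F G) where
    open Tightness F G E public
    open DecMembership (Fin._≟_ {n}) using (_∈?_)
    open Peel PΓ using () renaming (pairs to L; inside to L-inside; triangular to L-triangular; ends⊆ to L-ends⊆; pairs-adj to L-adj)

    headOr : Fin n → List (Fin n) → Fin n
    headOr d []      = d
    headOr d (x ∷ _) = x

    headOr-∈ : ∀ {d x xs} → x ∈ xs → headOr d xs ∈ xs
    headOr-∈ {xs = _ ∷ _} _ = here ≡.refl

    headOr-default : ∀ {d d′ x xs} → x ∈ xs → headOr d xs ≡ headOr d′ xs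
    headOr-default {xs = _ ∷ _} _ = ≡.refl

    component : Fin n → List (Fin n)
    component u = filter (connΓ? u) (allFin n)

    -- The default is never returned, as `u` lies in its own component. The head of a sublist of
    -- `allFin n` depends on the component only.
    representative : Fin n → Fin n
    representative u = headOr u (component u)

    ∈-component : ∀ u → u ∈ component u
    ∈-component u = ∈-filter⁺ (connΓ? u) (∈-allFin u) ε

    representative-conn : ∀ u → ConnΓ (representative u) u
    representative-conn u = connΓ-sym (proj₂ (∈-filter⁻ (connΓ? u) {xs = allFin n} (headOr-∈ (∈-component u))))

    representative-cong : ∀ {u u′} → ConnΓ u u′ → representative u ≡ representative u′
    representative-cong {u} {u′} c = ≡.trans (headOr-default (∈-component u))
      (cong (headOr u′) (filter-≐ (connΓ? u) (connΓ? u′) ((connΓ-sym c ◅◅_) , (c ◅◅_)) (allFin n)))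

    -- The cover varies with the component because different components may attach to one cycle at
    -- different vertices, which a single transversal cannot all contain.
    Zᶜ : Fin n → List (Fin n)
    Zᶜ u = Missing.Z (attachments (representative u))

    Zᶜ-edge : ∀ {x y} → ¬ OnCycle x → ¬ OnCycle y → x ~ y → Zᶜ x ≡ Zᶜ y
    Zᶜ-edge ¬cx ¬cy e = cong (λ r → Missing.Z (attachments r)) (representative-cong ((e , ¬cx , ¬cy) ◅ ε))

    abstract
      inZᶜ? : ∀ u → Dec (u ∈ Zᶜ u)
      inZᶜ? u = u ∈? Zᶜ u

    chosen : Edge → Fin n
    chosen (x , y) = if does (inZᶜ? x) then x else y

    chosen-fst : ∀ {x y} → x ∈ Zᶜ x → chosen (x , y) ≡ x
    chosen-fst {x} {y} x∈ = cong (if_then x else y) (dec-true (inZᶜ? x) x∈)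

    chosen-snd : ∀ {x y} → x ∉ Zᶜ x → chosen (x , y) ≡ y
    chosen-snd {x} {y} x∉ = cong (if_then x else y) (dec-false (inZᶜ? x) x∉)

    -- Taking one end of each pair fixes the size at μ in advance; what remains is to see that
    -- nothing needed from the local covers is lost.
    K : List (Fin n)
    K = map chosen L

    length-K : length K ≡ μ
    length-K = length-map chosen L

    -- Off the cycles a tight cover contains only ends of `L`, and only one end of each pair, so a
    -- member of its local cover is the end chosen from its pair.
    ∈-K : ∀ {u} → ¬ OnCycle u → u ∈ Zᶜ u → u ∈ K
    ∈-K {u} ¬cu u∈ = at-end (∈-map⁻ proj₂ {xs = tri L} (Missing.Z-off-cycle (attachments (representative u)) u∈ ¬cu))
      where
      first : ∀ {y} → (u , y) ∈ L → u ∈ K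
      first m = subst (_∈ K) (chosen-fst u∈) (∈-map⁺ chosen m)
      second : ∀ {y} → (y , u) ∈ L → u ∈ K
      second {y} m = subst (_∈ K) (chosen-snd y∉) (∈-map⁺ chosen m)
        where
        ¬cy : ¬ OnCycle y
        ¬cy = ∈-W⁻ (proj₁ (All.lookup L-inside m))
        y∉ : y ∉ Zᶜ y
        y∉ y∈ = Missing.pair-one-end (attachments (representative u)) m
          (subst (y ∈_) (Zᶜ-edge ¬cy ¬cu (L-adj m)) y∈) u∈
      at-pair : ∀ {ρ s} → (ρ , s) ∈ tri L → u ≡ s → u ∈ K
      at-pair m ≡.refl = [ second , first ]′ (tri-∈ L m)
      at-end : (∃[ e ] e ∈ tri L × u ≡ proj₂ e) → u ∈ K
      at-end ((ρ , s) , m , eq) = at-pair m eq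

    -- Both ends of an edge of Γ consult the same local cover.
    K-covers : CoverΓ K
    K-covers {x} {y} ¬cx ¬cy e = Sum.map (∈-K ¬cx) (λ y∈ → ∈-K ¬cy (subst (y ∈_) (Zᶜ-edge ¬cx ¬cy e) y∈))
      (Missing.Z-covers (attachments (representative x)) e)

    K-small : length K ℕ.≤ μ
    K-small = ℕ.≤-reflexive length-K

    -- On its cycle `v` is the attachment of the component of `u`; the local cover misses `v` and
    -- must contain `u`.
    K-attached : ∀ {u v k} → ¬ OnCycle u → u ~ v → v ∈ O k → u ∈ K
    K-attached {u} {v} {k} ¬cu u~v v∈ = ∈-K ¬cu (Missing.neighbours (attachments (representative u)) k
      (subst (u ~_) (proj₂ (proj₂ (attachment (representative u) k)) v v∈ (u , u~v , ¬cu , representative-conn u)) u~v))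

    K-off-cycle : ∀ {u} → u ∈ K → ¬ OnCycle u
    K-off-cycle u∈ = ∈-W⁻ (L-ends⊆ (coverΓ-⊆-ends K-covers K-small u∈))

    toU : ∀ v → ¬ OnCycle v → U
    toU v ¬cv = v , irr λ (c , cyc , v∈) → ¬cv (cycle⇒onCycle cyc v∈)

    -- The membership proof stored in `U` is irrelevant, which still suffices to refute.
    fromU : (u : U) → ¬ OnCycle (value u)
    fromU (v , irr p) (k , v∈) = ⊥-elim-irr (p (O k , O-cycle k , v∈))

    _≟U_ : DecidableEquality U
    _≟U_ = ≟-refinement Fin._≟_

    restrict-list : ∀ {A : Set} (f : U → A) vs → All (¬_ ∘ OnCycle) vs → List A
    restrict-list f vs ps = All.reduce (λ {v} p → f (toU v p)) ps

    -- T and Γ have the same rank since both are covered by K and contain the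
    -- triangular system of L.
    module _ {I : Set} (_≟_ : DecidableEquality I) (embed : U → I) (M : I → I → Carrier)
             (M-off : ∀ u v → ¬ value u ~ value v → M (embed u) (embed v) ≈ 0#)
             (M-on  : ∀ u v → value u ~ value v → ¬ M (embed u) (embed v) ≈ 0#) where

      private
        OffPair : Edge → Set
        OffPair (x , y) = ¬ OnCycle x × ¬ OnCycle y

        embed-pairs : ∀ {es} → All OffPair es → List (I × I)
        embed-pairs = All.reduce (λ {e} (p , q) → embed (toU (proj₁ e) p) , embed (toU (proj₂ e) q))

        embed-triangular : ∀ {es} → Tri es → (ps : All OffPair es) → Triangular {M = M} (embed-pairs ps)
        embed-triangular [] [] = []
        embed-triangular ((r , ns) ∷ t) ((p , q) ∷ ps) = (M-on (toU _ p) (toU _ q) r , zeros ns ps) ∷ embed-triangular t ps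
          where
          zeros : ∀ {es} → All (λ e → ¬ _ ~ proj₂ e) es → (ps : All OffPair es) → All (λ e → M (embed (toU _ p)) (proj₂ e) ≈ 0#) (embed-pairs ps)
          zeros [] [] = []
          zeros (n ∷ ns) ((_ , q′) ∷ ps) = M-off (toU _ p) (toU _ q′) n ∷ zeros ns ps

        length-reduce : ∀ {A B : Set} {P : A → Set} (f : ∀ {x} → P x → B) {xs} (ps : All P xs) → length (All.reduce f ps) ≡ length xs
        length-reduce f []       = ≡.refl
        length-reduce f (p ∷ ps) = cong suc (length-reduce f ps)

        tri-off : All OffPair (tri L)
        tri-off = All.tabulate λ {e} m → select (tri-∈ L m)
          where
          select : ∀ {ρ s} → (ρ , s) ∈ L ⊎ (s , ρ) ∈ L → OffPair (ρ , s)
          select (inj₁ p) = ∈-W⁻ (proj₁ (All.lookup L-inside p)) , ∈-W⁻ (proj₂ (All.lookup L-inside p))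
          select (inj₂ p) = ∈-W⁻ (proj₂ (All.lookup L-inside p)) , ∈-W⁻ (proj₁ (All.lookup L-inside p))

        K-off : All (¬_ ∘ OnCycle) K
        K-off = All.tabulate K-off-cycle

      KI : List I
      KI = restrict-list embed K K-off

      private
        es : List (I × I)
        es = embed-pairs tri-off

        length-es : length (map proj₂ es) ≡ μ ℕ.+ μ
        length-es = ≡.trans (length-map proj₂ es) (≡.trans (length-reduce _ tri-off) (length-tri L))

      ∈-KI : ∀ u → value u ∈ K → embed u ∈ KI
      ∈-KI u m = go K-off m
        where
        go : ∀ {vs} (ps : All (¬_ ∘ OnCycle) vs) → value u ∈ vs → embed u ∈ restrict-list embed vs ps
        go (p ∷ ps) (here ≡.refl) = here ≡.refl
        go (p ∷ ps) (there m)     = there (go ps m)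

      covered-rank : (∀ i j → i ∉ KI → j ∉ KI → M i j ≈ 0#) → HasRank M (μ ℕ.+ μ)
      covered-rank cover = subst (HasRank M) length-es (mkHasRank (map proj₂ es) indep λ j →
        maximal-indep-spans us (All.map⁺ (All.universal (λ s → spans s) (map proj₂ es))) indep counts (spans j))
        where
        us : List (I → Carrier)
        us = map (δ _≟_) KI ++ map (col M) KI
        spans : ∀ j → Span us (col M j)
        spans = cover-spans _≟_ M KI cover
        indep : ¬ Dep (map (col M) (map proj₂ es))
        indep = triangular⇒¬dep (embed-triangular L-triangular tri-off)
        length-KI : length KI ≡ μ
        length-KI = ≡.trans (length-reduce _ K-off) length-K
        counts : length us ℕ.≤ length (map (col M) (map proj₂ es))
        counts = ℕ.≤-reflexive (≡.trans
          (≡.trans (length-++ (map (δ _≟_) KI)) (≡.cong₂ ℕ._+_ (≡.trans (length-map _ KI) length-KI) (≡.trans (length-map _ KI) length-KI)))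
          (≡.sym (≡.trans (length-map _ (map proj₂ es)) length-es)))

    adjacency : ∀ {V : Set} → Graph V → V → V → Carrier
    adjacency H u v = if does (Graph._~?_ H u v) then 1# else 0#

    adjacency-off : ∀ {V} (H : Graph V) {u v} → ¬ Graph._~_ H u v → adjacency H u v ≈ 0#
    adjacency-off H {u} {v} ≁ with Graph._~?_ H u v
    ... | yes e = contradiction e ≁
    ... | no _  = refl

    adjacency-on : ∀ {V} (H : Graph V) {u v} → Graph._~_ H u v → adjacency H u v ≈ 1#
    adjacency-on H {u} {v} e with Graph._~?_ H u v
    ... | yes _ = refl
    ... | no ≁  = contradiction e ≁

    rank-Γ : HasRank (adjacency Γ) (μ ℕ.+ μ)
    rank-Γ = covered-rank _≟U_ id (adjacency Γ)
      (λ u v → adjacency-off Γ {u} {v}) (λ u v e z → 1≉0 (trans (sym (adjacency-on Γ {u} {v} e)) z))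
      λ u v u∉ v∉ → adjacency-off Γ {u} {v} λ e →
        [ u∉ ∘ in-K u , v∉ ∘ in-K v ]′ (K-covers (fromU u) (fromU v) e)
      where
      in-K = ∈-KI _≟U_ id (adjacency Γ)
        (λ u v → adjacency-off Γ {u} {v}) (λ u v e z → 1≉0 (trans (sym (adjacency-on Γ {u} {v} e)) z))

    InK : U ⊎ C → Set
    InK (inj₁ u) = value u ∈ K
    InK (inj₂ _) = ⊥

    cycle-neighbour-in-K : ∀ u k → Any (value u ~_) (O k) → value u ∈ K
    cycle-neighbour-in-K u k a = let (v , v∈ , e) = find a in K-attached (fromU u) e v∈

    -- Contracted cycles are never adjacent to each other, and their other neighbours are attached
    -- vertices, so `K` needs no member among them.
    K-covers-T : ∀ i j → Adj i j → InK i ⊎ InK j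
    K-covers-T (inj₁ u) (inj₁ v) e = K-covers (fromU u) (fromU v) e
    K-covers-T (inj₁ u) (inj₂ k) a = inj₁ (cycle-neighbour-in-K u k a)
    K-covers-T (inj₂ k) (inj₁ u) a = inj₂ (cycle-neighbour-in-K u k a)
    K-covers-T (inj₂ k) (inj₂ l) (k≢l , a) = contradiction
      (let (v , v∈ , b) = find a ; (w , w∈ , e) = find b in no-edges-between-cycles {k} {l} v∈ w∈ e) k≢l

    rank-T : HasRank (adjacency T) (μ ℕ.+ μ)
    rank-T = covered-rank _≟T_ inj₁ (adjacency T) T-off T-on
      λ i j i∉ j∉ → adjacency-off T {i} {j} λ e → [ i∉ ∘ in-K i , j∉ ∘ in-K j ]′ (K-covers-T i j e)
      where
      _≟T_ : DecidableEquality (U ⊎ C)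
      _≟T_ = Sum.≡-dec _≟U_ Fin._≟_
      T-off : ∀ u v → ¬ value u ~ value v → adjacency T (inj₁ u) (inj₁ v) ≈ 0#
      T-off u v = adjacency-off T {inj₁ u} {inj₁ v}
      T-on : ∀ u v → value u ~ value v → ¬ adjacency T (inj₁ u) (inj₁ v) ≈ 0#
      T-on u v e z = 1≉0 (trans (sym (adjacency-on T {inj₁ u} {inj₁ v} e)) z)
      in-K : ∀ i → InK i → i ∈ KI _≟T_ inj₁ (adjacency T) T-off T-on
      in-K (inj₁ u) m = ∈-KI _≟T_ inj₁ (adjacency T) T-off T-on u m

    -- Here |Q| is the total length of the cycles, and the difference of 2 per cycle between r(Φ)
    -- and r(G) lowers each length by 2.
    rank-G : rG ≡ (μ ℕ.+ μ) ℕ.+ sumℕ (map (λ c → length c ℕ.∸ 2) 𝒞)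
    rank-G = ℕ.+-cancelʳ-≡ (#𝒞 ℕ.+ #𝒞) _ _ (≡.trans (≡.sym rank-difference) (≡.trans rank-exact′
      (≡.trans (cong ((μ ℕ.+ μ) ℕ.+_) (≡.sym (lengths 𝒞 (All.tabulate λ m → cycle-length m)))) (≡.sym (ℕ.+-assoc (μ ℕ.+ μ) _ _)))))
      where
      rank-exact′ : rΦ ≡ (μ ℕ.+ μ) ℕ.+ length Q
      rank-exact′ = TightCover.rank-exact record { pick = proj₁ ∘ O-inhabited ; pick-∈ = proj₂ ∘ O-inhabited }
      cycle-length : ∀ {c} → c ∈ 𝒞 → 2 ℕ.≤ length c
      cycle-length m = subst (λ c → 2 ℕ.≤ length c) (≡.sym (Any.lookup-index m)) (ℕ.<⇒≤ (proj₁ (O-cycle (Any.index m))))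
      lengths : ∀ cs → All (λ c → 2 ℕ.≤ length c) cs →
        sumℕ (map (λ c → length c ℕ.∸ 2) cs) ℕ.+ (length cs ℕ.+ length cs) ≡ length (concat cs)
      lengths [] [] = ≡.refl
      lengths (c ∷ cs) (p ∷ ps) = ≡.trans (shuffle (length c ℕ.∸ 2) (sumℕ (map (λ c → length c ℕ.∸ 2) cs)) (length cs))
        (≡.trans (≡.cong₂ ℕ._+_ (ℕ.m∸n+n≡m p) (lengths cs ps)) (≡.sym (length-++ c)))

-- Lengths and gains of the cycles.

module CycleTypeTheory where

  open SpanTheory using (Field)
  open CycleTheory
  open PeelingTheory
  open CycleRankTheory
  open ExtremalTheory
  open OffCycleTheory
  open RankBoundTheory
  open TightnessTheory
  open StructureTheory
  import Algebra.Bundles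
  import Algebra.Definitions.RawSemiring as RawSemiringDefs
  open import Data.Bool.Base using (Bool; not)
  open import Data.Bool.Properties using (not-involutive; not-¬)
  open import Data.Empty using (⊥-elim)
  open import Data.List.Base using ([_]; foldr)
  open import Data.List.Properties using (map-++)
  open import Data.Unit.Base using (⊤; tt)
  open import Relation.Nullary.Decidable using (dec-true; dec-false)

  not^ : ℕ → Bool → Bool
  not^ zero    b = b
  not^ (suc k) b = not^ k (not b)

  not^-fixed : ∀ k {b} → not^ k b ≡ b → ∃[ h ] k ≡ h ℕ.+ h
  not^-fixed zero          _  = zero , ≡.refl
  not^-fixed (suc zero) {b} eq = contradiction (≡.sym eq) (not-¬ ≡.refl)
  not^-fixed (suc (suc k)) {b} eq with not^-fixed k (≡.trans (cong (not^ k) (≡.sym (not-involutive b))) eq)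
  ... | h , ≡.refl = suc h , cong suc (≡.sym (ℕ.+-suc h h))

  even-or-odd : ∀ k → ∃[ h ] (k ≡ h ℕ.+ h ⊎ k ≡ suc (h ℕ.+ h))
  even-or-odd zero = zero , inj₁ ≡.refl
  even-or-odd (suc k) with even-or-odd k
  ... | h , inj₁ eq = h , inj₂ (cong suc eq)
  ... | h , inj₂ eq = suc h , inj₁ (≡.trans (cong suc eq) (cong suc (≡.sym (ℕ.+-suc h h))))

  lastOf : ∀ {A : Set} → A → List A → A
  lastOf p []       = p
  lastOf p (q ∷ ws) = lastOf q ws

  module _ {A : Set} where

    steps′-last : ∀ p ws (e : A) → (lastOf p ws , e) ∈ steps′ p ws e
    steps′-last p []       e = here ≡.refl
    steps′-last p (q ∷ ws) e = there (steps′-last q ws e)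

    steps′-alternating : (f : A → Bool) → ∀ v vs {e} → (∀ {a b} → (a , b) ∈ steps′ v vs e → f b ≡ not (f a)) →
      f e ≡ not^ (length (v ∷ vs)) (f v)
    steps′-alternating f v []       alt = alt (here ≡.refl)
    steps′-alternating f v (w ∷ vs) alt = ≡.trans (steps′-alternating f w vs (alt ∘ there))
      (cong (not^ (suc (length vs))) (alt (here ≡.refl)))

    steps′-functional : ∀ v vs {e x y y′ : A} → Unique (v ∷ vs) →
      (x , y) ∈ steps′ v vs e → (x , y′) ∈ steps′ v vs e → y ≡ y′
    steps′-functional v []       _ (here ≡.refl) (here ≡.refl) = ≡.refl
    steps′-functional v (w ∷ vs) _ (here ≡.refl) (here ≡.refl) = ≡.refl
    steps′-functional v (w ∷ vs) u (here ≡.refl) (there m) = contradiction (steps′-source w vs m) (Unique⇒∉ u)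
    steps′-functional v (w ∷ vs) u (there m) (here ≡.refl) = contradiction (steps′-source w vs m) (Unique⇒∉ u)
    steps′-functional v (w ∷ vs) (_ ∷ u) (there m) (there m′) = steps′-functional w vs u m m′

    steps′-injective : ∀ v vs {e x x′ y : A} → Unique (vs ∷ʳ e) →
      (x , y) ∈ steps′ v vs e → (x′ , y) ∈ steps′ v vs e → x ≡ x′
    steps′-injective v []       _ (here ≡.refl) (here ≡.refl) = ≡.refl
    steps′-injective v (w ∷ vs) _ (here ≡.refl) (here ≡.refl) = ≡.refl
    steps′-injective v (w ∷ vs) u (here ≡.refl) (there m) = contradiction (steps′-target w vs m) (Unique⇒∉ u)
    steps′-injective v (w ∷ vs) u (there m) (here ≡.refl) = contradiction (steps′-target w vs m) (Unique⇒∉ u)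
    steps′-injective v (w ∷ vs) (_ ∷ u) (there m) (there m′) = steps′-injective w vs u m m′

  module CycleTypes (F : Field) {n : ℕ} (G : Graph (Fin n)) (E : WeightedGraph.Extremal F G) where
    open Structure F G E public
    open DecMembership (Fin._≟_ {n}) using (_∈?_)
    open RawSemiringDefs (Algebra.Bundles.Semiring.rawSemiring semiring) public using (_^_)

    -1²≈1 : - 1# * - 1# ≈ 1#
    -1²≈1 = begin
      - 1# * - 1#                 ≈⟨ solve 1 (λ m → m :* m := m :* m :+ con 0) refl (- 1#) ⟩
      - 1# * - 1# + 0#            ≈⟨ +-congˡ (-‿inverseˡ 1#) ⟨
      - 1# * - 1# + (- 1# + 1#)   ≈⟨ solve 1 (λ m → m :* m :+ (m :+ con 1) := m :* (m :+ con 1) :+ con 1) refl (- 1#) ⟩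
      - 1# * (- 1# + 1#) + 1#     ≈⟨ +-congʳ (trans (*-congˡ (-‿inverseˡ 1#)) (zeroʳ _)) ⟩
      0# + 1#                     ≈⟨ +-identityˡ 1# ⟩
      1# ∎

    sign² : ∀ k → (- 1#) ^ k * (- 1#) ^ k ≈ 1#
    sign² zero    = *-identityˡ 1#
    sign² (suc k) = trans (solve 2 (λ m s → m :* s :* (m :* s) := (m :* m) :* (s :* s)) refl (- 1#) ((- 1#) ^ k))
      (trans (*-cong -1²≈1 (sign² k)) (*-identityˡ 1#))

    sign-even : ∀ h → (- 1#) ^ (h ℕ.+ h) ≈ 1#
    sign-even zero    = refl
    sign-even (suc h) = trans (*-congˡ (reflexive (cong ((- 1#) ^_) (ℕ.+-suc h h))))
      (trans (sym (*-assoc (- 1#) (- 1#) _)) (trans (*-cong -1²≈1 (sign-even h)) (*-identityˡ 1#)))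

    -- Membership in `Z` flips at every step and is restored after a full turn.
    alternating-cover-even : ∀ Z c → (∀ {a b} → (a , b) ∈ steps c → a ∈ Z → b ∉ Z) →
      (∀ {a b} → (a , b) ∈ steps c → a ∈ Z ⊎ b ∈ Z) → ∃[ h ] length c ≡ h ℕ.+ h
    alternating-cover-even Z []       one-end covers = zero , ≡.refl
    alternating-cover-even Z (v ∷ vs) one-end covers =
      not^-fixed (length (v ∷ vs)) (≡.sym (steps′-alternating (λ v → does (v ∈? Z)) v vs λ {a} {b} m → alternates a b m (a ∈? Z)))
      where
      alternates : ∀ a b → (a , b) ∈ steps (v ∷ vs) → Dec (a ∈ Z) → does (b ∈? Z) ≡ not (does (a ∈? Z))
      alternates a b m (yes a∈) = ≡.trans (dec-false (b ∈? Z) (one-end m a∈)) (cong not (≡.sym (dec-true (a ∈? Z) a∈)))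
      alternates a b m (no a∉)  = ≡.trans (dec-true (b ∈? Z) ([ (λ a∈ → contradiction a∈ a∉) , id ]′ (covers m)))
        (cong not (≡.sym (dec-false (a ∈? Z) a∉)))

    module _ (M : Fin n → Fin n → Carrier) where

      pathGain : Fin n → List (Fin n) → Carrier
      pathGain p []       = 1#
      pathGain p (q ∷ ws) = M p q * pathGain q ws

      stepGain : List Edge → Carrier
      stepGain es = foldr _*_ 1# (map (λ (u , v) → M u v) es)

      stepGain-path : ∀ p ws e → stepGain (steps′ p ws e) ≈ pathGain p ws * M (lastOf p ws) e
      stepGain-path p []       e = *-comm _ _
      stepGain-path p (q ∷ ws) e = trans (*-congˡ (stepGain-path q ws e)) (sym (*-assoc _ _ _))

      -- The kernel equations at every second vertex of a path, each with the unit relation that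
      -- allows it to be solved for the value two steps back.
      AlternateRows : (Fin n → Carrier) → Fin n → List (Fin n) → Set
      AlternateRows z p (q ∷ r ∷ ws) =
        M p q * M q p ≈ 1# × M q p * z p + M q r * z r ≈ 0# × AlternateRows z r ws
      AlternateRows z p _ = ⊤

      -- Multiplying the row at `q` by `M p q` gives z p as minus the product of two gains times z
      -- r, so every two steps add one sign.
      propagate : ∀ k z p ws → length ws ≡ k ℕ.+ k → AlternateRows z p ws →
        z p ≈ (- 1#) ^ k * (pathGain p ws * z (lastOf p ws))
      propagate zero    z p [] _ _ = sym (trans (*-identityˡ _) (*-identityˡ _))
      propagate (suc k) z p (q ∷ []) len _ = contradiction (≡.trans (ℕ.suc-injective len) (ℕ.+-suc k k)) λ ()
      propagate (suc k) z p (q ∷ r ∷ ws) len (u , eq , rows) = begin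
        z p
          ≈⟨ solve 2 (λ x y → x := con 1 :* x :+ con 0 :* y) refl (z p) (M p q * (M q r * z r)) ⟩
        1# * z p + 0# * (M p q * (M q r * z r))
          ≈⟨ +-cong (*-congʳ (sym u)) (*-congʳ (sym (-‿inverseʳ 1#))) ⟩
        M p q * M q p * z p + (1# + - 1#) * (M p q * (M q r * z r))
          ≈⟨ solve 6 (λ a b c m x y → a :* b :* x :+ (con 1 :+ m) :* (a :* (c :* y))
                := a :* (b :* x :+ c :* y) :+ m :* (a :* (c :* y))) refl (M p q) (M q p) (M q r) (- 1#) (z p) (z r) ⟩
        M p q * (M q p * z p + M q r * z r) + - 1# * (M p q * (M q r * z r))
          ≈⟨ +-cong (trans (*-congˡ eq) (zeroʳ _)) (*-congˡ (*-congˡ (*-congˡ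
               (propagate k z r ws (ℕ.suc-injective (≡.trans (ℕ.suc-injective len) (ℕ.+-suc k k))) rows)))) ⟩
        0# + - 1# * (M p q * (M q r * ((- 1#) ^ k * (pathGain r ws * z (lastOf r ws)))))
          ≈⟨ solve 6 (λ m a b s g y → con 0 :+ m :* (a :* (b :* (s :* (g :* y)))) := m :* s :* (a :* (b :* g) :* y))
               refl (- 1#) (M p q) (M q r) ((- 1#) ^ k) (pathGain r ws) (z (lastOf r ws)) ⟩
        (- 1#) ^ suc k * (pathGain p (q ∷ r ∷ ws) * z (lastOf r ws)) ∎

    non-cover-neighbours : ∀ i j → ¬ OnCycle i → i ∉ K → i ~ j → j ∈ K
    non-cover-neighbours i j ¬ci i∉K e = cases (onCycle? j)
      where
      cases : Dec (OnCycle j) → j ∈ K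
      cases (yes (k , j∈)) = contradiction (K-attached ¬ci e j∈) i∉K
      cases (no ¬cj)       = [ (λ i∈K → contradiction i∈K i∉K) , id ]′ (K-covers ¬ci ¬cj e)

    module _ {c : List (Fin n)} (cyc : IsCycle c) {k : C} (same : SameCycle (O k) c) where

      ∈-O : ∀ {v} → v ∈ c → v ∈ O k
      ∈-O = sameCycle-∈ c (O k) (sameCycle-sym (O k) c same)

      steps-functional : ∀ {x y y′} → (x , y) ∈ steps c → (x , y′) ∈ steps c → y ≡ y′
      steps-functional = go c (proj₁ (proj₂ cyc))
        where
        go : ∀ c → Unique c → ∀ {x y y′} → (x , y) ∈ steps c → (x , y′) ∈ steps c → y ≡ y′
        go (v ∷ vs) u = steps′-functional v vs u

      steps-injective : ∀ {x x′ y} → (x , y) ∈ steps c → (x′ , y) ∈ steps c → x ≡ x′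
      steps-injective = go c (proj₁ (proj₂ cyc))
        where
        go : ∀ c → Unique c → ∀ {x x′ y} → (x , y) ∈ steps c → (x′ , y) ∈ steps c → x ≡ x′
        go (v ∷ vs) u = steps′-injective v vs (Unique-resp-↭ (Perm.∷↭∷ʳ v vs) u)

      no-return : ∀ {a b} → (a , b) ∈ steps c → (b , a) ∉ steps c
      no-return {a} {b} ab ba = go (steps-open cyc ab)
        where
        go : (∃[ ws ] IsCycle (b ∷ ws ∷ʳ a) × steps (b ∷ ws ∷ʳ a) ↭ steps c) → ⊥
        go ([] , (s≤s (s≤s ()) , _) , _)
        go (w ∷ ws , (_ , _ ∷ w∉ ∷ _ , _) , perm) =
          All.lookup w∉ (∈-++⁺ʳ ws (here ≡.refl)) (steps-functional (Perm.∈-resp-↭ perm (here ≡.refl)) ba)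

      even-length : ∃[ h ] length c ≡ h ℕ.+ h
      even-length = alternating-cover-even Z c one-end (λ m → Z-covers (orientedEdges-adj cyc (∈-++⁺ˡ m)))
        where
        Y : Transversal
        Y = record { pick = proj₁ ∘ O-inhabited ; pick-∈ = proj₂ ∘ O-inhabited }
        open TightCover Y using (Z; Z-covers; step-one-end)
        -- The given cycle may run in the direction opposite to `O k`.
        one-end : ∀ {a b} → (a , b) ∈ steps c → a ∈ Z → b ∉ Z
        one-end {a} {b} m = cases (orientedEdges-steps (O k) (proj₂ same (∈-++⁺ˡ m)))
          where
          cases : (a , b) ∈ steps (O k) ⊎ (b , a) ∈ steps (O k) → a ∈ Z → b ∉ Z
          cases (inj₁ p)       = step-one-end {k} p
          cases (inj₂ p) a∈ b∈ = step-one-end {k} p b∈ a∈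

      module _ {M : Fin n → Fin n → Carrier} (wM : Weighted M) (z : Fin n → Carrier)
               (vanish : ∀ {s} → s ∈ K → z s ≈ 0#) where

        -- Other neighbours of `b` contribute nothing: off the cycles they belong to `K`, where `z`
        -- is 0, and on a cycle they would be joined to `b` by a chord or by an edge between two
        -- cycles.
        cycle-row : ∀ {a b d} → (a , b) ∈ steps c → (b , d) ∈ steps c →
          (M ∙ z) b ≈ M b a * z a + M b d * z d
        cycle-row {a} {b} {d} ab bd = sum-pair _ a d (λ { ≡.refl → no-return ab bd })
          λ j j≢a j≢d → other j j≢a j≢d (b ~? j) (onCycle? j)
          where
          b∈ : b ∈ O k
          b∈ = ∈-O (step-source c bd)
          other : ∀ j → j ≢ a → j ≢ d → Dec (b ~ j) → Dec (OnCycle j) → M b j * z j ≈ 0#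
          other j _ _ (no ≁) _ = trans (*-congʳ (off wM ≁)) (zeroˡ _)
          other j _ _ (yes e) (no ¬cj) = trans (*-congˡ (vanish (K-attached ¬cj (sym-~ e) b∈))) (zeroʳ _)
          other j j≢a j≢d (yes e) (yes (l , j∈)) = ⊥-elim (on-step (orientedEdges-steps c in-cycle))
            where
            in-cycle : (b , j) ∈ orientedEdges c
            in-cycle = proj₁ same (no-chords {k} b∈
              (subst (λ l → j ∈ O l) (≡.sym (no-edges-between-cycles {k} {l} b∈ j∈ e)) j∈) e)
            on-step : (b , j) ∈ steps c ⊎ (j , b) ∈ steps c → ⊥
            on-step (inj₁ p) = j≢d (steps-functional p bd)
            on-step (inj₂ p) = j≢a (steps-injective p ab)

    module _ {x₀ x₁ ws} (cyc : IsCycle (x₀ ∷ x₁ ∷ ws)) {k : C} (same : SameCycle (O k) (x₀ ∷ x₁ ∷ ws))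
             {M : Fin n → Fin n → Carrier} (wM : Weighted M) (z : Fin n → Carrier)
             (vanish : ∀ {s} → s ∈ K → z s ≈ 0#)
             (kernel : ∀ i → i ≢ x₀ → OnCycle i → (M ∙ z) i ≈ 0#) {h} (even : length ws ≡ h ℕ.+ h) where
      private
        c : List (Fin n)
        c = x₀ ∷ x₁ ∷ ws
        l : Fin n
        l = lastOf x₁ ws

        x₀∉ : x₀ ∉ x₁ ∷ ws
        x₀∉ = Unique⇒∉ (proj₁ (proj₂ cyc))

        rows : ∀ p vs → (∀ {e} → e ∈ steps′ p vs x₀ → e ∈ steps c) → x₀ ∉ vs → AlternateRows M z p vs
        rows p []           _   _   = tt
        rows p (q ∷ [])     _   _   = tt
        rows p (q ∷ r ∷ vs) sub x₀∉ =
            inv wM (orientedEdges-adj {c} cyc (∈-++⁺ˡ (sub (here ≡.refl))))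
          , trans (sym (cycle-row {c} cyc {k} same wM z vanish (sub (here ≡.refl)) (sub (there (here ≡.refl)))))
              (kernel q (λ { ≡.refl → x₀∉ (here ≡.refl) })
                (k , ∈-O {c} cyc {k} same (step-target c (sub (here ≡.refl)))))
          , rows r vs (sub ∘ there ∘ there) (x₀∉ ∘ there ∘ there)

      -- The rows at alternate vertices carry z x₁ round to z l without using the row at `x₀`. The
      -- factor `M l x₀ * M x₀ l`, equal to 1, is inserted to complete the path gain to the gain of
      -- the cycle.
      cycle-equation : (M ∙ z) x₀ ≈ M x₀ l * z l + (- 1#) ^ h * (stepGain M (steps c) * (M x₀ l * z l))
      cycle-equation = begin
        (M ∙ z) x₀
          ≈⟨ cycle-row {c} cyc {k} same wM z vanish (there (steps′-last x₁ ws x₀)) (here ≡.refl) ⟩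
        M x₀ l * z l + M x₀ x₁ * z x₁
          ≈⟨ +-congˡ (*-congˡ (propagate M h z x₁ ws even (rows x₁ ws there (x₀∉ ∘ there)))) ⟩
        M x₀ l * z l + M x₀ x₁ * ((- 1#) ^ h * (pathGain M x₁ ws * z l))
          ≈⟨ +-congˡ (solve 4 (λ a s g y → a :* (s :* (g :* y)) := s :* (a :* g :* (con 1 :* y)))
               refl (M x₀ x₁) ((- 1#) ^ h) (pathGain M x₁ ws) (z l)) ⟩
        M x₀ l * z l + (- 1#) ^ h * (M x₀ x₁ * pathGain M x₁ ws * (1# * z l))
          ≈⟨ +-congˡ (*-congˡ (*-congˡ (*-congʳ (sym (inv wM
               (orientedEdges-adj {c} cyc (∈-++⁺ˡ (there (steps′-last x₁ ws x₀))))))))) ⟩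
        M x₀ l * z l + (- 1#) ^ h * (M x₀ x₁ * pathGain M x₁ ws * (M l x₀ * M x₀ l * z l))
          ≈⟨ +-congˡ (*-congˡ (solve 5 (λ a g b d y → a :* g :* (b :* d :* y) := a :* (g :* b) :* (d :* y))
               refl (M x₀ x₁) (pathGain M x₁ ws) (M l x₀) (M x₀ l) (z l))) ⟩
        M x₀ l * z l + (- 1#) ^ h * (M x₀ x₁ * (pathGain M x₁ ws * M l x₀) * (M x₀ l * z l))
          ≈⟨ +-congˡ (*-congˡ (*-congʳ (*-congˡ (stepGain-path M x₁ ws x₀)))) ⟨
        M x₀ l * z l + (- 1#) ^ h * (stepGain M (steps c) * (M x₀ l * z l)) ∎

    through : ∀ {k v} → v ∈ O k → ∃[ Y ] Transversal.pick Y k ≡ v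
    through {k} {v} v∈ = record { pick = λ j → proj₁ (choose j) ; pick-∈ = λ j → proj₁ (proj₂ (choose j)) }
        , proj₂ (proj₂ (choose k)) ≡.refl
      where
      choose : ∀ j → ∃[ x ] x ∈ O j × (j ≡ k → x ≡ v)
      choose j = cases (j Fin.≟ k)
        where
        cases : Dec (j ≡ k) → ∃[ x ] x ∈ O j × (j ≡ k → x ≡ v)
        cases (yes ≡.refl) = v , v∈ , λ _ → ≡.refl
        cases (no ne)      = proj₁ (O-inhabited j) , proj₂ (O-inhabited j) , λ eq → contradiction eq ne

    stepGain-one : ∀ es → All (λ (u , v) → u ~ v) es → stepGain A es ≈ 1#
    stepGain-one []       []       = refl
    stepGain-one (e ∷ es) (p ∷ ps) = trans (*-cong (A-one p) (stepGain-one es ps)) (*-identityˡ 1#)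

    -- For a kernel vector of G with value 1 at `l` the cycle equation reads 0 = 1 + (-1)^h. An even
    -- h would give 1 + 1 = 0. The cycle itself has length 2h + 2.
    half-length-odd : ∀ {x₀ x₁ ws} → IsCycle (x₀ ∷ x₁ ∷ ws) → ∀ {h} → length ws ≡ h ℕ.+ h → ∃[ m ] h ≡ suc (m ℕ.+ m)
    half-length-odd {x₀} {x₁} {ws} cyc {h} even = at-index (O-complete cyc)
      where
      c : List (Fin n)
      c = x₀ ∷ x₁ ∷ ws
      l : Fin n
      l = lastOf x₁ ws
      last-step : (l , x₀) ∈ steps c
      last-step = there (steps′-last x₁ ws x₀)
      at-index : (∃[ k ] SameCycle (O k) c) → ∃[ m ] h ≡ suc (m ℕ.+ m)
      at-index (k , same) = at-transversal (through (∈-O {c} cyc {k} same (step-source c last-step)))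
        where
        at-transversal : (∃[ Y ] Transversal.pick Y k ≡ l) → ∃[ m ] h ≡ suc (m ℕ.+ m)
        at-transversal (Y , pick≡) = at-kernel (kernel-vector Y k)
          where
          at-kernel : (∃[ z ] (∀ i → (A ∙ z) i ≈ 0#) × z (Transversal.pick Y k) ≈ 1# × (∀ l → l ≢ k → z (Transversal.pick Y l) ≈ 0#)) →
            ∃[ m ] h ≡ suc (m ℕ.+ m)
          at-kernel (z , ker , one , _) = parity (even-or-odd h)
            where
            vanish : ∀ {s} → s ∈ K → z s ≈ 0#
            vanish = kernel-vanishes-on-cover K-covers K-small wA z (λ i _ _ → ker i)
              (λ i j ¬ci i∉K e → inj₁ (non-cover-neighbours i j ¬ci i∉K e))
            s≈1 : A x₀ l * z l ≈ 1#
            s≈1 = trans (*-cong (A-one (sym-~ (orientedEdges-adj {c} cyc (∈-++⁺ˡ last-step))))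
              (trans (reflexive (cong z (≡.sym pick≡))) one)) (*-identityˡ 1#)
            equation : 0# ≈ 1# + (- 1#) ^ h
            equation = trans (sym (ker x₀)) (trans
              (cycle-equation cyc {k} same wA z vanish (λ i _ _ → ker i) {h} even)
              (+-cong s≈1 (trans (*-congˡ (trans (*-cong (stepGain-one (steps c) (proj₂ (proj₂ cyc))) s≈1) (*-identityˡ 1#))) (*-identityʳ _))))
            parity : (∃[ m ] (h ≡ m ℕ.+ m ⊎ h ≡ suc (m ℕ.+ m))) → ∃[ m ] h ≡ suc (m ℕ.+ m)
            parity (m , inj₂ eq) = m , eq
            parity (m , inj₁ eq) = contradiction (sym (trans equation (+-congˡ
              (trans (reflexive (cong ((- 1#) ^_) eq)) (sign-even m))))) 2≉0

    -- The 2μ + |Q| vectors unit K, col K, unit Q span all columns of Φ, so they lie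
    -- in its column space.
    unit-vector-reached : ∀ {x} → OnCycle x → ∃[ z ] (∀ i → δ Fin._≟_ x i ≈ (Φ ∙ z) i)
    unit-vector-reached {x} cx = reach (large-rank-spans RΦ us spans (ℕ.≤-reflexive count)
        (span-++ˡ (span-++ʳ (map δ′ K) (span-∈ (∈-map⁺ δ′ (∈-Q⁺ cx))))))
      where
      δ′ = δ Fin._≟_
      us : List (Fin n → Carrier)
      us = (map δ′ K ++ map δ′ Q) ++ map (col Φ) K
      spans : ∀ j → Span us (col Φ j)
      spans j = cases (j ∈? K) (onCycle? j)
        where
        supported : (∀ i → i ∉ K ++ Q → Φ i j ≈ 0#) → Span us (col Φ j)
        supported p = span-++ˡ (subst (λ vs → Span vs (col Φ j)) (map-++ δ′ K Q) (supported⇒span Fin._≟_ (K ++ Q) (col Φ j) p))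
        cases : Dec (j ∈ K) → Dec (OnCycle j) → Span us (col Φ j)
        cases (yes j∈) _        = span-++ʳ (map δ′ K ++ map δ′ Q) (span-∈ (∈-map⁺ (col Φ) j∈))
        cases (no j∉) (yes (k , j∈)) = supported λ i i∉ → off wΦ λ e → i∉ (neighbour i e (onCycle? i))
          where
          neighbour : ∀ i → i ~ j → Dec (OnCycle i) → i ∈ K ++ Q
          neighbour i e (yes ci) = ∈-++⁺ʳ K (∈-Q⁺ ci)
          neighbour i e (no ¬ci) = ∈-++⁺ˡ (K-attached ¬ci e j∈)
        cases (no j∉) (no ¬cj) = supported λ i i∉ → off wΦ λ e →
          i∉ (∈-++⁺ˡ (non-cover-neighbours j i ¬cj j∉ (sym-~ e)))
      count : length us ≡ rΦ
      count = ≡.trans (length-++ (map δ′ K ++ map δ′ Q)) (≡.trans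
        (≡.cong₂ ℕ._+_ (≡.trans (length-++ (map δ′ K)) (≡.cong₂ ℕ._+_ (≡.trans (length-map δ′ K) length-K) (length-map δ′ Q)))
          (≡.trans (length-map (col Φ) K) length-K))
        (≡.trans (ℕ.+-assoc μ (length Q) μ) (≡.trans (cong (μ ℕ.+_) (ℕ.+-comm (length Q) μ))
          (≡.trans (≡.sym (ℕ.+-assoc μ μ (length Q)))
            (≡.sym (TightCover.rank-exact record { pick = proj₁ ∘ O-inhabited ; pick-∈ = proj₂ ∘ O-inhabited }))))))
      reach : (∃[ S ] Span (map (col Φ) S) (δ′ x)) → ∃[ z ] (∀ i → δ′ x i ≈ (Φ ∙ z) i)
      reach (S , s) = let (z , eq , _) = span⇒combination Φ S s in z , eq

    -- A preimage of the unit vector at `x₀` satisfies the kernel equations at all other vertices,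
    -- so the cycle equation holds with left side 1; with the critical gain its two terms on the
    -- right cancel.
    gain-not-critical : ∀ {x₀ x₁ ws} → IsCycle (x₀ ∷ x₁ ∷ ws) → ∀ {h} → length ws ≡ h ℕ.+ h →
      ¬ (stepGain Φ (steps (x₀ ∷ x₁ ∷ ws)) ≈ (- 1#) ^ suc h)
    gain-not-critical {x₀} {x₁} {ws} cyc {h} even critical = at-index (O-complete cyc)
      where
      c : List (Fin n)
      c = x₀ ∷ x₁ ∷ ws
      l : Fin n
      l = lastOf x₁ ws
      at-index : (∃[ k ] SameCycle (O k) c) → ⊥
      at-index (k , same) = at-preimage (unit-vector-reached cx)
        where
        cx : OnCycle x₀
        cx = k , ∈-O {c} cyc {k} same (here ≡.refl)
        at-preimage : (∃[ z ] (∀ i → δ Fin._≟_ x₀ i ≈ (Φ ∙ z) i)) → ⊥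
        at-preimage (z , eq) = 1≉0 (begin
          1#                                              ≈⟨ at-x₀ ⟨
          δ Fin._≟_ x₀ x₀                                 ≈⟨ eq x₀ ⟩
          (Φ ∙ z) x₀                                      ≈⟨ cycle-equation cyc {k} same wΦ z vanish (λ i i≢ _ → zero-row i i≢) {h} even ⟩
          s + σ * (stepGain Φ (steps c) * s)              ≈⟨ +-congˡ (*-congˡ (*-congʳ critical)) ⟩
          s + σ * (- 1# * σ * s)                          ≈⟨ solve 3 (λ s t m → s :+ t :* (m :* t :* s) := m :* ((t :* t) :* s) :+ s) refl s σ (- 1#) ⟩
          - 1# * (σ * σ * s) + s                          ≈⟨ +-congʳ (*-congˡ (trans (*-congʳ (sign² h)) (*-identityˡ s))) ⟩
          - 1# * s + s                                    ≈⟨ -1*x+x≈0 Φ s ⟩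
          0# ∎)
          where
          s = Φ x₀ l * z l
          σ = (- 1#) ^ h
          at-x₀ : δ Fin._≟_ x₀ x₀ ≈ 1#
          at-x₀ = reflexive (cong (if_then 1# else 0#) (dec-true (x₀ Fin.≟ x₀) ≡.refl))
          zero-row : ∀ i → i ≢ x₀ → (Φ ∙ z) i ≈ 0#
          zero-row i i≢ = trans (sym (eq i)) (reflexive (cong (if_then 1# else 0#) (dec-false (i Fin.≟ x₀) i≢)))
          vanish : ∀ {s} → s ∈ K → z s ≈ 0#
          vanish = kernel-vanishes-on-cover K-covers K-small wΦ z
            (λ i ¬ci _ → zero-row i (λ { ≡.refl → ¬ci cx }))
            (λ i j ¬ci i∉K e → inj₁ (non-cover-neighbours i j ¬ci i∉K e))

-- Passage from gain graphs to the abstract setting.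

module GainTheory where

  open SpanTheory using (Field)
  open ComplexTheory using (module ComplexField)
  open ExtremalTheory using (module WeightedGraph)
  open CycleTypeTheory using (module CycleTypes)
  import Data.Integer.Base as ℤ
  import Data.Integer.Properties as ℤ
  open import Data.Integer.Solver using (module +-*-Solver)
  open import Data.List.Base using (foldr)
  open import Data.Nat.DivMod using (m*n/n≡m)
  open import Data.Nat.Divisibility using (_∣_; divides)

  clear-subtraction : ∀ {rΦ rG e n w} →
    ℤ.+ rΦ ≡ ℤ.+ rG ℤ.+ ℤ.+ 2 ℤ.* (ℤ.+ e ℤ.- ℤ.+ n ℤ.+ ℤ.+ w) →
    rΦ ℕ.+ (n ℕ.+ n) ≡ rG ℕ.+ ((e ℕ.+ w) ℕ.+ (e ℕ.+ w))
  clear-subtraction {rΦ} {rG} {e} {n} {w} eq = ℤ.+-injective (≡.trans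
    (cong (ℤ._+ (ℤ.+ n ℤ.+ ℤ.+ n)) eq)
    (solve 4 (λ r e n w → (r :+ con (ℤ.+ 2) :* (e :- n :+ w)) :+ (n :+ n) := r :+ ((e :+ w) :+ (e :+ w)))
      ≡.refl (ℤ.+ rG) (ℤ.+ e) (ℤ.+ n) (ℤ.+ w)))
    where open +-*-Solver using (solve; _:+_; _:*_; _:-_; _:=_; con)

  n+n≡n*2 : ∀ n → n ℕ.+ n ≡ n ℕ.* 2
  n+n≡n*2 n = ≡.trans (cong (n ℕ.+_) (≡.sym (ℕ.+-identityʳ n))) (ℕ.*-comm 2 n)

  module GainGraphs (ℝ : CompleteOrderedField) {n : ℕ} (Φ : Gain.GainGraph ℝ n) where
    open Gain ℝ
    open GainGraph Φ
    open ComplexField ℝ public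
    open Field complexField using (_≈_; _*_; 0#; 1#; -_; trans; sym; refl; *-cong; *-congˡ; *-identityˡ)
    open WeightedGraph complexField graph

    adjacency-off : ∀ {x y} → ¬ x ~ y → adjacencyMatrix graph x y ≈ 0#
    adjacency-off {x} {y} ≁ with x ~? y
    ... | yes e = contradiction e ≁
    ... | no _  = refl

    adjacency-on : ∀ {x y} → x ~ y → adjacencyMatrix graph x y ≈ 1#
    adjacency-on {x} {y} e with x ~? y
    ... | yes _ = refl
    ... | no ≁  = contradiction e ≁

    adjacency-sym : ∀ x y → adjacencyMatrix graph x y ≈ adjacencyMatrix graph y x
    adjacency-sym x y with x ~? y | y ~? x
    ... | yes _ | yes _ = refl
    ... | yes e | no ≁  = contradiction (sym-~ e) ≁
    ... | no ≁  | yes e = contradiction (sym-~ e) ≁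
    ... | no _  | no _  = refl

    gain-off : ∀ {x y} → ¬ x ~ y → A x y ≈ 0#
    gain-off {x} {y} ≁ with x ~? y
    ... | yes e = contradiction e ≁
    ... | no _  = refl

    gain-on : ∀ {x y} → x ~ y → A x y ≈ φ x y
    gain-on {x} {y} e with x ~? y
    ... | yes _ = refl
    ... | no ≁  = contradiction e ≁

    adjacency-weighted : Weighted (adjacencyMatrix graph)
    adjacency-weighted = record
      { off = λ {x} {y} → adjacency-off {x} {y}
      ; inv = λ {x} {y} e → trans
          (*-cong {adjacencyMatrix graph x y} {1#} {adjacencyMatrix graph y x} {1#} (adjacency-on e) (adjacency-on (sym-~ e)))
          (*-identityˡ 1#)
      }

    gain-weighted : Weighted A
    gain-weighted = record
      { off = λ {x} {y} → gain-off {x} {y}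
      ; inv = λ {x} {y} e → trans
          (*-cong {A x y} {φ x y} {A y x} {φ y x} (gain-on e) (gain-on (sym-~ e)))
          (trans (*-congˡ {φ x y} {φ y x} (φ-conj e)) (unit-modulus (φ x y) (φ-unit e)))
      }

    product : (Fin n → Fin n → ℂ.ℂ) → List (Fin n × Fin n) → ℂ.ℂ
    product M es = foldr _*_ 1# (map (λ (u , v) → M u v) es)

    -- The matrix entries agree with `φ` only on edges, so the steps must be known to be edges.
    gain≈stepGain : ∀ es → All (λ (u , v) → u ~ v) es → product A es ≈ product φ es
    gain≈stepGain []             []       = refl
    gain≈stepGain ((u , v) ∷ es) (e ∷ p) =
      *-cong {A u v} {φ u v} {product A es} {product φ es} (gain-on e) (gain≈stepGain es p)

    module Extreme {rΦ rG} (RΦ : Complex.HasRank ℝ A rΦ) (RG : GraphRank graph rG)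
             (equality : ℤ.+ rΦ ≡ ℤ.+ rG ℤ.+ ℤ.+ 2 ℤ.* θ) where

      extremal-graph : Extremal
      extremal-graph = record
        { wA = adjacency-weighted ; A-sym = adjacency-sym ; A-one = adjacency-on ; wΦ = gain-weighted
        ; RA = RG ; RΦ = RΦ ; extremal = clear-subtraction {rΦ} {rG} {∣E∣} {n} {ω} equality }

      open CycleTypes complexField graph extremal-graph public
        using (pairwiseDisjoint; rank-T; rank-Γ; rank-G; μ; O-complete; even-length; half-length-odd; gain-not-critical)

      cycle-type : ∀ c → IsCycle c → TypeB c × 4 ∣ length c
      cycle-type [] (() , _)
      cycle-type (_ ∷ []) (s≤s () , _)
      cycle-type c@(x₀ ∷ x₁ ∷ ws) cyc = from-half (even-length cyc {proj₁ (O-complete cyc)} (proj₂ (O-complete cyc)))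
        where
        from-half : (∃[ h ] length c ≡ h ℕ.+ h) → TypeB c × 4 ∣ length c
        from-half (zero , ())
        from-half (suc h , eq) = (divides (suc h) length≡ , not-critical) , four (half-length-odd cyc {h} length-ws)
          where
          length-ws : length ws ≡ h ℕ.+ h
          length-ws = ℕ.suc-injective (ℕ.suc-injective (≡.trans eq (cong suc (ℕ.+-suc h h))))
          length≡ : length c ≡ suc h ℕ.* 2
          length≡ = ≡.trans eq (n+n≡n*2 (suc h))
          half : length c ℕ./ 2 ≡ suc h
          half = ≡.trans (cong (ℕ._/ 2) length≡) (m*n/n≡m (suc h) 2)
          not-critical : ¬ (gain c ≈ Complex._^_ ℝ (- 1#) (length c ℕ./ 2))
          not-critical p = gain-not-critical cyc {h} length-ws
            (trans {product A (steps c)} {gain c} {Complex._^_ ℝ (- 1#) (suc h)} (gain≈stepGain (steps c) (proj₂ (proj₂ cyc)))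
              (subst (λ k → gain c ≈ Complex._^_ ℝ (- 1#) k) half p))
          -- With h = 2m + 1 the length 2(h + 1) equals 4(m + 1).
          four : (∃[ m ] h ≡ suc (m ℕ.+ m)) → 4 ∣ length c
          four (m , ≡.refl) = divides (suc m) (≡.trans length≡ (≡.trans
            (cong (ℕ._* 2) (≡.trans (cong suc (≡.sym (ℕ.+-suc m m))) (n+n≡n*2 (suc m)))) (ℕ.*-assoc (suc m) 2 2)))

open import Data.Integer.Base using (+_) renaming (_+_ to _+ℤ_; _*_ to _*ℤ_)
open import Data.List.Base using (length; map; sum)
open import Data.Nat.Base using (ℕ; _+_; _∸_)
open import Data.Nat.Divisibility using (_∣_)
open import Data.Product.Base using (∃-syntax; _×_; _,_)
open import Relation.Binary.PropositionalEquality using (_≡_; refl)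

theorem4p7 : (ℝ : CompleteOrderedField) (let open Complex ℝ using (HasRank)) (let open Gain ℝ)
    (n : ℕ) (Φ : GainGraph n) (let open GainGraph Φ) →
    (rΦ rG : ℕ) → HasRank A rΦ → GraphRank graph rG →
    + rΦ ≡ + rG +ℤ + 2 *ℤ θ →
    PairwiseDisjointCycles
    × (∀ c → IsCycle c → TypeB c × 4 ∣ length c)
    × (∃[ rT ] ∃[ rΓ ] (GraphRank T rT × GraphRank Γ rΓ
    × rG ≡ rT + sum (map (λ c → length c ∸ 2) 𝒞)
    × rT ≡ rΓ))
theorem4p7 ℝ n Φ rΦ rG RΦ RG equality =
  pairwiseDisjoint , cycle-type , (μ + μ , μ + μ , rank-T , rank-Γ , rank-G , refl)
  where
  open GainTheory.GainGraphs ℝ Φ using (module Extreme)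
  open Extreme RΦ RG equality
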